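{- Let $n$ and $k$ be positive integers with $k\le n$, let $\delta\in(0,1)$ and $c=10^{ -3}\delta$. Suppose $\mathcal{A}\subset\{0,1\}^n$ satisfies $|\mathcal{A}|=m=\binom{n}{\ge k}$ and $|\partial_v(\mathcal{A})|\le (1+\tfrac{c}{n})\binom{n}{k-1}$. Then $|\mathcal{A}\triangle\mathcal{H}|\le \delta\binom{n-1}{k-1}$ for some Hamming ball $\mathcal{H}$. Furthermore, if $|\mathcal{A}\triangle\mathcal{H}|=2D$ then $|\partial_v(\mathcal{A})|\ge|\partial_v(\mathcal{J})|$, where $\mathcal{J}=\mathcal{I}_{m-D}\cup(\mathcal{I}_{m+D}\setminus\mathcal{I}_m)$.
   Context: Subsets of $[n]=\{1,\dots,n\}$ are identified with vectors in $\{0,1\}^n$; $Q_n$ is the graph on $\{0,1\}^n$ in which two vertices are adjacent iff they differ in exactly one coordinate. For $\mathcal{A}\subset\{0,1\}^n$, the vertex boundary is $\partial_v(\mathcal{A})=\{x'\in\{0,1\}^n\setminus\mathcal{A}: xx'\in E(Q_n)\text{ for some }x\in\mathcal{A}\}$. $\binom{n}{\ge k}=\sum_{i=k}^n\binom{n}{i}$. A Hamming ball is a set $\mathcal{B}^n_r(C)=\{A\subset[n]:|A\triangle C|\le r\}$ for some $C\subset[n]$ and $r\ge 0$. The simplicial order on subsets of $[n]$ is: $A<B$ if $|A|>|B|$, or $|A|=|B|$ and $\max(A\triangle B)\in B$; $\mathcal{I}_m$ denotes the initial segment of size $m$ of this order. -}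

module Defs where

open import Data.Bool using (Bool; true; false; not; _∧_; _∨_; _xor_; if_then_else_)
open import Data.Nat using (ℕ; zero; suc; _+_; _∸_; _≤ᵇ_; _<ᵇ_; _≡ᵇ_)
open import Data.Nat.Combinatorics using (_C_)
open import Data.Fin using (Fin)
open import Data.Vec using (Vec; []; _∷_; _[_]%=_)
open import Data.List using (List; _∷_; []; map; _++_; allFin; upTo)
open import Data.Nat.ListAction using (sum)
open import Data.Bool.ListAction using (any)

-- Vertices of Q_n: x ∈ {0,1}^n, position i (Fin n) ↔ element i+1 of [n].
Cube : ℕ → Set
Cube n = Vec Bool n

Family : ℕ → Set
Family n = Cube n → Bool

allVecs : (n : ℕ) → List (Cube n)
allVecs zero = [] ∷ []
allVecs (suc n) = map (true ∷_) (allVecs n) ++ map (false ∷_) (allVecs n)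

card : {n : ℕ} → Family n → ℕ
card {n} A = sum (map (λ x → if A x then 1 else 0) (allVecs n))

flipAt : {n : ℕ} → Fin n → Cube n → Cube n
flipAt i x = x [ i ]%= not

vboundary : {n : ℕ} → Family n → Family n
vboundary {n} A x = not (A x) ∧ any (λ i → A (flipAt i x)) (allFin n)

_△_ : {n : ℕ} → Family n → Family n → Family n
(A △ B) x = A x xor B x

_∪_ : {n : ℕ} → Family n → Family n → Family n
(A ∪ B) x = A x ∨ B x

_∖_ : {n : ℕ} → Family n → Family n → Family n
(A ∖ B) x = A x ∧ not (B x)

hdist : {n : ℕ} → Cube n → Cube n → ℕ
hdist [] [] = 0
hdist (a ∷ as) (c ∷ cs) = (if a xor c then 1 else 0) + hdist as cs

ball : {n : ℕ} → Cube n → ℕ → Family n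
ball C r x = hdist x C ≤ᵇ r

binomGe : ℕ → ℕ → ℕ
binomGe n k = sum (map (λ i → if k ≤ᵇ i then n C i else 0) (upTo (suc n)))

weight : {n : ℕ} → Cube n → ℕ
weight [] = 0
weight (a ∷ as) = (if a then 1 else 0) + weight as

vecEq : {n : ℕ} → Cube n → Cube n → Bool
vecEq [] [] = true
vecEq (a ∷ as) (b ∷ bs) = not (a xor b) ∧ vecEq as bs

-- maxIn A B = "A ≠ B and max(A △ B) ∈ B" (later positions = larger elements)
maxIn : {n : ℕ} → Cube n → Cube n → Bool
maxIn [] [] = false
maxIn (a ∷ as) (b ∷ bs) = if vecEq as bs then not a ∧ b else maxIn as bs

simpLess : {n : ℕ} → Cube n → Cube n → Bool
simpLess A B = (weight B <ᵇ weight A) ∨ ((weight A ≡ᵇ weight B) ∧ maxIn A B)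

rank : {n : ℕ} → Cube n → ℕ
rank x = card (λ y → simpLess y x)

initSeg : {n : ℕ} → ℕ → Family n
initSeg m x = rank x <ᵇ m

-- Write nb A for the closed neighbourhood of A, so that |∂A| = |nb A| - |A|, and put k = j + 1,
-- n = j + i + 1, M = C(n - 1, k - 1) = C(j + i, j).
--
-- Harper's theorem: a (U, V)-compression replaces V by U in the members of A.  If A is already
-- compressed for all smaller pairs, this does not increase |nb A|; iterating first over pairs with
-- |U| = |V| + 1 and then over pairs with |U| = |V| ends in an initial segment of the simplicial order.
--
-- Local stability: let H be a Hamming ball of size |A| and D = |A ∖ H|.  By submodularity of nb,
-- |nb A| + |nb H| ≥ |nb (A ∩ H)| + |nb (A ∪ H)|, and Harper's theorem applies to both families on
-- the right.  This gives |∂A| ≥ |∂J|, and, by a shadow estimate for colexicographic segments,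
-- (i + 1) (|∂A| - C(n, k - 1)) ≥ D (M - D) / M.  Hence |A △ H| = 2 D cannot take values between a
-- small multiple of M and slightly more than M.
--
-- Global stability: go back along the compressions from the initial segment.  A compression with
-- U = {u}, V = ∅ moves A away from H or from the ball with the u-th coordinate of its centre flipped
-- by at most M; one with V ≠ ∅, applied to an up-set, moves A away from H by at most M.  By the gap
-- the distance to the nearest ball therefore stays small throughout.

module Submission where

open import Defs
open import Data.Bool using (Bool; T; true; false; not; _∧_; _∨_; _xor_; if_then_else_)
open import Data.Bool.Properties using (xor-identityʳ; xor-comm; xor-assoc)
import Data.Bool.Properties as Bool
open import Data.Empty using (⊥; ⊥-elim)
open import Data.Fin using (Fin; zero; suc)
open import Data.List using ([]; _∷_; map; _++_; upTo; applyUpTo; allFin; tabulate)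
open import Data.List.Properties using (map-++; map-∘; map-applyUpTo)
open import Data.Bool.ListAction using (any)
open import Data.Nat using (ℕ; >-nonZero; zero; suc; _+_; _*_; _∸_; _^_; _≤_; _<_; z≤n; s≤s; _≤ᵇ_; _<ᵇ_; _≡ᵇ_; _≤?_; _<?_; _≟_)
open import Data.Nat.Combinatorics using (_C_; nCk+nC[k+1]≡[n+1]C[k+1]; k>n⇒nCk≡0; nCn≡1; nCk≡nC[n∸k])
open import Data.Nat.ListAction using (sum)
open import Data.Nat.ListAction.Properties using (sum-++)
open import Data.Nat.Properties
open import Data.Nat.Tactic.RingSolver using (solve-∀)
open import Data.Product using (Σ; _×_; _,_; proj₁; proj₂; ∃; ∃-syntax)
open import Data.Sum using (_⊎_; inj₁; inj₂; [_,_]′)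
open import Data.Unit using (tt)
open import Data.Vec using ([]; _∷_; _∷ʳ_; replicate; last; initLast)
open import Data.Vec.Properties using (last-∷ʳ)
open import Function using (_∘_; case_of_)
open import Relation.Binary.PropositionalEquality using (_≡_; _≢_; refl; sym; trans; cong; cong₂; subst; subst₂; module ≡-Reasoning)
open import Relation.Binary.Definitions using (tri<; tri≈; tri>)
open import Relation.Nullary using (¬_; Dec; yes; no)
open import Relation.Nullary.Decidable using (_×-dec_)

-- The factor M - D in the local estimate is unavoidable. Flipping one coordinate of the centre of a
-- ball H gives a ball of the same boundary size at distance 2 M from H, so D = M can force no
-- surplus. The gap around distance M therefore lies half way between two adjacent balls, and each
-- backward step must change the distance by at most M to end inside it.
--
-- For U = {u}, V = ∅ a fixed ball is too coarse: it may separate pairs with 2 M members in all.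
-- Hence H is considered together with its flip in the coordinate u. The distances of A to these two
-- balls add up to at most 2 (d + M), where d is the distance from the compressed family to H, so
-- one of them is at most d + M.
--
-- For V ≠ ∅ the centre can be kept. Compressions of smallest level come first, so these are applied
-- only to up-sets, and they keep up-sets up-sets. The chain from an up-set down to `atLeast` thus
-- never needs U = {u}, V = ∅ again, and one centre, the full set, serves all its members.

ind : Bool → ℕ
ind b = if b then 1 else 0

-- Recursion on the first coordinate makes the splitting of a sum by its head definitional, which
-- the concatenated lists behind `card` do not give.
sumC : ∀ {n} → (Cube n → ℕ) → ℕ
sumC {zero} f = f []
sumC {suc n} f = sumC (f ∘ (true ∷_)) + sumC (f ∘ (false ∷_))

infix 9 #_
#_ : ∀ {n} → Family n → ℕ
# A = sumC (ind ∘ A)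

infix 4 _∈_
_∈_ : ∀ {n} → Cube n → Family n → Set
x ∈ A = A x ≡ true

infix 4 _⊆_
_⊆_ : ∀ {n} → Family n → Family n → Set
A ⊆ B = ∀ x → x ∈ A → x ∈ B

∈? : ∀ {n} (A : Family n) x → x ∈ A ⊎ A x ≡ false
∈? A x with A x
... | true = inj₁ refl
... | false = inj₂ refl

∈∉-absurd : ∀ {b : Bool} {P : Set} → b ≡ true → b ≡ false → P
∈∉-absurd refl ()

sum-map-allVecs : ∀ n (f : Cube n → ℕ) → sum (map f (allVecs n)) ≡ sumC f
sum-map-allVecs zero f = +-identityʳ (f [])
sum-map-allVecs (suc n) f = begin
  sum (map f (map (true ∷_) (allVecs n) ++ map (false ∷_) (allVecs n)))
    ≡⟨ cong sum (map-++ f (map (true ∷_) (allVecs n)) _) ⟩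
  sum (map f (map (true ∷_) (allVecs n)) ++ map f (map (false ∷_) (allVecs n)))
    ≡⟨ sum-++ (map f (map (true ∷_) (allVecs n))) _ ⟩
  sum (map f (map (true ∷_) (allVecs n))) + sum (map f (map (false ∷_) (allVecs n)))
    ≡⟨ cong₂ _+_ (half true) (half false) ⟩
  sumC (f ∘ (true ∷_)) + sumC (f ∘ (false ∷_)) ∎
  where
  open ≡-Reasoning
  half : ∀ b → sum (map f (map (b ∷_) (allVecs n))) ≡ sumC (f ∘ (b ∷_))
  half b = trans (cong sum (sym (map-∘ (allVecs n)))) (sum-map-allVecs n (f ∘ (b ∷_)))

card≡# : ∀ {n} (A : Family n) → card A ≡ # A
card≡# {n} A = sum-map-allVecs n (ind ∘ A)

sumC-cong : ∀ {n} {f g : Cube n → ℕ} → (∀ x → f x ≡ g x) → sumC f ≡ sumC g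
sumC-cong {zero} h = h []
sumC-cong {suc n} h = cong₂ _+_ (sumC-cong (λ x → h (true ∷ x))) (sumC-cong (λ x → h (false ∷ x)))

sumC-mono : ∀ {n} {f g : Cube n → ℕ} → (∀ x → f x ≤ g x) → sumC f ≤ sumC g
sumC-mono {zero} h = h []
sumC-mono {suc n} h = +-mono-≤ (sumC-mono (λ x → h (true ∷ x))) (sumC-mono (λ x → h (false ∷ x)))

sumC-mono-< : ∀ {n} {f g : Cube n → ℕ} → (∀ x → f x ≤ g x) → ∀ y → f y < g y → sumC f < sumC g
sumC-mono-< h [] p = p
sumC-mono-< h (true ∷ y) p = +-mono-<-≤ (sumC-mono-< (λ x → h (true ∷ x)) y p) (sumC-mono (λ x → h (false ∷ x)))
sumC-mono-< h (false ∷ y) p = +-mono-≤-< (sumC-mono (λ x → h (true ∷ x))) (sumC-mono-< (λ x → h (false ∷ x)) y p)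

+-interchange : ∀ a b c d → (a + b) + (c + d) ≡ (a + c) + (b + d)
+-interchange = solve-∀

sumC-+ : ∀ {n} (f g : Cube n → ℕ) → sumC (λ x → f x + g x) ≡ sumC f + sumC g
sumC-+ {zero} f g = refl
sumC-+ {suc n} f g = trans
  (cong₂ _+_ (sumC-+ (f ∘ (true ∷_)) (g ∘ (true ∷_))) (sumC-+ (f ∘ (false ∷_)) (g ∘ (false ∷_))))
  (+-interchange (sumC (f ∘ (true ∷_))) _ _ _)

sumC-zero : ∀ n → sumC {n} (λ _ → 0) ≡ 0
sumC-zero zero = refl
sumC-zero (suc n) = cong₂ _+_ (sumC-zero n) (sumC-zero n)

sumC-*ʳ : ∀ {n} (f : Cube n → ℕ) c → sumC (λ x → f x * c) ≡ sumC f * c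
sumC-*ʳ {zero} f c = refl
sumC-*ʳ {suc n} f c = trans (cong₂ _+_ (sumC-*ʳ (f ∘ (true ∷_)) c) (sumC-*ʳ (f ∘ (false ∷_)) c))
  (sym (*-distribʳ-+ c (sumC (f ∘ (true ∷_))) _))

-- Colexicographic arguments split off the largest element, which is the last coordinate, while
-- vectors recurse on the first.
sumC-snoc : ∀ {n} (f : Cube (suc n) → ℕ) →
  sumC f ≡ sumC (λ x → f (x ∷ʳ false)) + sumC (λ x → f (x ∷ʳ true))
sumC-snoc {zero} f = +-comm (f (true ∷ [])) _
sumC-snoc {suc n} f = trans (cong₂ _+_ (sumC-snoc (f ∘ (true ∷_))) (sumC-snoc (f ∘ (false ∷_))))
  (+-interchange (sumC (λ x → f (true ∷ (x ∷ʳ false)))) _ _ _)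

infixl 6 _⊕_
_⊕_ : ∀ {n} → Cube n → Cube n → Cube n
[] ⊕ [] = []
(a ∷ x) ⊕ (b ∷ y) = (a xor b) ∷ (x ⊕ y)

sumC-⊕ : ∀ {n} (f : Cube n → ℕ) m → sumC (λ x → f (x ⊕ m)) ≡ sumC f
sumC-⊕ f [] = refl
sumC-⊕ f (false ∷ m) = cong₂ _+_ (sumC-⊕ (f ∘ (true ∷_)) m) (sumC-⊕ (f ∘ (false ∷_)) m)
sumC-⊕ f (true ∷ m) = trans (+-comm (sumC (λ x → f (false ∷ (x ⊕ m)))) _)
  (cong₂ _+_ (sumC-⊕ (f ∘ (true ∷_)) m) (sumC-⊕ (f ∘ (false ∷_)) m))

⊕-cancelʳ : ∀ {n} (x m : Cube n) → x ⊕ m ⊕ m ≡ x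
⊕-cancelʳ [] [] = refl
⊕-cancelʳ (a ∷ x) (b ∷ m) = cong₂ _∷_ (lem a b) (⊕-cancelʳ x m)
  where
  lem : ∀ a b → (a xor b) xor b ≡ a
  lem true true = refl
  lem true false = refl
  lem false true = refl
  lem false false = refl

ind≤1 : ∀ b → ind b ≤ 1
ind≤1 true = ≤-refl
ind≤1 false = z≤n

ind-mono : ∀ {a b} → (a ≡ true → b ≡ true) → ind a ≤ ind b
ind-mono {false} h = z≤n
ind-mono {true} h rewrite h refl = ≤-refl

#-mono : ∀ {n} {A B : Family n} → A ⊆ B → # A ≤ # B
#-mono h = sumC-mono (λ x → ind-mono (h x))

#-mono-< : ∀ {n} {A B : Family n} → A ⊆ B → ∀ y → A y ≡ false → y ∈ B → # A < # B
#-mono-< {A = A} {B} h y y∉A y∈B = sumC-mono-< (λ x → ind-mono (h x)) y lem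
  where
  lem : ind (A y) < ind (B y)
  lem rewrite y∉A | y∈B = ≤-refl

#-cong : ∀ {n} {A B : Family n} → (∀ x → A x ≡ B x) → # A ≡ # B
#-cong h = sumC-cong (λ x → cong ind (h x))

#-xor : ∀ {n} (A : Family n) m → # (λ x → A (x ⊕ m)) ≡ # A
#-xor A m = sumC-⊕ (ind ∘ A) m

#-full : ∀ n → # (λ (_ : Cube n) → true) ≡ 2 ^ n
#-full zero = refl
#-full (suc n) = cong₂ _+_ (#-full n) (trans (#-full n) (sym (+-identityʳ (2 ^ n))))

#-complement : ∀ {n} (A : Family n) → # (not ∘ A) + # A ≡ 2 ^ n
#-complement {n} A = trans (sym (sumC-+ (ind ∘ not ∘ A) (ind ∘ A)))
  (trans (sumC-cong (λ x → lem (A x))) (#-full n))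
  where
  lem : ∀ a → ind (not a) + ind a ≡ 1
  lem true = refl
  lem false = refl

#-∪ : ∀ {n} {A B C : Family n} → (∀ x → x ∈ A → x ∈ B ⊎ x ∈ C) → # A ≤ # B + # C
#-∪ {A = A} {B} {C} h = ≤-trans (sumC-mono lem) (≤-reflexive (sumC-+ (ind ∘ B) (ind ∘ C)))
  where
  lem : ∀ x → ind (A x) ≤ ind (B x) + ind (C x)
  lem x with A x in eq
  ... | false = z≤n
  ... | true with h x eq
  ... | inj₁ p rewrite p = s≤s z≤n
  ... | inj₂ p rewrite p = m≤n+m 1 (ind (B x))

#-⊎ : ∀ {n} {A B C : Family n} → B ⊆ A → C ⊆ A → (∀ x → x ∈ B → x ∈ C → ⊥) → # B + # C ≤ # A
#-⊎ {A = A} {B} {C} hB hC disj = ≤-trans (≤-reflexive (sym (sumC-+ (ind ∘ B) (ind ∘ C)))) (sumC-mono lem)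
  where
  lem : ∀ x → ind (B x) + ind (C x) ≤ ind (A x)
  lem x with B x in eqB | C x in eqC
  ... | true | true = ⊥-elim (disj x eqB eqC)
  ... | true | false rewrite hB x eqB = ≤-refl
  ... | false | true rewrite hC x eqC = ≤-refl
  ... | false | false = z≤n

∧-true : ∀ {a b} → a ∧ b ≡ true → a ≡ true × b ≡ true
∧-true {true} {true} _ = refl , refl

not-true : ∀ {b} → not b ≡ true → b ≡ false
not-true {false} _ = refl

∨-true : ∀ {a b} → a ∨ b ≡ true → a ≡ true ⊎ b ≡ true
∨-true {true} _ = inj₁ refl
∨-true {false} h = inj₂ h

∨-trueʳ : ∀ a {b} → b ≡ true → a ∨ b ≡ true
∨-trueʳ true _ = refl
∨-trueʳ false h = h

∨-trueˡ : ∀ {a b} → a ≡ true → a ∨ b ≡ true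
∨-trueˡ refl = refl

-- Closed neighbourhoods

-- The covering relation of the subset order.
data Up : ∀ {n} → Cube n → Cube n → Set where
  here  : ∀ {n} {x : Cube n} → Up (false ∷ x) (true ∷ x)
  there : ∀ {n} {b} {x y : Cube n} → Up x y → Up (b ∷ x) (b ∷ y)

Adj : ∀ {n} → Cube n → Cube n → Set
Adj x y = Up x y ⊎ Up y x

Adj-sym : ∀ {n} {x y : Cube n} → Adj x y → Adj y x
Adj-sym (inj₁ u) = inj₂ u
Adj-sym (inj₂ u) = inj₁ u

Adj-there : ∀ {n} {b} {x y : Cube n} → Adj x y → Adj (b ∷ x) (b ∷ y)
Adj-there (inj₁ u) = inj₁ (there u)
Adj-there (inj₂ u) = inj₂ (there u)

flipAt-Adj : ∀ {n} (i : Fin n) x → Adj x (flipAt i x)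
flipAt-Adj zero (true ∷ x) = inj₂ here
flipAt-Adj zero (false ∷ x) = inj₁ here
flipAt-Adj (suc i) (b ∷ x) = Adj-there (flipAt-Adj i x)

Up-flipAt : ∀ {n} {x y : Cube n} → Up x y → ∃[ i ] flipAt i x ≡ y × flipAt i y ≡ x
Up-flipAt here = zero , refl , refl
Up-flipAt {x = b ∷ _} (there u) with Up-flipAt u
... | i , p , q = suc i , cong (b ∷_) p , cong (b ∷_) q

Adj-flipAt : ∀ {n} {x y : Cube n} → Adj x y → ∃[ i ] flipAt i x ≡ y
Adj-flipAt (inj₁ u) with Up-flipAt u
... | i , p , q = i , p
Adj-flipAt (inj₂ u) with Up-flipAt u
... | i , p , q = i , q

any-tabulate-elim : ∀ {A : Set} n (P : A → Bool) (f : Fin n → A) →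
  any P (tabulate f) ≡ true → ∃[ i ] P (f i) ≡ true
any-tabulate-elim (suc n) P f h with ∨-true {P (f zero)} h
... | inj₁ p = zero , p
... | inj₂ q with any-tabulate-elim n P (f ∘ suc) q
... | i , p = suc i , p

any-tabulate-intro : ∀ {A : Set} n (P : A → Bool) (f : Fin n → A) i →
  P (f i) ≡ true → any P (tabulate f) ≡ true
any-tabulate-intro (suc n) P f zero p = ∨-trueˡ p
any-tabulate-intro (suc n) P f (suc i) p = ∨-trueʳ (P (f zero)) (any-tabulate-intro n P (f ∘ suc) i p)

nb : ∀ {n} → Family n → Family n
nb {n} A x = A x ∨ any (λ i → A (flipAt i x)) (allFin n)

nb-elim : ∀ {n} (A : Family n) x → x ∈ nb A → x ∈ A ⊎ ∃[ y ] Adj x y × y ∈ A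
nb-elim {n} A x h with ∨-true {A x} h
... | inj₁ p = inj₁ p
... | inj₂ q with any-tabulate-elim n (λ i → A (flipAt i x)) (λ i → i) q
... | i , p = inj₂ (flipAt i x , flipAt-Adj i x , p)

⊆-nb : ∀ {n} (A : Family n) → A ⊆ nb A
⊆-nb A x p = ∨-trueˡ p

nb-intro : ∀ {n} (A : Family n) {x y} → Adj x y → y ∈ A → x ∈ nb A
nb-intro {n} A {x} {y} a p with Adj-flipAt a
... | i , eq = ∨-trueʳ (A x) (any-tabulate-intro n (λ i → A (flipAt i x)) (λ i → i) i (trans (cong A eq) p))

nb-mono : ∀ {n} {A B : Family n} → A ⊆ B → nb A ⊆ nb B
nb-mono {A = A} {B} h x p with nb-elim A x p
... | inj₁ q = ⊆-nb B x (h x q)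
... | inj₂ (y , a , q) = nb-intro B a (h y q)

#-nb : ∀ {n} (A : Family n) → # nb A ≡ # A + # vboundary A
#-nb A = trans (sumC-cong (λ x → lem (A x) _)) (sumC-+ (ind ∘ A) _)
  where
  lem : ∀ a b → ind (a ∨ b) ≡ ind a + ind (not a ∧ b)
  lem true b = refl
  lem false b = refl

-- Holds vertex by vertex: a vertex near A ∩ B is near both families, and closed neighbourhoods
-- commute with unions.
nb-submodular : ∀ {n} (A B : Family n) →
  # nb (λ x → A x ∧ B x) + # nb (λ x → A x ∨ B x) ≤ # nb A + # nb B
nb-submodular A B = ≤-trans (≤-reflexive (sym (sumC-+ (ind ∘ nb (λ x → A x ∧ B x)) _)))
  (≤-trans (sumC-mono pointwise) (≤-reflexive (sumC-+ (ind ∘ nb A) _)))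
  where
  lem : ∀ i u a b → (i ≡ true → a ≡ true × b ≡ true) → (u ≡ true → a ≡ true ⊎ b ≡ true) →
        ind i + ind u ≤ ind a + ind b
  lem true u a b h _ with h refl
  ... | refl , refl = s≤s (ind≤1 u)
  lem false false a b _ _ = z≤n
  lem false true a b _ h with h refl
  ... | inj₁ refl = s≤s z≤n
  ... | inj₂ refl = m≤n+m 1 (ind a)
  union : ∀ x → x ∈ nb (λ x → A x ∨ B x) → x ∈ nb A ⊎ x ∈ nb B
  union x p with nb-elim (λ x → A x ∨ B x) x p
  ... | inj₁ q with ∨-true {A x} q
  ... | inj₁ r = inj₁ (⊆-nb A x r)
  ... | inj₂ r = inj₂ (⊆-nb B x r)
  union x p | inj₂ (y , a , q) with ∨-true {A y} q
  ... | inj₁ r = inj₁ (nb-intro A a r)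
  ... | inj₂ r = inj₂ (nb-intro B a r)
  pointwise : ∀ x → ind (nb (λ x → A x ∧ B x) x) + ind (nb (λ x → A x ∨ B x) x)
              ≤ ind (nb A x) + ind (nb B x)
  pointwise x = lem _ _ _ _
    (λ p → nb-mono {A = λ x → A x ∧ B x} {A} (λ y q → proj₁ (∧-true {A y} {B y} q)) x p ,
           nb-mono {A = λ x → A x ∧ B x} {B} (λ y q → proj₂ (∧-true {A y} {B y} q)) x p)
    (union x)

-- Layer sizes

weight≤n : ∀ {n} (x : Cube n) → weight x ≤ n
weight≤n [] = z≤n
weight≤n (true ∷ x) = s≤s (weight≤n x)
weight≤n (false ∷ x) = m≤n⇒m≤1+n (weight≤n x)

weight-snoc : ∀ {n} (x : Cube n) b → weight (x ∷ʳ b) ≡ ind b + weight x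
weight-snoc [] b = refl
weight-snoc (a ∷ x) b = trans (cong (ind a +_) (weight-snoc x b)) (lem (ind a) (ind b) (weight x))
  where
  lem : ∀ a b w → a + (b + w) ≡ b + (a + w)
  lem = solve-∀

layer : ∀ {n} → ℕ → Family n
layer j x = weight x ≡ᵇ j

≡ᵇ-true : ∀ m n → (m ≡ᵇ n) ≡ true → m ≡ n
≡ᵇ-true m n h = ≡ᵇ⇒≡ m n (subst T (sym h) tt)

≡ᵇ-refl : ∀ m → (m ≡ᵇ m) ≡ true
≡ᵇ-refl zero = refl
≡ᵇ-refl (suc m) = ≡ᵇ-refl m

≡⇒≡ᵇ-true : ∀ {m n} → m ≡ n → (m ≡ᵇ n) ≡ true
≡⇒≡ᵇ-true {m} refl = ≡ᵇ-refl m

T⇒true : ∀ {b} → T b → b ≡ true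
T⇒true {true} _ = refl

≤ᵇ-true : ∀ m n → (m ≤ᵇ n) ≡ true → m ≤ n
≤ᵇ-true m n h = ≤ᵇ⇒≤ m n (subst T (sym h) tt)

≤⇒≤ᵇ-true : ∀ {m n} → m ≤ n → (m ≤ᵇ n) ≡ true
≤⇒≤ᵇ-true h = T⇒true (≤⇒≤ᵇ h)

<ᵇ-true : ∀ m n → (m <ᵇ n) ≡ true → m < n
<ᵇ-true m n h = <ᵇ⇒< m n (subst T (sym h) tt)

<⇒<ᵇ-true : ∀ {m n} → m < n → (m <ᵇ n) ≡ true
<⇒<ᵇ-true h = T⇒true (<⇒<ᵇ h)

C-zero : ∀ n → n C 0 ≡ 1
C-zero n = trans (nCk≡nC[n∸k] {0} {n} z≤n) (nCn≡1 n)

#-layer : ∀ n j → # layer {n} j ≡ n C j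
#-layer zero zero = refl
#-layer zero (suc j) = sym (k>n⇒nCk≡0 {0} {suc j} (s≤s z≤n))
#-layer (suc n) zero = trans (cong₂ _+_ (sumC-zero n) (#-layer n 0)) (trans (C-zero n) (sym (C-zero (suc n))))
#-layer (suc n) (suc j) = trans (cong₂ _+_ (#-layer n j) (#-layer n (suc j))) (nCk+nC[k+1]≡[n+1]C[k+1] n j)

-- Subtraction-free form of (j + 1) C(n, j + 1) = (n - j) C(n, j), so no condition j ≤ n is carried
-- along. Pascal's rule reduces it to the indices j and j + 1 at the preceding n.
absorb : ∀ n j → (n C suc j) * suc j + (n C j) * j ≡ (n C j) * n
absorb zero zero = refl
absorb zero (suc j) rewrite k>n⇒nCk≡0 {0} {suc j} (s≤s z≤n) | k>n⇒nCk≡0 {0} {suc (suc j)} (s≤s z≤n) = refl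
absorb (suc n) zero = begin
  (suc n C 1) * 1 + (suc n C 0) * 0 ≡⟨ cong₂ (λ u v → u * 1 + v) (sym (nCk+nC[k+1]≡[n+1]C[k+1] n 0)) (*-zeroʳ (suc n C 0)) ⟩
  ((n C 0) + (n C 1)) * 1 + 0       ≡⟨ lem (n C 0) (n C 1) ⟩
  (n C 0) + ((n C 1) * 1 + (n C 0) * 0) ≡⟨ cong ((n C 0) +_) (absorb n 0) ⟩
  (n C 0) + (n C 0) * n             ≡⟨ *-suc (n C 0) n ⟨
  (n C 0) * suc n                   ≡⟨ cong (_* suc n) (trans (C-zero n) (sym (C-zero (suc n)))) ⟩
  (suc n C 0) * suc n ∎
  where
  open ≡-Reasoning
  lem : ∀ a b → (a + b) * 1 + 0 ≡ a + (b * 1 + a * 0)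
  lem = solve-∀
absorb (suc n) (suc j) = begin
  (suc n C suc (suc j)) * suc (suc j) + (suc n C suc j) * suc j
    ≡⟨ cong₂ (λ u v → u * suc (suc j) + v * suc j)
         (sym (nCk+nC[k+1]≡[n+1]C[k+1] n (suc j))) (sym (nCk+nC[k+1]≡[n+1]C[k+1] n j)) ⟩
  (b + c) * suc (suc j) + (a + b) * suc j
    ≡⟨ lem a b c j ⟩
  (b * suc j + a * j) + (c * suc (suc j) + b * suc j) + (a + b)
    ≡⟨ cong₂ (λ u v → u + v + (a + b)) (absorb n j) (absorb n (suc j)) ⟩
  a * n + b * n + (a + b)
    ≡⟨ lem′ a b n ⟩
  (a + b) * suc n
    ≡⟨ cong (_* suc n) (nCk+nC[k+1]≡[n+1]C[k+1] n j) ⟩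
  (suc n C suc j) * suc n ∎
  where
  open ≡-Reasoning
  a = n C j
  b = n C suc j
  c = n C suc (suc j)
  lem : ∀ a b c j → (b + c) * suc (suc j) + (a + b) * suc j
        ≡ (b * suc j + a * j) + (c * suc (suc j) + b * suc j) + (a + b)
  lem = solve-∀
  lem′ : ∀ a b n → a * n + b * n + (a + b) ≡ (a + b) * suc n
  lem′ = solve-∀

C-ratio : ∀ j i → ((j + i) C suc j) * suc j ≡ ((j + i) C j) * i
C-ratio j i = +-cancelʳ-≡ (((j + i) C j) * j) _ _
  (trans (absorb (j + i) j) (lem ((j + i) C j) j i))
  where
  lem : ∀ c j i → c * (j + i) ≡ c * i + c * j
  lem = solve-∀

C-positive : ∀ j i → 0 < (j + i) C j
C-positive zero i = ≤-reflexive (sym (C-zero i))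
C-positive (suc j) i = <-≤-trans (C-positive j i)
  (≤-trans (m≤m+n _ _) (≤-reflexive (nCk+nC[k+1]≡[n+1]C[k+1] (j + i) j)))

C-suc-ratio : ∀ j i → (suc (j + i) C j) * suc i ≡ suc (j + i) * ((j + i) C j)
C-suc-ratio zero i rewrite C-zero (suc i) | C-zero i = *-comm 1 (suc i)
C-suc-ratio (suc j) i = begin
  (suc N C suc j) * suc i       ≡⟨ cong (_* suc i) (sym (nCk+nC[k+1]≡[n+1]C[k+1] N j)) ⟩
  (a + b) * suc i               ≡⟨ *-distribʳ-+ (suc i) a b ⟩
  a * suc i + b * suc i         ≡⟨ cong (_+ b * suc i) ratio ⟨
  b * suc j + b * suc i         ≡⟨ lem b j i ⟩
  suc N * b ∎
  where
  open ≡-Reasoning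
  N = suc j + i
  a = N C j
  b = N C suc j
  ratio : b * suc j ≡ a * suc i
  ratio = subst (λ M → (M C suc j) * suc j ≡ (M C j) * suc i) (+-suc j i) (C-ratio j (suc i))
  lem : ∀ b j i → b * suc j + b * suc i ≡ suc (suc j + i) * b
  lem = solve-∀

atLeast : ∀ {n} → ℕ → Family n
atLeast k x = k ≤ᵇ weight x

sum-applyUpTo-cong : ∀ {f g : ℕ → ℕ} → (∀ i → f i ≡ g i) → ∀ N → sum (applyUpTo f N) ≡ sum (applyUpTo g N)
sum-applyUpTo-cong h zero = refl
sum-applyUpTo-cong h (suc N) = cong₂ _+_ (h 0) (sum-applyUpTo-cong (λ i → h (suc i)) N)

sumC-sum : ∀ {n} (f : Cube n → ℕ → ℕ) N →
  sumC (λ x → sum (applyUpTo (f x) N)) ≡ sum (applyUpTo (λ i → sumC (λ x → f x i)) N)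
sumC-sum {n} f zero = sumC-zero n
sumC-sum f (suc N) = trans (sumC-+ (λ x → f x 0) _)
  (cong (sumC (λ x → f x 0) +_) (sumC-sum (λ x i → f x (suc i)) N))

sum-select-zero : ∀ (g : ℕ → ℕ) N → sum (applyUpTo (λ i → ind (0 ≡ᵇ suc i) * g (suc i)) N) ≡ 0
sum-select-zero g zero = refl
sum-select-zero g (suc N) = sum-select-zero (g ∘ suc) N

sum-select : ∀ (g : ℕ → ℕ) w N → w < N → sum (applyUpTo (λ i → ind (w ≡ᵇ i) * g i) N) ≡ g w
sum-select g zero (suc N) _ = trans (cong₂ _+_ (*-identityˡ (g 0)) (sum-select-zero g N)) (+-identityʳ (g 0))
sum-select g (suc w) (suc N) (s≤s h) = sum-select (g ∘ suc) w N h

binomGe≡#atLeast : ∀ n k → binomGe n k ≡ # atLeast {n} k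
binomGe≡#atLeast n k = begin
  sum (map (λ i → if k ≤ᵇ i then n C i else 0) (upTo (suc n)))
    ≡⟨ cong sum (map-applyUpTo (λ i → i) (λ i → if k ≤ᵇ i then n C i else 0) (suc n)) ⟩
  sum (applyUpTo (λ i → if k ≤ᵇ i then n C i else 0) (suc n))
    ≡⟨ sum-applyUpTo-cong layer-term (suc n) ⟩
  sum (applyUpTo (λ i → sumC (λ (x : Cube n) → ind (weight x ≡ᵇ i) * ind (k ≤ᵇ i))) (suc n))
    ≡⟨ sumC-sum {n} (λ x i → ind (weight x ≡ᵇ i) * ind (k ≤ᵇ i)) (suc n) ⟨
  sumC (λ (x : Cube n) → sum (applyUpTo (λ i → ind (weight x ≡ᵇ i) * ind (k ≤ᵇ i)) (suc n)))
    ≡⟨ sumC-cong (λ (x : Cube n) → sum-select (λ i → ind (k ≤ᵇ i)) (weight x) (suc n) (s≤s (weight≤n x))) ⟩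
  # atLeast {n} k ∎
  where
  open ≡-Reasoning
  lem : ∀ b c → (if b then c else 0) ≡ c * ind b
  lem true c = sym (*-identityʳ c)
  lem false c = sym (*-zeroʳ c)
  layer-term : ∀ i → (if k ≤ᵇ i then n C i else 0) ≡ sumC (λ (x : Cube n) → ind (weight x ≡ᵇ i) * ind (k ≤ᵇ i))
  layer-term i = trans (lem (k ≤ᵇ i) (n C i)) (trans (cong (_* ind (k ≤ᵇ i)) (sym (#-layer n i)))
    (sym (sumC-*ʳ {n} (ind ∘ layer i) (ind (k ≤ᵇ i)))))

≤ᵇ-split : ∀ j w → ind (j ≤ᵇ w) ≡ ind (w ≡ᵇ j) + ind (suc j ≤ᵇ w)
≤ᵇ-split zero zero = refl
≤ᵇ-split zero (suc w) = refl
≤ᵇ-split (suc j) zero = refl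
≤ᵇ-split (suc j) (suc w) = trans (cong ind (lem j w)) (≤ᵇ-split j w)
  where
  lem : ∀ j w → (suc j ≤ᵇ suc w) ≡ (j ≤ᵇ w)
  lem zero w = refl
  lem (suc j) w = refl

#atLeast-split : ∀ n j → # atLeast {n} j ≡ (n C j) + # atLeast {n} (suc j)
#atLeast-split n j = trans (sumC-cong (λ (x : Cube n) → ≤ᵇ-split j (weight x)))
  (trans (sumC-+ {n} (ind ∘ layer j) _) (cong (_+ # atLeast {n} (suc j)) (#-layer n j)))

ones : ∀ {n} → Cube n
ones {n} = replicate n true

weight-⊕-ones : ∀ {n} (x : Cube n) → weight (x ⊕ ones) + weight x ≡ n
weight-⊕-ones [] = refl
weight-⊕-ones (true ∷ x) = trans (+-suc _ (weight x)) (cong suc (weight-⊕-ones x))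
weight-⊕-ones (false ∷ x) = cong suc (weight-⊕-ones x)

weight≡n⇒ones : ∀ {n} (x : Cube n) → weight x ≡ n → x ≡ ones
weight≡n⇒ones [] _ = refl
weight≡n⇒ones (true ∷ x) h = cong (true ∷_) (weight≡n⇒ones x (suc-injective h))
weight≡n⇒ones (false ∷ x) h = ⊥-elim (<-irrefl h (s≤s (weight≤n x)))

atMost : ∀ {n} → ℕ → Family n
atMost r x = weight x ≤ᵇ r

bool-ext : ∀ {a b : Bool} → (a ≡ true → b ≡ true) → (b ≡ true → a ≡ true) → a ≡ b
bool-ext {true} f g = sym (f refl)
bool-ext {false} {true} f g = g refl
bool-ext {false} {false} f g = refl

#atMost≡#atLeast : ∀ r k → # atMost {k + r} r ≡ # atLeast {k + r} k
#atMost≡#atLeast r k = trans (#-cong (λ x → bool-ext (there′ x) (back x))) (#-xor (atLeast {k + r} k) ones)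
  where
  there′ : ∀ x → x ∈ atMost {k + r} r → x ⊕ ones ∈ atLeast {k + r} k
  there′ x h = ≤⇒≤ᵇ-true (+-cancelʳ-≤ r k _ (≤-trans (≤-reflexive (sym (weight-⊕-ones x))) (+-monoʳ-≤ (weight (x ⊕ ones)) (≤ᵇ-true (weight x) r h))))
  back : ∀ x → x ⊕ ones ∈ atLeast {k + r} k → x ∈ atMost {k + r} r
  back x h = ≤⇒≤ᵇ-true (+-cancelˡ-≤ k (weight x) r (≤-trans (+-monoˡ-≤ (weight x) (≤ᵇ-true k (weight (x ⊕ ones)) h)) (≤-reflexive (weight-⊕-ones x))))

hdist≡weight : ∀ {n} (x c : Cube n) → hdist x c ≡ weight (x ⊕ c)
hdist≡weight [] [] = refl
hdist≡weight (a ∷ x) (b ∷ c) = cong (ind (a xor b) +_) (hdist≡weight x c)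

#-ball : ∀ {n} k r → n ≡ k + r → (c : Cube n) → # ball c r ≡ # atLeast {n} k
#-ball k r refl c = trans (#-cong (λ x → cong (_≤ᵇ r) (hdist≡weight x c)))
  (trans (#-xor (atMost r) c) (#atMost≡#atLeast r k))

hdist-Adj : ∀ {n} {x y : Cube n} c → Adj x y → hdist x c ≤ suc (hdist y c)
hdist-Adj (true ∷ c) (inj₁ here) = ≤-refl
hdist-Adj (false ∷ c) (inj₁ here) = ≤-trans (n≤1+n _) (n≤1+n _)
hdist-Adj (true ∷ c) (inj₂ here) = ≤-trans (n≤1+n _) (n≤1+n _)
hdist-Adj (false ∷ c) (inj₂ here) = ≤-refl
hdist-Adj (b ∷ c) (inj₁ (there {b = a} u)) = ≤-trans (+-monoʳ-≤ (ind (a xor b)) (hdist-Adj c (inj₁ u))) (≤-reflexive (+-suc (ind (a xor b)) _))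
hdist-Adj (b ∷ c) (inj₂ (there {b = a} u)) = ≤-trans (+-monoʳ-≤ (ind (a xor b)) (hdist-Adj c (inj₂ u))) (≤-reflexive (+-suc (ind (a xor b)) _))

nb-ball : ∀ {n} (c : Cube n) r → nb (ball c r) ⊆ ball c (suc r)
nb-ball c r x h with nb-elim (ball c r) x h
... | inj₁ p = ≤⇒≤ᵇ-true (m≤n⇒m≤1+n (≤ᵇ-true (hdist x c) r p))
... | inj₂ (y , a , p) = ≤⇒≤ᵇ-true (≤-trans (hdist-Adj c a) (s≤s (≤ᵇ-true (hdist y c) r p)))

Up-weight : ∀ {n} {x y : Cube n} → Up x y → weight y ≡ suc (weight x)
Up-weight here = refl
Up-weight (there {b = true} u) = cong suc (Up-weight u)
Up-weight (there {b = false} u) = Up-weight u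

weight<n⇒Up : ∀ {n} (x : Cube n) → weight x < n → ∃[ y ] Up x y
weight<n⇒Up (true ∷ x) (s≤s h) with weight<n⇒Up x h
... | y , u = true ∷ y , there u
weight<n⇒Up (false ∷ x) h = true ∷ x , here

Up-snoc : ∀ {n} {x y : Cube n} b → Up x y → Up (x ∷ʳ b) (y ∷ʳ b)
Up-snoc b here = here
Up-snoc b (there u) = there (Up-snoc b u)

Up-last : ∀ {n} (x : Cube n) → Up (x ∷ʳ false) (x ∷ʳ true)
Up-last [] = here
Up-last (a ∷ x) = there (Up-last x)

-- Colexicographic and simplicial orders

-- Binary value with the head as least significant bit. The largest coordinate where x and y differ
-- decides, so `val x < val y` is the condition that max (x △ y) lies in y.
val : ∀ {n} → Cube n → ℕ
val [] = 0
val (a ∷ x) = ind a + (val x + val x)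

double-mono-< : ∀ {v w} → v < w → suc (v + v) < w + w
double-mono-< {v} {w} h = ≤-trans (≤-reflexive (cong suc (sym (+-suc v v)))) (+-mono-≤ h h)

double-cancel-< : ∀ {v w} → v + v < w + w → v < w
double-cancel-< {v} {w} h with v <? w
... | yes p = p
... | no p = ⊥-elim (<⇒≱ h (+-mono-≤ (≮⇒≥ p) (≮⇒≥ p)))

val-∷-mono : ∀ {n} a b {x y : Cube n} → val x < val y → val (a ∷ x) < val (b ∷ y)
val-∷-mono a b {x} {y} h = ≤-trans (s≤s (+-monoˡ-≤ (val x + val x) (ind≤1 a)))
  (≤-trans (double-mono-< h) (m≤n+m _ (ind b)))

val-injective : ∀ {n} (x y : Cube n) → val x ≡ val y → x ≡ y
val-injective [] [] _ = refl
val-injective (a ∷ x) (b ∷ y) h with <-cmp (val x) (val y)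
... | tri< p _ _ = ⊥-elim (<-irrefl h (val-∷-mono a b {x} {y} p))
... | tri> _ _ p = ⊥-elim (<-irrefl (sym h) (val-∷-mono b a {y} {x} p))
... | tri≈ _ p _ with val-injective x y p
... | refl = cong (_∷ x) (ind-injective a b (+-cancelʳ-≡ (val x + val x) (ind a) (ind b) h))
  where
  ind-injective : ∀ a b → ind a ≡ ind b → a ≡ b
  ind-injective true true _ = refl
  ind-injective false false _ = refl

val<2^n : ∀ {n} (x : Cube n) → val x < 2 ^ n
val<2^n [] = s≤s z≤n
val<2^n {suc n} (a ∷ x) = ≤-trans (s≤s (+-monoˡ-≤ (val x + val x) (ind≤1 a)))
  (≤-trans (double-mono-< (val<2^n x)) (≤-reflexive (cong (2 ^ n +_) (sym (+-identityʳ (2 ^ n))))))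

val-snoc : ∀ {n} (x : Cube n) b → val (x ∷ʳ b) ≡ val x + ind b * 2 ^ n
val-snoc [] b = lem (ind b)
  where
  lem : ∀ i → i + 0 ≡ i * 1
  lem = solve-∀
val-snoc {suc n} (a ∷ x) b = trans (cong (λ v → ind a + (v + v)) (val-snoc x b)) (lem (ind a) (val x) (ind b) (2 ^ n))
  where
  lem : ∀ a v i t → a + ((v + i * t) + (v + i * t)) ≡ a + (v + v) + i * (t + (t + 0))
  lem = solve-∀

Up-val : ∀ {n} {x y : Cube n} → Up x y → val x < val y
Up-val here = ≤-refl
Up-val (there {b = b} {x} {y} u) = val-∷-mono b b {x} {y} (Up-val u)

vecEq-sound : ∀ {n} (x y : Cube n) → vecEq x y ≡ true → x ≡ y
vecEq-sound [] [] _ = refl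
vecEq-sound (true ∷ x) (true ∷ y) h = cong (true ∷_) (vecEq-sound x y h)
vecEq-sound (false ∷ x) (false ∷ y) h = cong (false ∷_) (vecEq-sound x y h)

vecEq-refl : ∀ {n} (x : Cube n) → vecEq x x ≡ true
vecEq-refl [] = refl
vecEq-refl (true ∷ x) = vecEq-refl x
vecEq-refl (false ∷ x) = vecEq-refl x

maxIn⇒val< : ∀ {n} (x y : Cube n) → maxIn x y ≡ true → val x < val y
maxIn⇒val< [] [] ()
maxIn⇒val< (a ∷ x) (b ∷ y) h with vecEq x y in eq
... | false = val-∷-mono a b {x} {y} (maxIn⇒val< x y h)
maxIn⇒val< (false ∷ x) (true ∷ y) h | true rewrite vecEq-sound x y eq = ≤-refl

val<⇒maxIn : ∀ {n} (x y : Cube n) → val x < val y → maxIn x y ≡ true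
val<⇒maxIn (a ∷ x) (b ∷ y) h with vecEq x y in eq
val<⇒maxIn (a ∷ x) (b ∷ y) h | true with vecEq-sound x y eq
val<⇒maxIn (true ∷ x) (true ∷ y) h | true | refl = ⊥-elim (<-irrefl refl h)
val<⇒maxIn (true ∷ x) (false ∷ y) h | true | refl = ⊥-elim (<-irrefl refl (<-trans h (n<1+n _)))
val<⇒maxIn (false ∷ x) (false ∷ y) h | true | refl = ⊥-elim (<-irrefl refl h)
val<⇒maxIn (false ∷ x) (true ∷ y) h | true | refl = refl
val<⇒maxIn (a ∷ x) (b ∷ y) h | false with <-cmp (val x) (val y)
... | tri< p _ _ = val<⇒maxIn x y p
... | tri> _ _ p = ⊥-elim (<-asym h (val-∷-mono b a {y} {x} p))
... | tri≈ _ p _ with val-injective x y p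
... | refl = ∈∉-absurd (vecEq-refl x) eq

infix 4 _≺_
_≺_ : ∀ {n} → Cube n → Cube n → Set
x ≺ y = weight y < weight x ⊎ (weight x ≡ weight y × val x < val y)

simpLess⇒≺ : ∀ {n} (x y : Cube n) → simpLess x y ≡ true → x ≺ y
simpLess⇒≺ x y h with ∨-true {weight y <ᵇ weight x} h
... | inj₁ p = inj₁ (<ᵇ-true (weight y) (weight x) p)
... | inj₂ p with ∧-true {weight x ≡ᵇ weight y} p
... | q , r = inj₂ (≡ᵇ-true (weight x) (weight y) q , maxIn⇒val< x y r)

≺⇒simpLess : ∀ {n} (x y : Cube n) → x ≺ y → simpLess x y ≡ true
≺⇒simpLess x y (inj₁ p) = ∨-trueˡ (<⇒<ᵇ-true p)
≺⇒simpLess x y (inj₂ (p , q)) = ∨-trueʳ (weight y <ᵇ weight x)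
  (cong₂ _∧_ (≡⇒≡ᵇ-true p) (val<⇒maxIn x y q))

≺-irrefl : ∀ {n} (x : Cube n) → ¬ (x ≺ x)
≺-irrefl x (inj₁ p) = <-irrefl refl p
≺-irrefl x (inj₂ (_ , p)) = <-irrefl refl p

≺-trans : ∀ {n} {x y z : Cube n} → x ≺ y → y ≺ z → x ≺ z
≺-trans (inj₁ p) (inj₁ q) = inj₁ (<-trans q p)
≺-trans (inj₁ p) (inj₂ (q , _)) = inj₁ (≤-<-trans (≤-reflexive (sym q)) p)
≺-trans (inj₂ (p , _)) (inj₁ q) = inj₁ (<-≤-trans q (≤-reflexive (sym p)))
≺-trans (inj₂ (p , p′)) (inj₂ (q , q′)) = inj₂ (trans p q , <-trans p′ q′)

≺-total : ∀ {n} (x y : Cube n) → x ≡ y ⊎ (x ≺ y ⊎ y ≺ x)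
≺-total x y with <-cmp (weight x) (weight y)
... | tri< p _ _ = inj₂ (inj₂ (inj₁ p))
... | tri> _ _ p = inj₂ (inj₁ (inj₁ p))
... | tri≈ _ e _ with <-cmp (val x) (val y)
... | tri< p _ _ = inj₂ (inj₁ (inj₂ (e , p)))
... | tri> _ _ p = inj₂ (inj₂ (inj₂ (sym e , p)))
... | tri≈ _ p _ = inj₁ (val-injective x y p)

-- A numerical code for the simplicial order: `val` stays below 2 ^ n, so the size of the set
-- dominates.
position : ∀ {n} → Cube n → ℕ
position {n} x = (n ∸ weight x) * 2 ^ n + val x

≺⇒position< : ∀ {n} (x y : Cube n) → x ≺ y → position x < position y
≺⇒position< {n} x y (inj₁ p) = <-≤-trans (+-monoʳ-< ((n ∸ weight x) * 2 ^ n) (val<2^n x))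
  (≤-trans (≤-reflexive (+-comm _ (2 ^ n)))
  (≤-trans (*-monoˡ-≤ (2 ^ n) (∸-monoʳ-< p (weight≤n x))) (m≤m+n _ (val y))))
≺⇒position< {n} x y (inj₂ (e , p)) rewrite e = +-monoʳ-< ((n ∸ weight y) * 2 ^ n) p

-- only x y is |x ∖ y|.
only : ∀ {n} → Cube n → Cube n → ℕ
only [] [] = 0
only (a ∷ x) (b ∷ y) = ind (a ∧ not b) + only x y

weight-only : ∀ {n} (x y : Cube n) → weight x + only y x ≡ weight y + only x y
weight-only [] [] = refl
weight-only (true ∷ x) (true ∷ y) = cong suc (weight-only x y)
weight-only (true ∷ x) (false ∷ y) = trans (cong suc (weight-only x y)) (sym (+-suc (weight y) (only x y)))
weight-only (false ∷ x) (true ∷ y) = trans (+-suc (weight x) (only y x)) (cong suc (weight-only x y))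
weight-only (false ∷ x) (false ∷ y) = weight-only x y

only-self : ∀ {n} (x : Cube n) → only x x ≡ 0
only-self [] = refl
only-self (true ∷ x) = only-self x
only-self (false ∷ x) = only-self x

only-zero⇒≡ : ∀ {n} (x y : Cube n) → only x y ≡ 0 → only y x ≡ 0 → x ≡ y
only-zero⇒≡ [] [] _ _ = refl
only-zero⇒≡ (true ∷ x) (true ∷ y) p q = cong (true ∷_) (only-zero⇒≡ x y p q)
only-zero⇒≡ (false ∷ x) (false ∷ y) p q = cong (false ∷_) (only-zero⇒≡ x y p q)

only<⇒weight< : ∀ {n} (x y : Cube n) → only y x < only x y → weight y < weight x
only<⇒weight< x y h = +-cancelʳ-< (only x y) (weight y) (weight x)
  (≤-<-trans (≤-reflexive (sym (weight-only x y))) (+-monoʳ-< (weight x) h))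

weight<⇒only< : ∀ {n} (x y : Cube n) → weight y < weight x → only y x < only x y
weight<⇒only< x y h = +-cancelˡ-< (weight x) _ _
  (≤-<-trans (≤-reflexive (weight-only x y)) (+-monoˡ-< (only x y) h))

only≡⇒weight≡ : ∀ {n} (x y : Cube n) → only x y ≡ only y x → weight x ≡ weight y
only≡⇒weight≡ x y h = +-cancelʳ-≡ (only y x) _ _ (trans (weight-only x y) (cong (weight y +_) h))

weight≡⇒only≡ : ∀ {n} (x y : Cube n) → weight x ≡ weight y → only x y ≡ only y x
weight≡⇒only≡ x y h = +-cancelˡ-≡ (weight y) _ _ (trans (sym (weight-only x y)) (cong (_+ only y x) h))

only≤n : ∀ {n} (x y : Cube n) → only x y ≤ n
only≤n [] [] = z≤n
only≤n (a ∷ x) (b ∷ y) = +-mono-≤ (ind≤1 (a ∧ not b)) (only≤n x y)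

Up-only : ∀ {n} {x y : Cube n} → Up x y → only y x ≡ 1 × only x y ≡ 0
Up-only {x = _ ∷ x} here = cong suc (only-self x) , only-self x
Up-only (there {b = true} u) = Up-only u
Up-only (there {b = false} u) = Up-only u

pick-remove : ∀ {n} (x y : Cube n) p → only x y ≡ suc p →
  ∃[ x′ ] Up x′ x × only x′ y ≡ p × only y x′ ≡ only y x
pick-remove [] [] p ()
pick-remove (true ∷ x) (false ∷ y) p h = false ∷ x , here , suc-injective h , refl
pick-remove (true ∷ x) (true ∷ y) p h with pick-remove x y p h
... | x′ , u , e , f = true ∷ x′ , there u , e , f
pick-remove (false ∷ x) (true ∷ y) p h with pick-remove x y p h
... | x′ , u , e , f = false ∷ x′ , there u , e , cong suc f
pick-remove (false ∷ x) (false ∷ y) p h with pick-remove x y p h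
... | x′ , u , e , f = false ∷ x′ , there u , e , f

pick-add : ∀ {n} (x y : Cube n) q → only y x ≡ suc q →
  ∃[ x′ ] Up x x′ × only y x′ ≡ q × only x′ y ≡ only x y
pick-add [] [] q ()
pick-add (false ∷ x) (true ∷ y) q h = true ∷ x , here , suc-injective h , refl
pick-add (true ∷ x) (true ∷ y) q h with pick-add x y q h
... | x′ , u , e , f = true ∷ x′ , there u , e , f
pick-add (true ∷ x) (false ∷ y) q h with pick-add x y q h
... | x′ , u , e , f = true ∷ x′ , there u , e , cong suc f
pick-add (false ∷ x) (false ∷ y) q h with pick-add x y q h
... | x′ , u , e , f = false ∷ x′ , there u , e , f

-- The least element of y ∖ x is added, which keeps max (x △ y) in y.
pick-add-< : ∀ {n} (x y : Cube n) q → only y x ≡ suc (suc q) → val x < val y →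
  ∃[ x′ ] Up x x′ × only y x′ ≡ suc q × only x′ y ≡ only x y × val x′ < val y
pick-add-< (false ∷ x) (true ∷ y) q h l with <-cmp (val x) (val y)
... | tri< p _ _ = true ∷ x , here , suc-injective h , refl , val-∷-mono true true {x} {y} p
... | tri> _ _ p = ⊥-elim (<-asym l (val-∷-mono true false {y} {x} p))
... | tri≈ _ p _ with val-injective x y p
... | refl with trans (sym (only-self x)) (suc-injective h)
... | ()
pick-add-< (true ∷ x) (true ∷ y) q h l
  with pick-add-< x y q h (double-cancel-< (+-cancelˡ-< 1 _ _ l))
... | x′ , u , e , f , g = true ∷ x′ , there u , e , f , val-∷-mono true true {x′} {y} g
pick-add-< (true ∷ x) (false ∷ y) q h l
  with pick-add-< x y q h (double-cancel-< (<-trans (n<1+n _) l))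
... | x′ , u , e , f , g = true ∷ x′ , there u , e , cong suc f , val-∷-mono true false {x′} {y} g
pick-add-< (false ∷ x) (false ∷ y) q h l
  with pick-add-< x y q h (double-cancel-< l)
... | x′ , u , e , f , g = false ∷ x′ , there u , e , f , val-∷-mono false false {x′} {y} g

-- Compressions

-- agr x y z: on the coordinates where x and y differ, z agrees with y.
agr : ∀ {n} → Cube n → Cube n → Cube n → Bool
agr [] [] [] = true
agr (a ∷ x) (b ∷ y) (c ∷ z) = (not (a xor b) ∨ not (c xor b)) ∧ agr x y z

agr-⊕ : ∀ {n} (x y z : Cube n) → agr x y (z ⊕ (x ⊕ y)) ≡ agr y x z
agr-⊕ [] [] [] = refl
agr-⊕ (a ∷ x) (b ∷ y) (c ∷ z) = cong₂ _∧_ (lem a b c) (agr-⊕ x y z)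
  where
  lem : ∀ a b c → (not (a xor b) ∨ not ((c xor (a xor b)) xor b)) ≡ (not (b xor a) ∨ not (c xor a))
  lem true true c = refl
  lem true false true = refl
  lem true false false = refl
  lem false true true = refl
  lem false true false = refl
  lem false false c = refl

agr-⊕′ : ∀ {n} (x y z : Cube n) → agr y x (z ⊕ (x ⊕ y)) ≡ agr x y z
agr-⊕′ x y z = trans (sym (agr-⊕ x y (z ⊕ (x ⊕ y)))) (cong (agr x y) (⊕-cancelʳ z (x ⊕ y)))

agr-self : ∀ {n} (x y : Cube n) → agr x y y ≡ true
agr-self [] [] = refl
agr-self (a ∷ x) (b ∷ y) = cong₂ _∧_ (lem a b) (agr-self x y)
  where
  lem : ∀ a b → (not (a xor b) ∨ not (b xor b)) ≡ true
  lem true true = refl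
  lem true false = refl
  lem false true = refl
  lem false false = refl

⊕-swapˡ : ∀ {n} (x y : Cube n) → x ⊕ (x ⊕ y) ≡ y
⊕-swapˡ [] [] = refl
⊕-swapˡ (a ∷ x) (b ∷ y) = cong₂ _∷_ (lem a b) (⊕-swapˡ x y)
  where
  lem : ∀ a b → a xor (a xor b) ≡ b
  lem true true = refl
  lem true false = refl
  lem false b = refl

⊕-swapʳ : ∀ {n} (x y : Cube n) → y ⊕ (x ⊕ y) ≡ x
⊕-swapʳ x y = trans (cong (_⊕ (x ⊕ y)) (sym (⊕-swapˡ x y))) (⊕-cancelʳ x (x ⊕ y))

agr-both : ∀ {n} (x y z : Cube n) → agr x y z ≡ true → agr y x z ≡ true → x ≡ y
agr-both [] [] [] _ _ = refl
agr-both (a ∷ x) (b ∷ y) (c ∷ z) h k with ∧-true {not (a xor b) ∨ not (c xor b)} h | ∧-true {not (b xor a) ∨ not (c xor a)} k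
... | p , h′ | q , k′ = cong₂ _∷_ (lem a b c p q) (agr-both x y z h′ k′)
  where
  lem : ∀ a b c → (not (a xor b) ∨ not (c xor b)) ≡ true → (not (b xor a) ∨ not (c xor a)) ≡ true → a ≡ b
  lem true true _ _ _ = refl
  lem true false true () _
  lem true false false _ ()
  lem false true true _ ()
  lem false true false () _
  lem false false _ _ _ = refl

agr-head : ∀ a b c → (not (a xor b) ∨ not (c xor b)) ≡ true →
  (((c xor (a xor b)) ∧ not c) ≡ (a ∧ not b)) × ((c ∧ not (c xor (a xor b))) ≡ (b ∧ not a))
agr-head true true true _ = refl , refl
agr-head true true false _ = refl , refl
agr-head true false true ()
agr-head true false false _ = refl , refl
agr-head false true true _ = refl , refl
agr-head false true false ()
agr-head false false true _ = refl , refl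
agr-head false false false _ = refl , refl

agr-only : ∀ {n} (x y z : Cube n) → agr x y z ≡ true →
  only (z ⊕ (x ⊕ y)) z ≡ only x y × only z (z ⊕ (x ⊕ y)) ≡ only y x
agr-only [] [] [] _ = refl , refl
agr-only (a ∷ x) (b ∷ y) (c ∷ z) h with ∧-true {not (a xor b) ∨ not (c xor b)} h
... | p , h′ with agr-head a b c p | agr-only x y z h′
... | q , r | s , t = cong₂ _+_ (cong ind q) s , cong₂ _+_ (cong ind r) t

agr-val : ∀ {n} (x y z : Cube n) → agr x y z ≡ true → val (z ⊕ (x ⊕ y)) + val y ≡ val z + val x
agr-val [] [] [] _ = refl
agr-val (a ∷ x) (b ∷ y) (c ∷ z) h with ∧-true {not (a xor b) ∨ not (c xor b)} h
... | p , h′ = begin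
  (ind c′ + (v′ + v′)) + (ind b + (val y + val y)) ≡⟨ lem (ind c′) v′ (ind b) (val y) ⟩
  (ind c′ + ind b) + ((v′ + val y) + (v′ + val y)) ≡⟨ cong₂ (λ s t → s + (t + t)) (head a b c p) (agr-val x y z h′) ⟩
  (ind c + ind a) + ((val z + val x) + (val z + val x)) ≡⟨ lem (ind c) (val z) (ind a) (val x) ⟨
  (ind c + (val z + val z)) + (ind a + (val x + val x)) ∎
  where
  open ≡-Reasoning
  c′ = c xor (a xor b)
  v′ = val (z ⊕ (x ⊕ y))
  lem : ∀ c v b w → (c + (v + v)) + (b + (w + w)) ≡ (c + b) + ((v + w) + (v + w))
  lem = solve-∀
  head : ∀ a b c → (not (a xor b) ∨ not (c xor b)) ≡ true → ind (c xor (a xor b)) + ind b ≡ ind c + ind a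
  head true true true _ = refl
  head true true false _ = refl
  head true false true ()
  head true false false _ = refl
  head false true true _ = refl
  head false true false ()
  head false false true _ = refl
  head false false false _ = refl

agr-val< : ∀ {n} (x y z : Cube n) → agr x y z ≡ true → val x < val y → val (z ⊕ (x ⊕ y)) < val z
agr-val< x y z h l = +-cancelʳ-< (val y) _ _ (≤-<-trans (≤-reflexive (agr-val x y z h)) (+-monoʳ-< (val z) l))

agr-≺ : ∀ {n} (x y z : Cube n) → agr x y z ≡ true → x ≺ y → z ⊕ (x ⊕ y) ≺ z
agr-≺ x y z h (inj₁ p) with agr-only x y z h | weight<⇒only< x y p
... | e , f | q = inj₁ (only<⇒weight< (z ⊕ (x ⊕ y)) z (≤-<-trans (≤-reflexive f) (<-≤-trans q (≤-reflexive (sym e)))))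
agr-≺ x y z h (inj₂ (p , l)) with agr-only x y z h | weight≡⇒only≡ x y p
... | e , f | q = inj₂ (only≡⇒weight≡ (z ⊕ (x ⊕ y)) z (trans e (trans q (sym f))) , agr-val< x y z h l)

-- With U = x ∖ y and V = y ∖ x, the sizes say that s arises from t by an exchange of V for U with
-- one element of U, respectively of V, left out. This is what an edge in a direction of U or V
-- turns the full exchange into.
NearU NearV : ∀ {n} → Cube n → Cube n → Cube n → Cube n → Set
NearU x y s t = suc (only s t) ≡ only x y × only t s ≡ only y x
NearV x y s t = only s t ≡ only x y × suc (only t s) ≡ only y x

-- The position of the edge uv relative to the coordinates x △ y: its direction lies
-- outside x △ y, in x ∖ y, or in y ∖ x.
data Direction {n} (x y u v : Cube n) : Set where
  out : agr x y u ≡ agr x y v → agr y x u ≡ agr y x v → Up (u ⊕ (x ⊕ y)) (v ⊕ (x ⊕ y)) → Direction x y u v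
  inU : agr x y v ≡ false → agr y x u ≡ false → Up (v ⊕ (x ⊕ y)) (u ⊕ (x ⊕ y)) →
        (agr x y u ≡ true → NearU x y (u ⊕ (x ⊕ y)) v × NearU x y (v ⊕ (x ⊕ y)) u) → Direction x y u v
  inV : agr x y u ≡ false → agr y x v ≡ false → Up (v ⊕ (x ⊕ y)) (u ⊕ (x ⊕ y)) →
        (agr x y v ≡ true → NearV x y (v ⊕ (x ⊕ y)) u × NearV x y (u ⊕ (x ⊕ y)) v) → Direction x y u v

∧-falseʳ : ∀ a {b} → b ≡ false → a ∧ b ≡ false
∧-falseʳ true h = h
∧-falseʳ false _ = refl

direction : ∀ {n} (x y : Cube n) {u v} → Up u v → Direction x y u v
direction (true ∷ x) (true ∷ y) here = out refl refl here
direction (false ∷ x) (false ∷ y) here = out refl refl here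
direction (true ∷ x) (false ∷ y) (here {x = z}) = inU refl refl here near
  where
  near : agr x y z ≡ true → NearU (true ∷ x) (false ∷ y) (true ∷ (z ⊕ (x ⊕ y))) (true ∷ z) ×
                           NearU (true ∷ x) (false ∷ y) (false ∷ (z ⊕ (x ⊕ y))) (false ∷ z)
  near h with agr-only x y z h
  ... | e , f = (cong suc e , f) , (cong suc e , f)
direction (false ∷ x) (true ∷ y) (here {x = z}) = inV refl refl here near
  where
  near : agr x y z ≡ true → NearV (false ∷ x) (true ∷ y) (false ∷ (z ⊕ (x ⊕ y))) (false ∷ z) ×
                           NearV (false ∷ x) (true ∷ y) (true ∷ (z ⊕ (x ⊕ y))) (true ∷ z)
  near h with agr-only x y z h
  ... | e , f = (e , cong suc f) , (e , cong suc f)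
direction (a ∷ x) (b ∷ y) (there {b = c} {u} {v} up) with direction x y up
... | out e f w = out (cong (_ ∧_) e) (cong (_ ∧_) f) (there w)
... | inU e f w near = inU (∧-falseʳ _ e) (∧-falseʳ _ f) (there w) near′
  where
  lift : ∀ {s t} → (not (a xor b) ∨ not (c xor b)) ≡ true → NearU x y s t →
         NearU (a ∷ x) (b ∷ y) ((c xor (a xor b)) ∷ s) (c ∷ t)
  lift p (q , r) with agr-head a b c p
  ... | g , h = trans (sym (+-suc _ _)) (cong₂ _+_ (cong ind g) q) , cong₂ _+_ (cong ind h) r
  near′ : (not (a xor b) ∨ not (c xor b)) ∧ agr x y u ≡ true →
    NearU (a ∷ x) (b ∷ y) ((c xor (a xor b)) ∷ (u ⊕ (x ⊕ y))) (c ∷ v) ×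
    NearU (a ∷ x) (b ∷ y) ((c xor (a xor b)) ∷ (v ⊕ (x ⊕ y))) (c ∷ u)
  near′ h with ∧-true {not (a xor b) ∨ not (c xor b)} h
  ... | p , q = lift {u ⊕ (x ⊕ y)} {v} p (proj₁ (near q)) , lift {v ⊕ (x ⊕ y)} {u} p (proj₂ (near q))
... | inV e f w near = inV (∧-falseʳ _ e) (∧-falseʳ _ f) (there w) near′
  where
  lift : ∀ {s t} → (not (a xor b) ∨ not (c xor b)) ≡ true → NearV x y s t →
         NearV (a ∷ x) (b ∷ y) ((c xor (a xor b)) ∷ s) (c ∷ t)
  lift p (q , r) with agr-head a b c p
  ... | g , h = cong₂ _+_ (cong ind g) q , trans (sym (+-suc _ _)) (cong₂ _+_ (cong ind h) r)
  near′ : (not (a xor b) ∨ not (c xor b)) ∧ agr x y v ≡ true →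
    NearV (a ∷ x) (b ∷ y) ((c xor (a xor b)) ∷ (v ⊕ (x ⊕ y))) (c ∷ u) ×
    NearV (a ∷ x) (b ∷ y) ((c xor (a xor b)) ∷ (u ⊕ (x ⊕ y))) (c ∷ v)
  near′ h with ∧-true {not (a xor b) ∨ not (c xor b)} h
  ... | p , q = lift {v ⊕ (x ⊕ y)} {u} p (proj₁ (near q)) , lift {u ⊕ (x ⊕ y)} {v} p (proj₂ (near q))

Adj-⊕ : ∀ {n} {u v : Cube n} m → Adj u v → Adj (u ⊕ m) (v ⊕ m)
Adj-⊕ (true ∷ m) (inj₁ here) = inj₂ here
Adj-⊕ (false ∷ m) (inj₁ here) = inj₁ here
Adj-⊕ (true ∷ m) (inj₂ here) = inj₁ here
Adj-⊕ (false ∷ m) (inj₂ here) = inj₂ here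
Adj-⊕ (b ∷ m) (inj₁ (there u)) = Adj-there (Adj-⊕ m (inj₁ u))
Adj-⊕ (b ∷ m) (inj₂ (there u)) = Adj-there (Adj-⊕ m (inj₂ u))

-- t and b record that z agrees with x, respectively y, on x △ y.
choose : Bool → Bool → Bool → Bool → Bool
choose true true u v = u
choose true false u v = u ∨ v
choose false true u v = u ∧ v
choose false false u v = u

-- Replaces y ∖ x by x ∖ y in the members of A whenever possible.
comp : ∀ {n} → Cube n → Cube n → Family n → Family n
comp x y A z = choose (agr y x z) (agr x y z) (A z) (A (z ⊕ (x ⊕ y)))

comp-⊕ : ∀ {n} (x y : Cube n) (A : Family n) z →
  comp x y A (z ⊕ (x ⊕ y)) ≡ choose (agr x y z) (agr y x z) (A (z ⊕ (x ⊕ y))) (A z)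
comp-⊕ x y A z = trans (cong₂ (λ t b → choose t b (A (z ⊕ (x ⊕ y))) (A (z ⊕ (x ⊕ y) ⊕ (x ⊕ y)))) (agr-⊕′ x y z) (agr-⊕ x y z))
  (cong (λ w → choose (agr x y z) (agr y x z) (A (z ⊕ (x ⊕ y))) (A w)) (⊕-cancelʳ z (x ⊕ y)))

-- Compressions act separately on the pairs z, z ⊕ m. Summing over all z meets every pair twice,
-- which is why the estimates below are proved for doubled quantities.
sumC-pairs : ∀ {n} (f : Cube n → ℕ) m → sumC (λ z → f z + f (z ⊕ m)) ≡ sumC f + sumC f
sumC-pairs f m = trans (sumC-+ f (λ z → f (z ⊕ m))) (cong (sumC f +_) (sumC-⊕ f m))

double-injective : ∀ {a b} → a + a ≡ b + b → a ≡ b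
double-injective {a} {b} h with <-cmp a b
... | tri< p _ _ = ⊥-elim (<-irrefl h (+-mono-< p p))
... | tri≈ _ p _ = p
... | tri> _ _ p = ⊥-elim (<-irrefl (sym h) (+-mono-< p p))

double-cancel-≤ : ∀ {a b} → a + a ≤ b + b → a ≤ b
double-cancel-≤ {a} {b} h = ≮⇒≥ λ p → <⇒≱ (+-mono-< p p) h

#-comp : ∀ {n} (x y : Cube n) A → # comp x y A ≡ # A
#-comp x y A = double-injective (trans (sym (sumC-pairs (ind ∘ comp x y A) (x ⊕ y)))
  (trans (sumC-cong pointwise) (sumC-pairs (ind ∘ A) (x ⊕ y))))
  where
  lem : ∀ t b u v → ind (choose t b u v) + ind (choose b t v u) ≡ ind u + ind v
  lem true true u v = refl
  lem true false true true = refl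
  lem true false true false = refl
  lem true false false true = refl
  lem true false false false = refl
  lem false true true true = refl
  lem false true true false = refl
  lem false true false true = refl
  lem false true false false = refl
  lem false false u v = refl
  pointwise : ∀ z → ind (comp x y A z) + ind (comp x y A (z ⊕ (x ⊕ y))) ≡ ind (A z) + ind (A (z ⊕ (x ⊕ y)))
  pointwise z = trans (cong (λ w → ind (comp x y A z) + ind w) (comp-⊕ x y A z)) (lem (agr y x z) (agr x y z) (A z) _)

potential : ∀ {n} → Family n → ℕ
potential A = sumC (λ z → ind (A z) * position z)

-- Every exchange moves a member to an earlier position in the simplicial order, and y is exchanged
-- for x, so the sum of positions drops strictly.
potential-comp : ∀ {n} (x y : Cube n) A → x ≺ y → y ∈ A → A x ≡ false → potential (comp x y A) < potential A
potential-comp x y A l y∈A x∉A = ≰⇒> λ h → <⇒≱ doubled (+-mono-≤ h h)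
  where
  m = x ⊕ y
  lem : ∀ t b u v p q → (t ≡ true → b ≡ false → p ≤ q) → (b ≡ true → t ≡ false → q ≤ p) →
    ind (choose t b u v) * p + ind (choose b t v u) * q ≤ ind u * p + ind v * q
  lem true true u v p q f g = ≤-refl
  lem false false u v p q f g = ≤-refl
  lem true false true true p q f g = ≤-refl
  lem true false true false p q f g = ≤-refl
  lem true false false true p q f g = ≤-trans (≤-reflexive (+-identityʳ (p + 0))) (+-monoˡ-≤ 0 (f refl refl))
  lem true false false false p q f g = ≤-refl
  lem false true true true p q f g = ≤-refl
  lem false true true false p q f g = ≤-trans (+-monoˡ-≤ 0 (g refl refl)) (≤-reflexive (sym (+-identityʳ (p + 0))))
  lem false true false true p q f g = ≤-refl
  lem false true false false p q f g = ≤-refl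
  pos : ∀ z → agr x y z ≡ true → position (z ⊕ m) < position z
  pos z h = ≺⇒position< (z ⊕ m) z (agr-≺ x y z h l)
  pos′ : ∀ z → agr y x z ≡ true → position z < position (z ⊕ m)
  pos′ z h = subst (λ w → position w < position (z ⊕ m)) (⊕-cancelʳ z m) (pos (z ⊕ m) (trans (agr-⊕ x y z) h))
  f g : Cube _ → ℕ
  f z = ind (comp x y A z) * position z
  g z = ind (A z) * position z
  weak : ∀ z → f z + f (z ⊕ m) ≤ g z + g (z ⊕ m)
  weak z rewrite comp-⊕ x y A z = lem (agr y x z) (agr x y z) (A z) _ _ _ (λ h _ → <⇒≤ (pos′ z h)) (λ h _ → <⇒≤ (pos z h))
  notboth : agr y x y ≡ false
  notboth with agr y x y in eq
  ... | false = refl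
  ... | true with agr-both x y y (agr-self x y) eq
  ... | refl = ⊥-elim (≺-irrefl x l)
  strict : f y + f (y ⊕ m) < g y + g (y ⊕ m)
  strict rewrite comp-⊕ x y A y | notboth | agr-self x y | y∈A | ⊕-swapʳ x y | x∉A
    = ≤-trans (s≤s (≤-reflexive (+-identityʳ (position x))))
        (≤-trans (≺⇒position< x y l) (≤-reflexive (sym (trans (+-identityʳ (position y + 0)) (+-identityʳ (position y))))))
  doubled : potential (comp x y A) + potential (comp x y A) < potential A + potential A
  doubled = <-≤-trans (≤-<-trans (≤-reflexive (sym (sumC-pairs f m))) (sumC-mono-< weak y strict)) (≤-reflexive (sumC-pairs g m))

comp-elim : ∀ {n} (x y : Cube n) (A : Family n) z → x ≢ y → z ∈ comp x y A →
  (z ∈ A × (agr x y z ≡ true → z ⊕ (x ⊕ y) ∈ A)) ⊎ (agr y x z ≡ true × agr x y z ≡ false × z ⊕ (x ⊕ y) ∈ A)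
comp-elim x y A z ne h with agr y x z in eqt | agr x y z in eqb
... | true | true = ⊥-elim (ne (agr-both x y z eqb eqt))
... | true | false with ∨-true {A z} h
... | inj₁ p = inj₁ (p , λ ())
... | inj₂ p = inj₂ (refl , refl , p)
comp-elim x y A z ne h | false | true = inj₁ (proj₁ (∧-true {A z} h) , λ _ → proj₂ (∧-true {A z} h))
comp-elim x y A z ne h | false | false = inj₁ (h , λ ())

comp-intro : ∀ {n} (x y : Cube n) (A : Family n) z → z ∈ A → (agr x y z ≡ true → z ⊕ (x ⊕ y) ∈ A) → z ∈ comp x y A
comp-intro x y A z p q with agr y x z | agr x y z
... | true | true = p
... | true | false = ∨-trueˡ p
... | false | true = cong₂ _∧_ p (q refl)
... | false | false = p

comp-intro-top : ∀ {n} (x y : Cube n) (A : Family n) z →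
  agr y x z ≡ true → agr x y z ≡ false → z ⊕ (x ⊕ y) ∈ A → z ∈ comp x y A
comp-intro-top x y A z p q r rewrite p | q = ∨-trueʳ (A z) r

module _ {n} (x y : Cube n) (A : Family n) (x≢y : x ≢ y)
  (goodU : ∀ s t → NearU x y s t → (val x < val y → val s < val t) → t ∈ A → s ∈ nb A)
  (goodV : ∀ s t → NearV x y s t → t ∈ A → s ∈ nb A) where

  private
    m = x ⊕ y

  nb-bottom : ∀ z t → Adj z t → agr x y z ≡ true → t ∈ A → (agr x y t ≡ true → t ⊕ m ∈ A) → z ⊕ m ∈ nb A
  nb-bottom z t (inj₁ up) bot t∈A t′∈A with direction x y up
  ... | out e f _ = nb-intro A (Adj-⊕ m (inj₁ up)) (t′∈A (trans (sym e) bot))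
  ... | inU e f w near = goodU (z ⊕ m) t (proj₁ (near bot)) (λ l → <-trans (agr-val< x y z bot l) (Up-val up)) t∈A
  ... | inV e f _ near = ∈∉-absurd bot e
  nb-bottom z t (inj₂ up) bot t∈A t′∈A with direction x y up
  ... | out e f _ = nb-intro A (Adj-⊕ m (inj₂ up)) (t′∈A (trans e bot))
  ... | inU e f w near = ∈∉-absurd bot e
  ... | inV e f _ near = goodV (z ⊕ m) t (proj₁ (near bot)) t∈A

  -- u and w play the roles of t ⊕ m and z ⊕ m for an edge zt with t in the upper state.
  nb-top : ∀ w u → Adj w u → agr x y u ≡ true → u ∈ A →
    (agr x y w ≡ true × agr y x w ≡ agr y x u) ⊎ w ⊕ m ∈ nb A
  nb-top w u (inj₁ up) bot u∈A with direction x y up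
  ... | out e f _ = inj₁ (trans e bot , f)
  ... | inU e f _ near = ∈∉-absurd bot e
  ... | inV e f _ near = inj₂ (goodV (w ⊕ m) u (proj₂ (near bot)) u∈A)
  nb-top w u (inj₂ up) bot u∈A with direction x y up
  ... | out e f _ = inj₁ (trans (sym e) bot , sym f)
  ... | inU e f w′ near = inj₂ (goodU (w ⊕ m) u (proj₂ (near bot)) (λ l → <-trans (Up-val w′) (agr-val< x y u bot l)) u∈A)
  ... | inV e f _ near = ∈∉-absurd bot e

  -- As `comp` preserves cardinalities, this inclusion is what keeps |nb A| from growing. An edge
  -- whose direction lies outside x △ y is carried along by the exchange; an edge in a direction of
  -- U or V leads to a reduced exchange, which `goodU` and `goodV` place in nb A.
  nb-comp : nb (comp x y A) ⊆ comp x y (nb A)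
  nb-comp z h with nb-elim (comp x y A) z h
  nb-comp z h | inj₁ p with comp-elim x y A z x≢y p
  ... | inj₁ (q , r) = comp-intro x y (nb A) z (⊆-nb A z q) (λ b → ⊆-nb A (z ⊕ m) (r b))
  ... | inj₂ (q , r , s) = comp-intro-top x y (nb A) z q r (⊆-nb A (z ⊕ m) s)
  nb-comp z h | inj₂ (t , adj , p) with comp-elim x y A t x≢y p
  ... | inj₁ (q , r) = comp-intro x y (nb A) z (nb-intro A adj q) (λ b → nb-bottom z t adj b q r)
  ... | inj₂ (q , r , s) with nb-top (z ⊕ m) (t ⊕ m) (Adj-⊕ m adj) (trans (agr-⊕ x y t) q) s
  ... | inj₁ (e , f) = comp-intro-top x y (nb A) z (trans (sym (agr-⊕ x y z)) e)
          (trans (sym (agr-⊕′ x y z)) (trans f (trans (agr-⊕′ x y t) r))) (nb-intro A (Adj-⊕ m adj) s)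
  ... | inj₂ z∈ = comp-intro x y (nb A) z (subst (_∈ nb A) (⊕-cancelʳ z m) z∈) (λ _ → nb-intro A (Adj-⊕ m adj) s)

  #-nb-comp : # nb (comp x y A) ≤ # nb A
  #-nb-comp = ≤-trans (#-mono nb-comp) (≤-reflexive (#-comp x y (nb A)))

Type1 Type2 : ∀ {n} → Family n → ℕ → Set
Type1 A a = ∀ x y → only x y ≡ suc a → only y x ≡ a → y ∈ A → x ∈ A
Type2 A a = ∀ x y → only x y ≡ a → only y x ≡ a → val x < val y → y ∈ A → x ∈ A

Compressed : ∀ {n} → Family n → Set
Compressed A = (∀ a → Type1 A a) × (∀ a → Type2 A a)

-- Both reduced exchanges lead to level a - 1. If an element of U was left out, adding an element of
-- t ∖ s to s gives a neighbour of s in A; if an element of V was left out, removing an element of s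
-- ∖ t does. For a = 0 the first case is s = t and the second cannot occur.
#-nb-comp₁ : ∀ {n} (A : Family n) a x y → only x y ≡ suc a → only y x ≡ a →
  (∀ b → b < a → Type1 A b) → # nb (comp x y A) ≤ # nb A
#-nb-comp₁ A a x y p q T = #-nb-comp x y A x≢y (goodU a p q T) (goodV a p q T)
  where
  x≢y : x ≢ y
  x≢y refl with trans (sym p) (only-self x)
  ... | ()
  goodU : ∀ a → only x y ≡ suc a → only y x ≡ a → (∀ b → b < a → Type1 A b) →
    ∀ s t → NearU x y s t → (val x < val y → val s < val t) → t ∈ A → s ∈ nb A
  goodU zero p q T s t (e , f) _ t∈A
    rewrite only-zero⇒≡ s t (suc-injective (trans e p)) (trans f q) = ⊆-nb A t t∈A
  goodU (suc b) p q T s t (e , f) _ t∈A with pick-add s t b (trans f q)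
  ... | s′ , up , g , h = nb-intro A (inj₁ up) (T b ≤-refl s′ t (trans h (suc-injective (trans e p))) g t∈A)
  goodV : ∀ a → only x y ≡ suc a → only y x ≡ a → (∀ b → b < a → Type1 A b) →
    ∀ s t → NearV x y s t → t ∈ A → s ∈ nb A
  goodV zero p q T s t (e , f) t∈A with trans f q
  ... | ()
  goodV (suc b) p q T s t (e , f) t∈A with pick-remove s t (suc b) (trans e p)
  ... | s′ , up , g , h = nb-intro A (inj₂ up) (T b ≤-refl s′ t g (trans h (suc-injective (trans f q))) t∈A)

-- Leaving out an element of V gives an exchange of type 1, so s itself is in A. If an element of U
-- was left out, the least element of t ∖ s is added to s. For a > 1 this is an exchange of level a
-- - 1 that still decreases in colexicographic order, which is why `goodU` carries a condition on
-- `val`; for a = 1 it gives t.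
#-nb-comp₂ : ∀ {n} (A : Family n) a x y → only x y ≡ a → only y x ≡ a → val x < val y →
  (∀ b → Type1 A b) → (∀ b → b < a → Type2 A b) → # nb (comp x y A) ≤ # nb A
#-nb-comp₂ A a x y p q l T₁ T = #-nb-comp x y A x≢y (goodU a p q T) (goodV a p q)
  where
  x≢y : x ≢ y
  x≢y refl = <-irrefl refl l
  goodU : ∀ a → only x y ≡ a → only y x ≡ a → (∀ b → b < a → Type2 A b) →
    ∀ s t → NearU x y s t → (val x < val y → val s < val t) → t ∈ A → s ∈ nb A
  goodU zero p q T s t (e , f) _ t∈A with trans e p
  ... | ()
  goodU (suc zero) p q T s t (e , f) _ t∈A with pick-add s t 0 (trans f q)
  ... | s′ , up , g , h with only-zero⇒≡ s′ t (trans h (suc-injective (trans e p))) g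
  ... | refl = nb-intro A (inj₁ up) t∈A
  goodU (suc (suc c)) p q T s t (e , f) v t∈A with pick-add-< s t c (trans f q) (v l)
  ... | s′ , up , g , h , i = nb-intro A (inj₁ up)
          (T (suc c) ≤-refl s′ t (trans h (suc-injective (trans e p))) g i t∈A)
  goodV : ∀ a → only x y ≡ a → only y x ≡ a → ∀ s t → NearV x y s t → t ∈ A → s ∈ nb A
  goodV zero p q s t (e , f) t∈A with trans f q
  ... | ()
  goodV (suc b) p q s t (e , f) t∈A = ⊆-nb A s (T₁ b s t (trans e p) (suc-injective (trans f q)) t∈A)

-- Iterated compressions and Harper's theorem.

search : ∀ {n} {P : Cube n → Set} → (∀ x → Dec (P x)) → Dec (∃ P)
search {zero} d with d []
... | yes p = yes ([] , p)
... | no p = no λ { ([] , q) → p q }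
search {suc n} d with search (λ x → d (true ∷ x)) | search (λ x → d (false ∷ x))
... | yes (x , p) | _ = yes (true ∷ x , p)
... | no _ | yes (x , p) = yes (false ∷ x , p)
... | no p | no q = no λ { (true ∷ x , r) → p (x , r) ; (false ∷ x , r) → q (x , r) }

firstFailure : ∀ {P Q : ℕ → Set} → (∀ a → P a ⊎ Q a) → ∀ N →
  (∀ a → a < N → P a) ⊎ ∃[ a ] Q a × (∀ b → b < a → P b)
firstFailure d zero = inj₁ λ a ()
firstFailure d (suc N) with firstFailure d N
... | inj₂ r = inj₂ r
... | inj₁ f with d N
... | inj₂ q = inj₂ (N , q , f)
... | inj₁ p = inj₁ λ a a<1+N → [ f a , (λ { refl → p }) ]′ (m≤n⇒m<n∨m≡n (≤-pred a<1+N))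

Bad1 Bad2 : ∀ {n} → Family n → ℕ → Set
Bad1 A a = ∃[ x ] ∃[ y ] only x y ≡ suc a × only y x ≡ a × y ∈ A × A x ≡ false
Bad2 A a = ∃[ x ] ∃[ y ] only x y ≡ a × only y x ≡ a × val x < val y × y ∈ A × A x ≡ false

type1? : ∀ {n} (A : Family n) a → Type1 A a ⊎ Bad1 A a
type1? A a with search (λ x → search (λ y → (only x y ≟ suc a) ×-dec (only y x ≟ a) ×-dec (A y Bool.≟ true) ×-dec (A x Bool.≟ false)))
... | yes bad = inj₂ bad
... | no none = inj₁ λ x y p q y∈A → case ∈? A x of λ
  { (inj₁ x∈A) → x∈A ; (inj₂ x∉A) → ⊥-elim (none (x , y , p , q , y∈A , x∉A)) }

type2? : ∀ {n} (A : Family n) a → Type2 A a ⊎ Bad2 A a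
type2? A a with search (λ x → search (λ y → (only x y ≟ a) ×-dec (only y x ≟ a) ×-dec (val x <? val y) ×-dec (A y Bool.≟ true) ×-dec (A x Bool.≟ false)))
... | yes bad = inj₂ bad
... | no none = inj₁ λ x y p q l y∈A → case ∈? A x of λ
  { (inj₁ x∈A) → x∈A ; (inj₂ x∉A) → ⊥-elim (none (x , y , p , q , l , y∈A , x∉A)) }

-- A violated exchange of smallest level is compressed, and type 2 is considered only when no
-- violation of type 1 remains. Each step thus comes with the compressedness that the bounds on |nb
-- A| require. The recursion is on `potential`; levels above n are vacuous.
compression-induction : ∀ {n} (P : Family n → Set) →
  (∀ A → Compressed A → P A) →
  (∀ A a x y → only x y ≡ suc a → only y x ≡ a → (∀ b → b < a → Type1 A b) →
     y ∈ A → A x ≡ false → P (comp x y A) → P A) →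
  (∀ A a x y → only x y ≡ a → only y x ≡ a → val x < val y →
     (∀ b → Type1 A b) → (∀ b → b < a → Type2 A b) → P (comp x y A) → P A) →
  ∀ A → P A
compression-induction {n} P base step₁ step₂ A = go (suc (potential A)) A ≤-refl
  where
  large : ∀ {x y : Cube n} {a} → only y x ≡ a → a < suc n
  large {x} {y} refl = s≤s (only≤n y x)
  go : ∀ N A → potential A < N → P A
  go (suc N) A (s≤s h) with firstFailure (type1? A) (suc n)
  ... | inj₂ (a , (x , y , p , q , y∈A , x∉A) , T) =
    step₁ A a x y p q T y∈A x∉A (go N (comp x y A)
      (<-≤-trans (potential-comp x y A (inj₁ (only<⇒weight< x y (≤-reflexive (trans (cong suc q) (sym p))))) y∈A x∉A) h))
  ... | inj₁ T₁ with firstFailure (type2? A) (suc n)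
  ... | inj₂ (a , (x , y , p , q , l , y∈A , x∉A) , T) =
    step₂ A a x y p q l (λ b → λ x y p q → T₁ b (large {x} {y} q) x y p q) T (go N (comp x y A)
      (<-≤-trans (potential-comp x y A (inj₂ (only≡⇒weight≡ x y (trans p (sym q)) , l)) y∈A x∉A) h))
  ... | inj₁ T₂ = base A ((λ b x y p q → T₁ b (large {x} {y} q) x y p q) , (λ b x y p q → T₂ b (large {x} {y} q) x y p q))

Closed : ∀ {n} → Family n → Set
Closed A = ∀ x y → x ≺ y → y ∈ A → x ∈ A

-- If x is larger than y, elements of x ∖ y are removed until the excess is one, where type 1
-- applies; they are then restored one at a time by type 1 of level 0. Sets of equal size differ by
-- a single exchange of type 2.
Compressed⇒Closed : ∀ {n} (A : Family n) → Compressed A → Closed A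
Compressed⇒Closed A (T₁ , T₂) x y (inj₁ p) y∈A with weight<⇒only< x y p
... | q = higher (only x y ∸ suc (only y x)) x (trans (sym (m∸n+n≡m q)) (+-suc _ (only y x)))
  where
  higher : ∀ d x → only x y ≡ suc (d + only y x) → x ∈ A
  higher zero x h = T₁ (only y x) x y h refl y∈A
  higher (suc d) x h with pick-remove x y (suc (d + only y x)) h
  ... | x′ , up , e , f = T₁ 0 x x′ (proj₁ (Up-only up)) (proj₂ (Up-only up))
          (higher d x′ (trans e (cong (λ w → suc (d + w)) (sym f))))
Compressed⇒Closed A (T₁ , T₂) x y (inj₂ (p , l)) y∈A = T₂ (only x y) x y refl (sym (weight≡⇒only≡ x y p)) l y∈A

rank≡# : ∀ {n} (x : Cube n) → rank x ≡ # (λ y → simpLess y x)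
rank≡# x = card≡# (λ y → simpLess y x)

simpLess-irrefl : ∀ {n} (x : Cube n) → simpLess x x ≡ false
simpLess-irrefl x with simpLess x x in eq
... | true = ⊥-elim (≺-irrefl x (simpLess⇒≺ x x eq))
... | false = refl

Closed⇒initSeg : ∀ {n} (A : Family n) → Closed A → ∀ x → A x ≡ initSeg (# A) x
Closed⇒initSeg A closed x = bool-ext inside outside
  where
  inside : x ∈ A → (rank x <ᵇ # A) ≡ true
  inside x∈A = <⇒<ᵇ-true (≤-<-trans (≤-reflexive (rank≡# x))
    (#-mono-< (λ y p → closed y x (simpLess⇒≺ y x p) x∈A) x (simpLess-irrefl x) x∈A))
  outside : (rank x <ᵇ # A) ≡ true → x ∈ A
  outside h with ∈? A x
  ... | inj₁ p = p
  ... | inj₂ x∉A = ⊥-elim (<⇒≱ (<ᵇ-true (rank x) (# A) h) (≤-trans (#-mono before) (≤-reflexive (sym (rank≡# x)))))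
    where
    before : A ⊆ (λ y → simpLess y x)
    before y y∈A with ≺-total y x
    ... | inj₁ refl = ∈∉-absurd y∈A x∉A
    ... | inj₂ (inj₁ p) = ≺⇒simpLess y x p
    ... | inj₂ (inj₂ p) = ∈∉-absurd (closed x y p y∈A) x∉A

initSeg-Closed : ∀ {n} m → Closed (initSeg {n} m)
initSeg-Closed m x y x≺y h = <⇒<ᵇ-true (≤-<-trans rank≤ (<ᵇ-true (rank y) m h))
  where
  rank≤ : rank x ≤ rank y
  rank≤ = ≤-trans (≤-reflexive (rank≡# x)) (≤-trans
    (#-mono (λ z p → ≺⇒simpLess z y (≺-trans {x = z} {x} {y} (simpLess⇒≺ z x p) x≺y))) (≤-reflexive (sym (rank≡# y))))

-- The size of the initial segment is carried along in the induction. For sizes of actual families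
-- this replaces a separate proof that the ranks are exactly 0, ..., 2 ^ n - 1.
harper : ∀ {n} (A : Family n) → # initSeg {n} (# A) ≡ # A × # nb (initSeg {n} (# A)) ≤ # nb A
harper {n} = compression-induction Optimal base
  (λ A a x y p q T _ _ → step A x y (#-nb-comp₁ A a x y p q T))
  (λ A a x y p q l T₁ T → step A x y (#-nb-comp₂ A a x y p q l T₁ T))
  where
  OptimalSize : Family n → ℕ → Set
  OptimalSize A m = # initSeg {n} m ≡ m × # nb (initSeg {n} m) ≤ # nb A
  Optimal : Family n → Set
  Optimal A = OptimalSize A (# A)
  base : ∀ A → Compressed A → Optimal A
  base A c = sym (#-cong eq) , #-mono (nb-mono (λ x p → trans (eq x) p))
    where
    eq = Closed⇒initSeg A (Compressed⇒Closed A c)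
  step : ∀ A x y → # nb (comp x y A) ≤ # nb A → Optimal (comp x y A) → Optimal A
  step A x y h (e , f) = subst (OptimalSize A) (#-comp x y A) (e , ≤-trans f h)

-- Shadows of colexicographic segments

nb-snoc : ∀ {n} (S : Family (suc n)) b z → z ∈ nb (λ x → S (x ∷ʳ b)) → z ∷ʳ b ∈ nb S
nb-snoc S b z h with nb-elim (λ x → S (x ∷ʳ b)) z h
... | inj₁ p = ⊆-nb S (z ∷ʳ b) p
... | inj₂ (y , inj₁ u , p) = nb-intro S (inj₁ (Up-snoc b u)) p
... | inj₂ (y , inj₂ u , p) = nb-intro S (inj₂ (Up-snoc b u)) p

#-empty : ∀ {n} {A : Family n} → (∀ x → ¬ (x ∈ A)) → # A ≡ 0
#-empty {n} {A} h = trans (sumC-cong zeros) (sumC-zero n)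
  where
  zeros : ∀ x → ind (A x) ≡ 0
  zeros x with ∈? A x
  ... | inj₁ p = ⊥-elim (h x p)
  ... | inj₂ p = cong ind p

shadow : ∀ {n} → ℕ → Family n → Family n
shadow j S z = nb S z ∧ (suc (weight z) ≡ᵇ j)

shadow-intro : ∀ {n} j (S : Family n) z → z ∈ nb S → suc (weight z) ≡ j → z ∈ shadow j S
shadow-intro j S z p q = cong₂ _∧_ p (≡⇒≡ᵇ-true q)

shadow-elim : ∀ {n} j (S : Family n) z → z ∈ shadow j S → z ∈ nb S × suc (weight z) ≡ j
shadow-elim j S z h with ∧-true {nb S z} h
... | p , q = p , ≡ᵇ-true (suc (weight z)) j q

record ColexSegment {n} (j : ℕ) (S : Family n) : Set where
  field
    inLayer : ∀ x → x ∈ S → weight x ≡ j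
    initial : ∀ x y → weight x ≡ j → val x < val y → y ∈ S → x ∈ S

open ColexSegment

#-inLayer≤ : ∀ {n} j (S : Family n) → (∀ x → x ∈ S → weight x ≡ j) → # S ≤ n C j
#-inLayer≤ {n} j S h = ≤-trans (#-mono (λ x p → ≡⇒≡ᵇ-true (h x p))) (≤-reflexive (#-layer n j))

segment-snoc : ∀ {n} j b (S : Family (suc n)) → ColexSegment (ind b + j) S → ColexSegment j (λ x → S (x ∷ʳ b))
segment-snoc {n} j b S seg = record
  { inLayer = λ x p → +-cancelˡ-≡ (ind b) _ _ (trans (sym (weight-snoc x b)) (inLayer seg _ p))
  ; initial = λ x y w l p → initial seg _ _ (trans (weight-snoc x b) (cong (ind b +_) w))
      (≤-trans (≤-reflexive (cong suc (val-snoc x b))) (≤-trans (+-monoˡ-< (ind b * 2 ^ n) l) (≤-reflexive (sym (val-snoc y b))))) p }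

-- The case where no member contains the last element. By Pascal M = M′ + M₁, and the complement
-- grows by M′. Dropping the surplus from the induction hypothesis leaves the double counting bound
-- D j ≤ s₀ (i + 1); the ratio of the binomials turns it into D M′ ≤ s₀ M₁, which pays for the new
-- term D M′.
shadow-arith₁ : ∀ D j M′ M₁ D₁ s s₀ i → 0 < M₁ → M′ * suc i ≡ M₁ * j → s₀ ≤ s →
  D * j * M₁ + D * D₁ ≤ s₀ * suc i * M₁ →
  D * j * (M′ + M₁) + D * (D₁ + M′) ≤ s * suc (suc i) * (M′ + M₁)
shadow-arith₁ D j M′ (suc M₀) D₁ s s₀ i _ ratio s₀≤s ih = begin
  D * j * (M′ + M₁) + D * (D₁ + M′)
    ≡⟨ lem₁ D j M′ M₁ D₁ ⟩
  (D * j * M₁ + D * D₁) + D * M′ + D * j * M′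
    ≤⟨ +-mono-≤ (+-mono-≤ ih second) (*-monoˡ-≤ M′ first) ⟩
  s₀ * suc i * M₁ + s₀ * M₁ + s₀ * suc i * M′
    ≤⟨ m≤m+n _ (s₀ * M′) ⟩
  s₀ * suc i * M₁ + s₀ * M₁ + s₀ * suc i * M′ + s₀ * M′
    ≡⟨ lem₂ s₀ i M′ M₁ ⟩
  s₀ * suc (suc i) * (M′ + M₁)
    ≤⟨ *-monoˡ-≤ (M′ + M₁) (*-monoˡ-≤ (suc (suc i)) s₀≤s) ⟩
  s * suc (suc i) * (M′ + M₁) ∎
  where
  open ≤-Reasoning
  M₁ = suc M₀
  first : D * j ≤ s₀ * suc i
  first = *-cancelʳ-≤ (D * j) (s₀ * suc i) M₁ (≤-trans (m≤m+n _ (D * D₁)) ih)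
  second : D * M′ ≤ s₀ * M₁
  second = *-cancelʳ-≤ (D * M′) (s₀ * M₁) (suc i) (begin
    D * M′ * suc i   ≡⟨ *-assoc D M′ (suc i) ⟩
    D * (M′ * suc i) ≡⟨ cong (D *_) ratio ⟩
    D * (M₁ * j)     ≡⟨ lem D M₁ j ⟩
    D * j * M₁       ≤⟨ *-monoˡ-≤ M₁ first ⟩
    s₀ * suc i * M₁  ≡⟨ lem′ s₀ (suc i) M₁ ⟩
    s₀ * M₁ * suc i ∎)
    where
    lem : ∀ D M j → D * (M * j) ≡ D * j * M
    lem = solve-∀
    lem′ : ∀ s i M → s * i * M ≡ s * M * i
    lem′ = solve-∀
  lem₁ : ∀ D j M′ M₁ D₁ → D * j * (M′ + M₁) + D * (D₁ + M′) ≡ (D * j * M₁ + D * D₁) + D * M′ + D * j * M′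
  lem₁ = solve-∀
  lem₂ : ∀ s i M′ M₁ → s * suc i * M₁ + s * M₁ + s * suc i * M′ + s * M′ ≡ s * suc (suc i) * (M′ + M₁)
  lem₂ = solve-∀

-- The case where the segment contains the whole layer without the last element, of size M₁, and D₁
-- further sets. The shadow then contains a full layer of size M′. As M₁ + D₁ ≤ M, the required
-- surplus is at most D′, and the full layer pays for it through M₁ (j + 1) + D₁ + D′ = M′ (i + 1).
shadow-arith₂ : ∀ M′ M₁ D₁ D′ j s s₁ i → 0 < M′ → M′ * i ≡ M₁ * suc j → D₁ + D′ ≡ M′ → M′ + s₁ ≤ s →
  D₁ * j * M′ + D₁ * D′ ≤ s₁ * suc i * M′ →
  (M₁ + D₁) * suc j * (M′ + M₁) + (M₁ + D₁) * D′ ≤ s * suc i * (M′ + M₁)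
shadow-arith₂ (suc M₀) M₁ D₁ D′ j s s₁ i _ ratio split s≥ ih = begin
  (M₁ + D₁) * suc j * M + (M₁ + D₁) * D′
    ≤⟨ +-monoʳ-≤ ((M₁ + D₁) * suc j * M) (*-monoˡ-≤ D′ D≤M) ⟩
  (M₁ + D₁) * suc j * M + M * D′
    ≡⟨ lem₁ M₁ D₁ j M D′ ⟩
  (M₁ * suc j + (D₁ + D′) + D₁ * j) * M
    ≡⟨ cong (λ w → (w + D₁ * j) * M) (cong₂ _+_ (sym ratio) split) ⟩
  (M′ * i + M′ + D₁ * j) * M
    ≤⟨ *-monoˡ-≤ M (+-monoʳ-≤ (M′ * i + M′) first) ⟩
  (M′ * i + M′ + s₁ * suc i) * M
    ≡⟨ cong (_* M) (lem₂ M′ i s₁) ⟩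
  (M′ + s₁) * suc i * M
    ≤⟨ *-monoˡ-≤ M (*-monoˡ-≤ (suc i) s≥) ⟩
  s * suc i * M ∎
  where
  open ≤-Reasoning
  M′ = suc M₀
  M = M′ + M₁
  D≤M : M₁ + D₁ ≤ M
  D≤M = ≤-trans (+-monoʳ-≤ M₁ (m+n≤o⇒m≤o D₁ (≤-reflexive split))) (≤-reflexive (+-comm M₁ M′))
  first : D₁ * j ≤ s₁ * suc i
  first = *-cancelʳ-≤ (D₁ * j) (s₁ * suc i) M′ (≤-trans (m≤m+n _ (D₁ * D′)) ih)
  lem₁ : ∀ M₁ D₁ j M D′ → (M₁ + D₁) * suc j * M + M * D′ ≡ (M₁ * suc j + (D₁ + D′) + D₁ * j) * M
  lem₁ = solve-∀
  lem₂ : ∀ M′ i s₁ → M′ * i + M′ + s₁ * suc i ≡ (M′ + s₁) * suc i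
  lem₂ = solve-∀

-- Double counting gives |shadow S| (i + 1) ≥ D j for D = |S|.  The surplus D D′ / M, with
-- M = C(N, j), comes from induction on N, splitting off the largest element.
shadow-bound : ∀ N j i (S : Family N) → N ≡ j + i → ColexSegment j S → ∀ D′ → # S + D′ ≡ N C j →
  # S * j * (N C j) + # S * D′ ≤ # shadow j S * suc i * (N C j)
shadow-bound N zero i S eq seg D′ split rewrite *-zeroʳ (# S) = ≤-trans (≤-reflexive (lem (# S) D′ (trans split (C-zero N)))) z≤n
  where
  lem : ∀ d e → d + e ≡ 1 → d * e ≡ 0
  lem zero e _ = refl
  lem (suc zero) zero _ = refl
shadow-bound (suc N) (suc j) i S refl seg D′ split with search (λ x → S (x ∷ʳ true) Bool.≟ true)
... | no none = noLast i refl
  where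
  S₀ : Family N
  S₀ x = S (x ∷ʳ false)
  seg₀ : ColexSegment (suc j) S₀
  seg₀ = segment-snoc (suc j) false S seg
  #S : # S ≡ # S₀
  #S = trans (sumC-snoc (ind ∘ S)) (trans (cong (# S₀ +_) (#-empty {A = λ x → S (x ∷ʳ true)} (λ x p → none (x , p)))) (+-identityʳ (# S₀)))
  noLast : ∀ i′ → i ≡ i′ → # S * suc j * (suc N C suc j) + # S * D′ ≤ # shadow (suc j) S * suc i * (suc N C suc j)
  noLast zero refl = ≤-trans (≤-reflexive (trans (cong (λ d → d * suc j * (suc N C suc j) + d * D′) (trans #S S₀-empty)) refl)) z≤n
    where
    S₀-empty : # S₀ ≡ 0
    S₀-empty = #-empty λ x p → <⇒≱ (≤-reflexive (sym (inLayer seg₀ x p))) (≤-trans (weight≤n x) (≤-reflexive (+-identityʳ j)))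
  noLast (suc i′) refl = subst₂ (λ d M → d * suc j * M + d * D′ ≤ # shadow (suc j) S * suc (suc i′) * M)
      (sym #S) (nCk+nC[k+1]≡[n+1]C[k+1] N j)
      (subst (λ e → # S₀ * suc j * (M′ + M₁) + # S₀ * e ≤ # shadow (suc j) S * suc (suc i′) * (M′ + M₁)) D′≡
        (shadow-arith₁ (# S₀) (suc j) M′ M₁ D₁ (# shadow (suc j) S) (# shadow (suc j) S₀) i′
          M₁>0 (sym (C-ratio j (suc i′))) shadow≥
          (shadow-bound N (suc j) i′ S₀ (+-suc j i′) seg₀ D₁ (m+[n∸m]≡n D≤M₁))))
    where
    M′ = N C j
    M₁ = N C suc j
    D₁ = M₁ ∸ # S₀
    D≤M₁ : # S₀ ≤ M₁
    D≤M₁ = #-inLayer≤ (suc j) S₀ (inLayer seg₀)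
    M₁>0 : 0 < M₁
    M₁>0 = subst (λ n → 0 < n C suc j) (sym (+-suc j i′)) (C-positive (suc j) i′)
    D′≡ : D₁ + M′ ≡ D′
    D′≡ = +-cancelˡ-≡ (# S₀) _ _ (trans (sym (+-assoc (# S₀) D₁ M′)) (trans (cong (_+ M′) (m+[n∸m]≡n D≤M₁))
      (trans (+-comm M₁ M′) (trans (nCk+nC[k+1]≡[n+1]C[k+1] N j) (trans (sym split) (cong (_+ D′) #S))))))
    shadow≥ : # shadow (suc j) S₀ ≤ # shadow (suc j) S
    shadow≥ = ≤-trans (≤-trans (#-mono incl) (m≤m+n _ _)) (≤-reflexive (sym (sumC-snoc (ind ∘ shadow (suc j) S))))
      where
      incl : shadow (suc j) S₀ ⊆ (λ z → shadow (suc j) S (z ∷ʳ false))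
      incl z p with shadow-elim (suc j) S₀ z p
      ... | q , r = shadow-intro (suc j) S (z ∷ʳ false) (nb-snoc S false z q) (trans (cong suc (weight-snoc z false)) r)
... | yes (x₁ , x₁∈) = subst₂ (λ d M → d * suc j * M + d * D′ ≤ # shadow (suc j) S * suc i * M)
      (sym #S) (nCk+nC[k+1]≡[n+1]C[k+1] N j)
      (shadow-arith₂ M′ M₁ (# S₁) D′ j (# shadow (suc j) S) (# shadow j S₁) i (C-positive j i) (sym (C-ratio j i))
        split₁ shadow≥ (shadow-bound N j i S₁ refl seg₁ D′ split₁))
  where
  M′ = N C j
  M₁ = N C suc j
  S₁ : Family N
  S₁ x = S (x ∷ʳ true)
  seg₁ : ColexSegment j S₁
  seg₁ = segment-snoc j true S seg
  -- Within a layer, sets avoiding the last element precede those containing it, so one member of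
  -- the latter kind forces all of the former.
  full : ∀ y → weight y ≡ suc j → y ∷ʳ false ∈ S
  full y w = initial seg _ (x₁ ∷ʳ true) (trans (weight-snoc y false) w)
    (≤-trans (≤-reflexive (cong suc (trans (val-snoc y false) (+-identityʳ (val y)))))
      (≤-trans (val<2^n y) (≤-trans (≤-trans (≤-reflexive (sym (+-identityʳ (2 ^ N)))) (m≤n+m _ (val x₁))) (≤-reflexive (sym (val-snoc x₁ true)))))) x₁∈
  #S₀ : # (λ x → S (x ∷ʳ false)) ≡ M₁
  #S₀ = trans (#-cong (λ y → bool-ext
      (λ p → ≡⇒≡ᵇ-true (inLayer (segment-snoc (suc j) false S seg) y p))
      (λ p → full y (≡ᵇ-true (weight y) (suc j) p)))) (#-layer N (suc j))
  #S : # S ≡ M₁ + # S₁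
  #S = trans (sumC-snoc (ind ∘ S)) (cong (_+ # S₁) #S₀)
  split₁ : # S₁ + D′ ≡ M′
  split₁ = +-cancelˡ-≡ M₁ _ _ (trans (sym (+-assoc M₁ (# S₁) D′)) (trans (cong (_+ D′) (sym #S))
    (trans split (trans (sym (nCk+nC[k+1]≡[n+1]C[k+1] N j)) (+-comm M′ M₁)))))
  lower : ∀ z → weight z ≡ j → z ∷ʳ false ∈ nb S
  lower z w with weight z <? N
  ... | yes l with weight<n⇒Up z l
  ... | y , u = nb-intro S (inj₁ (Up-snoc false u)) (full y (trans (Up-weight u) (cong suc w)))
  -- Here j = N and no set above z avoids the last element. But z and x₁ are then both the full set,
  -- and z with the last element added is x₁ with it.
  lower z w | no l = nb-intro S (inj₁ (Up-last z)) (subst (_∈ S₁) (trans (weight≡n⇒ones x₁ x₁-ones) (sym (weight≡n⇒ones z z-ones))) x₁∈)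
    where
    z-ones : weight z ≡ N
    z-ones = ≤-antisym (weight≤n z) (≮⇒≥ l)
    x₁-ones : weight x₁ ≡ N
    x₁-ones = trans (inLayer seg₁ x₁ x₁∈) (trans (sym w) z-ones)
  shadow≥ : M′ + # shadow j S₁ ≤ # shadow (suc j) S
  shadow≥ = ≤-trans (+-mono-≤ (≤-trans (≤-reflexive (sym (#-layer N j))) (#-mono incl₀)) (#-mono incl₁))
    (≤-reflexive (sym (sumC-snoc (ind ∘ shadow (suc j) S))))
    where
    incl₀ : layer j ⊆ (λ z → shadow (suc j) S (z ∷ʳ false))
    incl₀ z p = shadow-intro (suc j) S _ (lower z w) (cong suc (trans (weight-snoc z false) w))
      where
      w = ≡ᵇ-true (weight z) j p
    incl₁ : shadow j S₁ ⊆ (λ z → shadow (suc j) S (z ∷ʳ true))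
    incl₁ z p with shadow-elim j S₁ z p
    ... | q , r = shadow-intro (suc j) S (z ∷ʳ true) (nb-snoc S true z q) (cong suc (trans (weight-snoc z true) r))

-- Neighbourhoods of families of nearly the size of a ball

Closed-before : ∀ {n} {B : Family n} → Closed B → ∀ {y z} → y ∈ B → B z ≡ false → y ≺ z
Closed-before closed {y} {z} y∈B z∉B with ≺-total y z
... | inj₁ refl = ∈∉-absurd y∈B z∉B
... | inj₂ (inj₁ p) = p
... | inj₂ (inj₂ p) = ∈∉-absurd (closed z y p y∈B) z∉B

≺⇒weight≤ : ∀ {n} (x y : Cube n) → x ≺ y → weight y ≤ weight x
≺⇒weight≤ x y (inj₁ p) = <⇒≤ p
≺⇒weight≤ x y (inj₂ (p , _)) = ≤-reflexive (sym p)

≺-snoc : ∀ {n} (x y : Cube n) → weight (x ∷ʳ false) ≡ weight (y ∷ʳ true) → x ∷ʳ false ≺ y ∷ʳ true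
≺-snoc {n} x y w = inj₂ (w , subst₂ _<_ (sym (trans (val-snoc x false) (+-identityʳ (val x)))) (sym (val-snoc y true))
  (<-≤-trans (val<2^n x) (≤-trans (≤-reflexive (sym (+-identityʳ (2 ^ n)))) (m≤n+m _ (val y)))))

-- If a set of size at least k were missing, all of B would precede it and hence lie in `atLeast k`,
-- making B too small.
atLeast-⊆-Closed : ∀ {n} k (B : Family n) → Closed B → # atLeast {n} k ≤ # B → atLeast k ⊆ B
atLeast-⊆-Closed k B closed size z h with ∈? B z
... | inj₁ p = p
... | inj₂ z∉B = ⊥-elim (<⇒≱ (#-mono-< incl z z∉B h) size)
  where
  incl : B ⊆ atLeast k
  incl y y∈B = ≤⇒≤ᵇ-true (≤-trans (≤ᵇ-true k (weight z) h) (≺⇒weight≤ y z (Closed-before closed y∈B z∉B)))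

-- The sets of size j avoiding the last element are the first C(n, j) of their layer. What an
-- initial segment adds to a ball, up to that amount, therefore lives in a cube of one dimension
-- less, where M = C(n, j) is the size of the layer.
halfLayer : ∀ {n} → ℕ → Family (suc n)
halfLayer j z = layer j z ∧ not (last z)

halfLayer-intro : ∀ {n} j (y : Cube n) → weight y ≡ j → y ∷ʳ false ∈ halfLayer j
halfLayer-intro j y w = cong₂ _∧_ (≡⇒≡ᵇ-true (trans (weight-snoc y false) w)) (cong not (last-∷ʳ false y))

last-false : ∀ {n} (y : Cube n) b → not (last (y ∷ʳ b)) ≡ true → b ≡ false
last-false y b h rewrite last-∷ʳ b y with b
... | false = refl

halfLayer-elim : ∀ {n} j (z : Cube (suc n)) → z ∈ halfLayer j → ∃[ y ] z ≡ y ∷ʳ false × weight y ≡ j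
halfLayer-elim j z h = go (initLast z)
  where
  go : (∃[ y ] ∃[ b ] z ≡ y ∷ʳ b) → ∃[ y ] z ≡ y ∷ʳ false × weight y ≡ j
  go (y , b , refl) with ∧-true {layer j (y ∷ʳ b)} h
  ... | p , q with last-false y b q
  ... | refl = y , refl , trans (sym (weight-snoc y false)) (≡ᵇ-true (weight (y ∷ʳ false)) j p)

#-halfLayer : ∀ {n} j → n C j ≤ # halfLayer {n} j
#-halfLayer {n} j = begin
  n C j              ≡⟨ #-layer n j ⟨
  # layer {n} j      ≤⟨ #-mono {A = layer {n} j} (λ y p → halfLayer-intro j y (≡ᵇ-true (weight y) j p)) ⟩
  sumC half          ≤⟨ m≤m+n (sumC half) (sumC (λ (y : Cube n) → ind (halfLayer j (y ∷ʳ true)))) ⟩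
  _                  ≡⟨ sumC-snoc (ind ∘ halfLayer {n} j) ⟨
  # halfLayer {n} j  ∎
  where
  open ≤-Reasoning
  half : Cube n → ℕ
  half y = ind (halfLayer j (y ∷ʳ false))

-- An initial segment of size at most |atLeast (j + 1)| + C(n, j) does not reach the sets
-- of size j containing the last element.
Closed-⊆-halfLayer : ∀ {n} j (B : Family (suc n)) → Closed B → # B ≤ # atLeast {suc n} (suc j) + n C j →
  ∀ z → z ∈ B → weight z ≤ j → z ∈ halfLayer j
Closed-⊆-halfLayer {n} j B closed size z z∈B w with ∈? (halfLayer j) z
... | inj₁ p = p
... | inj₂ z∉F = ⊥-elim (<⇒≱ (≤-<-trans disjoint (#-mono-< G⊆B z z∉G z∈B)) size)
  where
  G : Family (suc n)
  G y = atLeast (suc j) y ∨ halfLayer j y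
  disjoint : # atLeast {suc n} (suc j) + n C j ≤ # G
  disjoint = ≤-trans (+-monoʳ-≤ (# atLeast {suc n} (suc j)) (#-halfLayer j))
    (#-⊎ {A = G} {atLeast (suc j)} {halfLayer j} (λ y p → ∨-trueˡ p) (λ y p → ∨-trueʳ (atLeast (suc j) y) p)
      (λ y p q → <-irrefl (sym (≡ᵇ-true (weight y) j (proj₁ (∧-true {layer j y} q)))) (≤ᵇ-true (suc j) (weight y) p)))
  z∉G : G z ≡ false
  z∉G with atLeast (suc j) z in eq
  ... | true = ⊥-elim (<⇒≱ (≤ᵇ-true (suc j) (weight z) eq) w)
  ... | false = z∉F
  lastIn : weight z ≡ j → (∃[ z′ ] ∃[ b ] z ≡ z′ ∷ʳ b) → ∃[ z′ ] z ≡ z′ ∷ʳ true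
  lastIn e (z′ , true , refl) = z′ , refl
  lastIn e (z′ , false , refl) = ∈∉-absurd (halfLayer-intro j z′ (trans (sym (weight-snoc z′ false)) e)) z∉F
  earlier : ∀ y → y ∈ halfLayer j → y ≺ z
  earlier y p with halfLayer-elim j y p
  ... | y′ , refl , w′ with m≤n⇒m<n∨m≡n w
  ... | inj₁ l = inj₁ (<-≤-trans l (≤-reflexive (sym (trans (weight-snoc y′ false) w′))))
  ... | inj₂ e with lastIn e (initLast z)
  ... | z′ , refl = ≺-snoc y′ z′ (trans (weight-snoc y′ false) (trans w′ (sym e)))
  G⊆B : G ⊆ B
  G⊆B y p with ∨-true {atLeast (suc j) y} p
  ... | inj₁ q = closed y z (inj₁ (≤-<-trans w (≤ᵇ-true (suc j) (weight y) q))) z∈B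
  ... | inj₂ q = closed y z (earlier y q) z∈B

atLeast-⊆-nb : ∀ {n} j (B : Family n) → j < n → atLeast (suc j) ⊆ B → atLeast j ⊆ nb B
atLeast-⊆-nb j B j<n h z p with m≤n⇒m<n∨m≡n (≤ᵇ-true j (weight z) p)
... | inj₁ l = ⊆-nb B z (h z (≤⇒≤ᵇ-true l))
... | inj₂ refl with weight<n⇒Up z j<n
... | y , u = nb-intro B (inj₁ u) (h y (≤⇒≤ᵇ-true (≤-reflexive (sym (Up-weight u)))))

-- By Harper's theorem X may be replaced by an initial segment, which consists of `atLeast (j + 1)`
-- and D sets of size j without the last element. Its neighbourhood contains `atLeast j` and, one
-- layer below, the shadow of these D sets; s is the size of that shadow.
nb-above-ball : ∀ N j i → N ≡ j + i → (X : Family (suc N)) → ∀ D D′ →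
  # X ≡ # atLeast {suc N} (suc j) + D → D + D′ ≡ N C j →
  ∃[ s ] # atLeast {suc N} j + s ≤ # nb X × D * j * (N C j) + D * D′ ≤ s * suc i * (N C j)
nb-above-ball N j i N≡ X D D′ size split = # shadow j S , bound ,
  subst (λ d → d * j * (N C j) + d * D′ ≤ # shadow j S * suc i * (N C j)) #S
    (shadow-bound N j i S N≡ segment D′ (trans (cong (_+ D′) #S) split))
  where
  B L : Family (suc N)
  B = initSeg (# X)
  L z = B z ∧ layer j z
  S : Family N
  S y = L (y ∷ʳ false)
  closed : Closed B
  closed = initSeg-Closed (# X)
  #B : # B ≡ # atLeast {suc N} (suc j) + D
  #B = trans (proj₁ (harper X)) size
  upper : atLeast (suc j) ⊆ B
  upper = atLeast-⊆-Closed (suc j) B closed (≤-trans (m≤m+n _ D) (≤-reflexive (sym #B)))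
  low : ∀ z → z ∈ B → weight z ≤ j → z ∈ halfLayer j
  low = Closed-⊆-halfLayer j B closed (≤-trans (≤-reflexive #B) (+-monoʳ-≤ _ (m+n≤o⇒m≤o D (≤-reflexive split))))
  L-layer : ∀ z → z ∈ L → z ∈ B × weight z ≡ j
  L-layer z p with ∧-true {B z} p
  ... | q , r = q , ≡ᵇ-true (weight z) j r
  #L : # L ≡ # S
  #L = trans (sumC-snoc (ind ∘ L)) (trans (cong (# S +_) (#-empty {A = λ y → L (y ∷ʳ true)} none)) (+-identityʳ (# S)))
    where
    none : ∀ y → ¬ (L (y ∷ʳ true) ≡ true)
    none y p = case last-false y true (proj₂ (∧-true {layer j (y ∷ʳ true)}
      (low (y ∷ʳ true) (proj₁ (L-layer (y ∷ʳ true) p)) (≤-reflexive (proj₂ (L-layer (y ∷ʳ true) p)))))) of λ ()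
  #S : # S ≡ D
  #S = +-cancelˡ-≡ (# atLeast {suc N} (suc j)) _ _ (trans (cong (# atLeast {suc N} (suc j) +_) (sym #L)) (trans (≤-antisym
    (#-⊎ {A = B} {atLeast (suc j)} {L} upper (λ z p → proj₁ (L-layer z p))
      (λ z p q → <-irrefl (sym (proj₂ (L-layer z q))) (≤ᵇ-true (suc j) (weight z) p)))
    (#-∪ {A = B} {atLeast (suc j)} {L} cover)) #B))
    where
    cover : ∀ z → z ∈ B → z ∈ atLeast (suc j) ⊎ z ∈ L
    cover z p with suc j ≤? weight z
    ... | yes q = inj₁ (≤⇒≤ᵇ-true q)
    ... | no q = inj₂ (cong₂ _∧_ p (proj₁ (∧-true {layer j z} (low z p (≤-pred (≰⇒> q))))))
  segment : ColexSegment j S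
  segment = record
    { inLayer = λ y p → trans (sym (weight-snoc y false)) (proj₂ (L-layer (y ∷ʳ false) p))
    ; initial = λ x y w l p → case L-layer (y ∷ʳ false) p of λ { (q , r) →
        cong₂ _∧_ (closed (x ∷ʳ false) (y ∷ʳ false)
          (inj₂ (trans (weight-snoc x false) (trans w (sym r)) ,
                 subst₂ _<_ (sym (val-snoc x false)) (sym (val-snoc y false)) (+-monoˡ-< 0 l))) q)
          (≡⇒≡ᵇ-true (trans (weight-snoc x false) w)) } }
  shadow⊆ : shadow j S ⊆ (λ y → shadow j B (y ∷ʳ false))
  shadow⊆ y p with shadow-elim j S y p
  ... | q , r = shadow-intro j B (y ∷ʳ false)
        (nb-mono {A = L} {B} (λ z t → proj₁ (L-layer z t)) (y ∷ʳ false) (nb-snoc L false y q))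
        (trans (cong suc (weight-snoc y false)) r)
  j<n : j < suc N
  j<n = s≤s (≤-trans (m≤m+n j i) (≤-reflexive (sym N≡)))
  bound : # atLeast {suc N} j + # shadow j S ≤ # nb X
  bound = begin
    # atLeast {suc N} j + # shadow j S
      ≤⟨ +-monoʳ-≤ _ (≤-trans (#-mono shadow⊆) (m≤m+n _ _)) ⟩
    # atLeast {suc N} j + (sumC (λ y → ind (shadow j B (y ∷ʳ false))) + sumC (λ y → ind (shadow j B (y ∷ʳ true))))
      ≡⟨ cong (# atLeast {suc N} j +_) (sumC-snoc (ind ∘ shadow j B)) ⟨
    # atLeast {suc N} j + # shadow j B
      ≤⟨ #-⊎ {A = nb B} {atLeast j} {shadow j B} (atLeast-⊆-nb j B j<n upper)
           (λ z p → proj₁ (shadow-elim j B z p))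
           (λ z p q → <⇒≱ (≤-reflexive (proj₂ (shadow-elim j B z q))) (≤ᵇ-true j (weight z) p)) ⟩
    # nb B
      ≤⟨ proj₂ (harper X) ⟩
    # nb X ∎
    where open ≤-Reasoning

subfamily : ∀ {n} (B : Family n) m → m ≤ # B → Σ (Family n) λ B′ → B′ ⊆ B × # B′ ≡ m
subfamily {zero} B zero h = (λ _ → false) , (λ _ ()) , refl
subfamily {zero} B (suc m) h = B , (λ _ p → p) , ≤-antisym (≤-trans (ind≤1 (B [])) (s≤s z≤n)) h
subfamily {suc n} B m h with m ≤? # (λ x → B (true ∷ x))
... | yes p with subfamily (λ x → B (true ∷ x)) m p
... | C , C⊆ , #C = (λ { (true ∷ x) → C x ; (false ∷ x) → false }) ,
  (λ { (true ∷ x) q → C⊆ x q }) , trans (cong₂ _+_ #C (sumC-zero n)) (+-identityʳ m)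
subfamily {suc n} B m h | no p with subfamily (λ x → B (false ∷ x)) (m ∸ # (λ x → B (true ∷ x)))
    (≤-trans (∸-monoˡ-≤ (# (λ x → B (true ∷ x))) h) (≤-reflexive (m+n∸m≡n (# (λ x → B (true ∷ x))) _)))
... | C , C⊆ , #C = (λ { (true ∷ x) → B (true ∷ x) ; (false ∷ x) → C x }) ,
  (λ { (true ∷ x) q → q ; (false ∷ x) q → C⊆ x q }) ,
  trans (cong (# (λ x → B (true ∷ x)) +_) #C) (m+[n∸m]≡n (<⇒≤ (≰⇒> p)))

#atLeast-dual : ∀ n k r → n ≡ k + r → # atLeast {n} (suc r) + # atLeast {n} k ≡ 2 ^ n
#atLeast-dual n k r refl = trans (cong₂ _+_ (#-cong {A = atLeast {n} (suc r)} (λ x → lem (weight x) r)) (sym (#atMost≡#atLeast r k)))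
  (#-complement (atMost {n} r))
  where
  lem : ∀ w r → (suc r ≤ᵇ w) ≡ not (w ≤ᵇ r)
  lem zero r = refl
  lem (suc w) zero = refl
  lem (suc zero) (suc r) = refl
  lem (suc (suc w)) (suc r) = lem (suc w) r

nb-complement : ∀ {n} (X : Family n) → nb (not ∘ nb X) ⊆ (not ∘ X)
nb-complement X z h with ∈? X z
... | inj₂ p = cong not p
... | inj₁ p with nb-elim (not ∘ nb X) z h
... | inj₁ q = ∈∉-absurd (⊆-nb X z p) (not-true q)
... | inj₂ (y , a , q) = ∈∉-absurd (nb-intro X (Adj-sym a) p) (not-true q)

-- The complement of nb X slightly exceeds a ball and its neighbourhood avoids X, so the
-- bound above applies to it with j and i replaced by i + 1 and j - 1.
nb-deficit : ∀ N j i → N ≡ suc j + i → (X : Family (suc N)) → ∀ D l →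
  # X + D ≡ # atLeast {suc N} (suc (suc j)) → D < N C suc j →
  # nb X + l ≡ # atLeast {suc N} (suc j) → l * suc i ≤ D * suc j
nb-deficit N j i N≡ X D l size D<M total = go (l ≤? N C suc i)
  where
  N≡* : N ≡ suc i + j
  N≡* = trans N≡ (cong suc (+-comm j i))
  rearrange : ∀ a l c → (a + l) + c ≡ (c + l) + a
  rearrange = solve-∀
  B : Family (suc N)
  B = not ∘ nb X
  #B : # B ≡ # atLeast {suc N} (suc (suc i)) + l
  #B = +-cancelʳ-≡ (# nb X) _ _ (trans (#-complement (nb X)) (trans (sym (#atLeast-dual (suc N) (suc (suc i)) j (cong suc N≡*)))
    (trans (cong (_+ # atLeast {suc N} (suc (suc i))) (sym total)) (rearrange (# nb X) l _))))
  #notX : # (not ∘ X) ≡ # atLeast {suc N} (suc i) + D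
  #notX = +-cancelʳ-≡ (# X) _ _ (trans (#-complement X) (trans (sym (#atLeast-dual (suc N) (suc i) (suc j)
      (cong suc (trans N≡ (+-comm (suc j) i)))))
    (trans (cong (_+ # atLeast {suc N} (suc i)) (sym size)) (rearrange (# X) D _))))
  dual-ratio : (N C suc j) * suc j ≡ (N C suc i) * suc i
  dual-ratio = trans (subst (λ n → (n C suc j) * suc j ≡ (n C j) * suc i) (trans (+-suc j i) (sym N≡)) (C-ratio j (suc i)))
    (cong (_* suc i) (trans (nCk≡nC[n∸k] (≤-trans (m≤n+m j (suc i)) (≤-reflexive (sym N≡*))))
      (cong (N C_) (trans (cong (_∸ j) N≡*) (m+n∸n≡m (suc i) j)))))
  C>0 : 0 < N C suc i
  C>0 = subst (λ n → 0 < n C suc i) (sym N≡*) (C-positive (suc i) j)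
  -- The bound above a ball admits an excess of at most C(N, i + 1), so it is applied to a subfamily
  -- of the complement of the neighbourhood. If l exceeds this limit, l′ = C(N, i + 1) already
  -- forces C(N, j + 1) ≤ D, which is excluded.
  partial : ∀ l′ → l′ ≤ l → l′ ≤ N C suc i → l′ * suc i ≤ D * suc j
  partial l′ l′≤l l′≤M = fromSubfamily (subfamily B (# atLeast {suc N} (suc (suc i)) + l′)
      (≤-trans (+-monoʳ-≤ _ l′≤l) (≤-reflexive (sym #B))))
    where
    fromBound : ∀ (B′ : Family (suc N)) → B′ ⊆ B →
      ∃[ s ] # atLeast {suc N} (suc i) + s ≤ # nb B′ ×
        l′ * suc i * (N C suc i) + l′ * (N C suc i ∸ l′) ≤ s * suc j * (N C suc i) →
      l′ * suc i ≤ D * suc j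
    fromBound B′ B′⊆B (s , h , k) = ≤-trans
      (*-cancelʳ-≤ _ _ (N C suc i) {{>-nonZero C>0}} (≤-trans (m≤m+n _ (l′ * (N C suc i ∸ l′))) k)) (*-monoˡ-≤ (suc j) s≤D)
      where
      s≤D : s ≤ D
      s≤D = +-cancelˡ-≤ (# atLeast {suc N} (suc i)) s D (≤-trans h (≤-trans
        (#-mono {B = not ∘ X} (λ z q → nb-complement X z (nb-mono {B = B} B′⊆B z q))) (≤-reflexive #notX)))
    fromSubfamily : (Σ (Family (suc N)) λ B′ → B′ ⊆ B × # B′ ≡ # atLeast {suc N} (suc (suc i)) + l′) → l′ * suc i ≤ D * suc j
    fromSubfamily (B′ , B′⊆B , #B′) = fromBound B′ B′⊆B
      (nb-above-ball N (suc i) j N≡* B′ l′ (N C suc i ∸ l′) #B′ (m+[n∸m]≡n l′≤M))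
  go : Dec (l ≤ N C suc i) → l * suc i ≤ D * suc j
  go (yes q) = partial l ≤-refl q
  go (no q) = ⊥-elim (<⇒≱ D<M (*-cancelʳ-≤ (N C suc j) D (suc j)
    (≤-trans (≤-reflexive dual-ratio) (partial (N C suc i) (<⇒≤ (≰⇒> q)) ≤-refl))))

-- The witness l is the shortfall of |nb X| against the neighbourhood of a ball, and 0 if there is
-- none. Its price D j / (i + 1) equals the main term gained above a ball, so the two cancel later.
nb-below-ball : ∀ N j i → N ≡ j + i → (X : Family (suc N)) → ∀ D →
  # X + D ≡ # atLeast {suc N} (suc j) → D < N C j →
  ∃[ l ] # atLeast {suc N} j ≤ # nb X + l × l * suc i ≤ D * j
nb-below-ball N zero i N≡ X (suc D) size D<M = ⊥-elim (<⇒≱ D<M (≤-trans (≤-reflexive (C-zero N)) (s≤s z≤n)))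
nb-below-ball N zero i N≡ X zero size D<M = go
  (nb-above-ball N 0 i N≡ X 0 (N C 0) (trans (sym (+-identityʳ (# X))) (trans size (sym (+-identityʳ _)))) refl)
  where
  go : ∃[ s ] # atLeast {suc N} 0 + s ≤ # nb X × 0 * 0 * (N C 0) + 0 * (N C 0) ≤ s * suc i * (N C 0) →
    ∃[ l ] # atLeast {suc N} 0 ≤ # nb X + l × l * suc i ≤ 0
  go (s , h , _) = 0 , ≤-trans (m≤m+n _ s) (≤-trans h (m≤m+n _ 0)) , z≤n
nb-below-ball N (suc j) i N≡ X D size D<M = go (# atLeast {suc N} (suc j) ≤? # nb X)
  where
  go : Dec (# atLeast {suc N} (suc j) ≤ # nb X) → ∃[ l ] # atLeast {suc N} (suc j) ≤ # nb X + l × l * suc i ≤ D * suc j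
  go (yes p) = 0 , ≤-trans p (m≤m+n _ 0) , z≤n
  go (no p) = # atLeast {suc N} (suc j) ∸ # nb X , ≤-reflexive (sym total) ,
    nb-deficit N j i N≡ X D _ size D<M total
    where
    total : # nb X + (# atLeast {suc N} (suc j) ∸ # nb X) ≡ # atLeast {suc N} (suc j)
    total = m+[n∸m]≡n (<⇒≤ (≰⇒> p))

-- Distance to balls along compressions

∀ᵇ : (Bool → Bool) → Bool
∀ᵇ P = P true ∧ P false

∀ᵇ-sound : ∀ {P} → ∀ᵇ P ≡ true → ∀ b → P b ≡ true
∀ᵇ-sound {P} h true = proj₁ (∧-true {P true} h)
∀ᵇ-sound {P} h false = proj₂ (∧-true {P true} h)

△-choose : Bool → Bool → Bool → Bool → Bool → Bool → ℕ
△-choose t b u v h h′ = ind (choose t b u v xor h) + ind (choose b t v u xor h′)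

-- The estimates on one pair z, z ⊕ m, where u, v record membership in A and h, h′ membership in H.
-- They are verified by evaluating all 64 assignments.
moveᵇ flipᵇ : Bool → Bool → Bool → Bool → Bool → Bool → Bool
moveᵇ t b u v h h′ = ind (u xor h) + ind (v xor h′) ≤ᵇ
  △-choose t b u v h h′ + (ind ((t xor b) ∧ (h xor h′)) + ind ((t xor b) ∧ (h xor h′)))
flipᵇ t b u v h h′ = (ind (u xor h) + ind (v xor h′)) + (ind (u xor h′) + ind (v xor h)) ≤ᵇ
  (△-choose t b u v h h′ + △-choose t b u v h h′) + (ind (h xor h′) + ind (h xor h′))

moveᵇ-true : ∀ t b u v h h′ → moveᵇ t b u v h h′ ≡ true
moveᵇ-true t b u v h h′ = ∀ᵇ-sound {λ h′ → moveᵇ t b u v h h′} (∀ᵇ-sound {λ h → ∀ᵇ λ h′ → moveᵇ t b u v h h′}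
  (∀ᵇ-sound {λ v → ∀ᵇ λ h → ∀ᵇ λ h′ → moveᵇ t b u v h h′} (∀ᵇ-sound {λ u → ∀ᵇ λ v → ∀ᵇ λ h → ∀ᵇ λ h′ → moveᵇ t b u v h h′}
  (∀ᵇ-sound {λ b → ∀ᵇ λ u → ∀ᵇ λ v → ∀ᵇ λ h → ∀ᵇ λ h′ → moveᵇ t b u v h h′}
  (∀ᵇ-sound {λ t → ∀ᵇ λ b → ∀ᵇ λ u → ∀ᵇ λ v → ∀ᵇ λ h → ∀ᵇ λ h′ → moveᵇ t b u v h h′} refl t) b) u) v) h) h′

flipᵇ-true : ∀ t b u v h h′ → flipᵇ t b u v h h′ ≡ true
flipᵇ-true t b u v h h′ = ∀ᵇ-sound {λ h′ → flipᵇ t b u v h h′} (∀ᵇ-sound {λ h → ∀ᵇ λ h′ → flipᵇ t b u v h h′}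
  (∀ᵇ-sound {λ v → ∀ᵇ λ h → ∀ᵇ λ h′ → flipᵇ t b u v h h′} (∀ᵇ-sound {λ u → ∀ᵇ λ v → ∀ᵇ λ h → ∀ᵇ λ h′ → flipᵇ t b u v h h′}
  (∀ᵇ-sound {λ b → ∀ᵇ λ u → ∀ᵇ λ v → ∀ᵇ λ h → ∀ᵇ λ h′ → flipᵇ t b u v h h′}
  (∀ᵇ-sound {λ t → ∀ᵇ λ b → ∀ᵇ λ u → ∀ᵇ λ v → ∀ᵇ λ h → ∀ᵇ λ h′ → flipᵇ t b u v h h′} refl t) b) u) v) h) h′

module _ {n} (x y : Cube n) (A H : Family n) where

  private
    m = x ⊕ y
    f : Cube n → ℕ
    f z = ind (comp x y A z xor H z)

  pair-comp : ∀ z → f z + f (z ⊕ m) ≡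
    △-choose (agr y x z) (agr x y z) (A z) (A (z ⊕ m)) (H z) (H (z ⊕ m))
  pair-comp z = cong (λ w → f z + ind (w xor H (z ⊕ m))) (comp-⊕ x y A z)

  separated : Family n
  separated z = (agr y x z xor agr x y z) ∧ (H z xor H (z ⊕ m))

  -- An exchange within a pair can change the distance to H only if H contains exactly one of its
  -- two sets, and then by at most 2, the contribution of that pair to `separated`.
  △-move : # (A △ H) ≤ # (comp x y A △ H) + # separated
  △-move = double-cancel-≤ (begin
    # (A △ H) + # (A △ H)
      ≡⟨ sumC-pairs (ind ∘ (A △ H)) m ⟨
    sumC (λ z → ind (A z xor H z) + ind (A (z ⊕ m) xor H (z ⊕ m)))
      ≤⟨ sumC-mono pointwise ⟩
    sumC (λ z → (f z + f (z ⊕ m)) + (ind (separated z) + ind (separated z)))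
      ≡⟨ sumC-+ (λ z → f z + f (z ⊕ m)) (λ z → ind (separated z) + ind (separated z)) ⟩
    sumC (λ z → f z + f (z ⊕ m)) + sumC (λ z → ind (separated z) + ind (separated z))
      ≡⟨ cong₂ _+_ (sumC-pairs f m) (sumC-+ (ind ∘ separated) (ind ∘ separated)) ⟩
    (# (comp x y A △ H) + # (comp x y A △ H)) + (# separated + # separated)
      ≡⟨ +-interchange (# (comp x y A △ H)) _ _ _ ⟩
    (# (comp x y A △ H) + # separated) + (# (comp x y A △ H) + # separated) ∎)
    where
    open ≤-Reasoning
    pointwise : ∀ z → ind (A z xor H z) + ind (A (z ⊕ m) xor H (z ⊕ m)) ≤
      (f z + f (z ⊕ m)) + (ind (separated z) + ind (separated z))
    pointwise z = ≤-trans (≤ᵇ-true _ _ (moveᵇ-true (agr y x z) (agr x y z) (A z) (A (z ⊕ m)) (H z) (H (z ⊕ m))))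
      (≤-reflexive (cong (_+ (ind (separated z) + ind (separated z))) (sym (pair-comp z))))

  flipped : Family n
  flipped z = H (z ⊕ m)

  -- On each pair the compressed family agrees with A or with A swapped, and swapping A interchanges
  -- the distances to H and to its flip. So the sum of both distances is the same for A and its
  -- compression, and the triangle inequality replaces the flip by H.
  △-flip : # (A △ H) + # (A △ flipped) ≤ (# (comp x y A △ H) + # (comp x y A △ H)) + # (H △ flipped)
  △-flip = double-cancel-≤ (begin
    (# (A △ H) + # (A △ flipped)) + (# (A △ H) + # (A △ flipped))
      ≡⟨ +-interchange (# (A △ H)) _ _ _ ⟩
    (# (A △ H) + # (A △ H)) + (# (A △ flipped) + # (A △ flipped))
      ≡⟨ cong₂ _+_ (sumC-pairs (ind ∘ (A △ H)) m) (sumC-pairs (ind ∘ (A △ flipped)) m) ⟨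
    sumC (λ z → ind (A z xor H z) + ind (A (z ⊕ m) xor H (z ⊕ m))) +
    sumC (λ z → ind (A z xor H (z ⊕ m)) + ind (A (z ⊕ m) xor H (z ⊕ m ⊕ m)))
      ≡⟨ sumC-+ (λ z → ind (A z xor H z) + ind (A (z ⊕ m) xor H (z ⊕ m))) _ ⟨
    sumC (λ z → (ind (A z xor H z) + ind (A (z ⊕ m) xor H (z ⊕ m))) +
                (ind (A z xor H (z ⊕ m)) + ind (A (z ⊕ m) xor H (z ⊕ m ⊕ m))))
      ≤⟨ sumC-mono pointwise ⟩
    sumC (λ z → ((f z + f (z ⊕ m)) + (f z + f (z ⊕ m))) + (ind (H z xor flipped z) + ind (H z xor flipped z)))
      ≡⟨ sumC-+ (λ z → (f z + f (z ⊕ m)) + (f z + f (z ⊕ m))) _ ⟩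
    sumC (λ z → (f z + f (z ⊕ m)) + (f z + f (z ⊕ m))) + sumC (λ z → ind (H z xor flipped z) + ind (H z xor flipped z))
      ≡⟨ cong₂ _+_ (trans (sumC-+ (λ z → f z + f (z ⊕ m)) _) (cong₂ _+_ (sumC-pairs f m) (sumC-pairs f m)))
                   (sumC-+ (ind ∘ (H △ flipped)) (ind ∘ (H △ flipped))) ⟩
    ((d + d) + (d + d)) + (# (H △ flipped) + # (H △ flipped))
      ≡⟨ +-interchange (d + d) _ _ _ ⟩
    ((d + d) + # (H △ flipped)) + ((d + d) + # (H △ flipped)) ∎)
    where
    open ≤-Reasoning
    d = # (comp x y A △ H)
    pointwise : ∀ z → (ind (A z xor H z) + ind (A (z ⊕ m) xor H (z ⊕ m))) +
                      (ind (A z xor H (z ⊕ m)) + ind (A (z ⊕ m) xor H (z ⊕ m ⊕ m)))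
      ≤ ((f z + f (z ⊕ m)) + (f z + f (z ⊕ m))) + (ind (H z xor flipped z) + ind (H z xor flipped z))
    pointwise z = ≤-trans (≤-reflexive (cong (λ w → (ind (A z xor H z) + ind (A (z ⊕ m) xor H (z ⊕ m))) +
        (ind (A z xor H (z ⊕ m)) + ind (A (z ⊕ m) xor H w))) (⊕-cancelʳ z m)))
      (≤-trans (≤ᵇ-true _ _ (flipᵇ-true (agr y x z) (agr x y z) (A z) (A (z ⊕ m)) (H z) (H (z ⊕ m))))
        (≤-reflexive (cong (λ w → (w + w) + (ind (H z xor flipped z) + ind (H z xor flipped z))) (sym (pair-comp z)))))

-- Balls with translated centres.

⊕-exchange : ∀ {n} (x y z : Cube n) → x ⊕ (y ⊕ z) ≡ x ⊕ z ⊕ y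
⊕-exchange [] [] [] = refl
⊕-exchange (a ∷ x) (b ∷ y) (c ∷ z) = cong₂ _∷_ (trans (cong (a xor_) (xor-comm b c)) (sym (xor-assoc a c b))) (⊕-exchange x y z)

ball-⊕ : ∀ {n} (c m : Cube n) r z → ball (c ⊕ m) r z ≡ ball c r (z ⊕ m)
ball-⊕ c m r z = cong (_≤ᵇ r) (trans (hdist≡weight z (c ⊕ m)) (trans (cong weight (⊕-exchange z c m)) (sym (hdist≡weight (z ⊕ m) c))))

weight-⊕ : ∀ {n} (x y : Cube n) → weight (x ⊕ y) ≡ only x y + only y x
weight-⊕ [] [] = refl
weight-⊕ (true ∷ x) (true ∷ y) = weight-⊕ x y
weight-⊕ (true ∷ x) (false ∷ y) = cong suc (weight-⊕ x y)
weight-⊕ (false ∷ x) (true ∷ y) = trans (cong suc (weight-⊕ x y)) (sym (+-suc (only x y) (only y x)))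
weight-⊕ (false ∷ x) (false ∷ y) = weight-⊕ x y

⊕-weight-zero : ∀ {n} (x m : Cube n) → weight m ≡ 0 → x ⊕ m ≡ x
⊕-weight-zero [] [] _ = refl
⊕-weight-zero (a ∷ x) (false ∷ m) h = cong₂ _∷_ (xor-identityʳ a) (⊕-weight-zero x m h)

≤ᵇ-suc-suc : ∀ w r → (suc w ≤ᵇ suc r) ≡ (w ≤ᵇ r)
≤ᵇ-suc-suc zero r = refl
≤ᵇ-suc-suc (suc w) r = refl

≤ᵇ-step : ∀ w r → (suc w ≤ᵇ r) xor (w ≤ᵇ r) ≡ (w ≡ᵇ r)
≤ᵇ-step zero zero = refl
≤ᵇ-step zero (suc r) = refl
≤ᵇ-step (suc w) zero = refl
≤ᵇ-step (suc w) (suc r) = trans (cong ((suc w ≤ᵇ r) xor_) (≤ᵇ-suc-suc w r)) (≤ᵇ-step w r)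

-- Flipping one coordinate changes membership in the ball exactly when the other n coordinates
-- contain r ones; the flipped coordinate itself is arbitrary, hence the factor 2.
#-atMost-flip : ∀ n r (m : Cube (suc n)) → weight m ≡ 1 →
  # (λ w → atMost r w xor atMost r (w ⊕ m)) ≡ n C r + n C r
#-atMost-flip n r (true ∷ m) h = cong₂ _+_
  (trans (#-cong {A = λ w → (suc (weight w) ≤ᵇ r) xor (weight (w ⊕ m) ≤ᵇ r)} (λ w → trans (cong (λ v → (suc (weight w) ≤ᵇ r) xor (weight v ≤ᵇ r)) (same w)) (≤ᵇ-step (weight w) r))) (#-layer n r))
  (trans (#-cong {A = λ w → (weight w ≤ᵇ r) xor (suc (weight (w ⊕ m)) ≤ᵇ r)} (λ w → trans (cong (λ v → (weight w ≤ᵇ r) xor (suc (weight v) ≤ᵇ r)) (same w))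
    (trans (xor-comm (weight w ≤ᵇ r) _) (≤ᵇ-step (weight w) r)))) (#-layer n r))
  where
  same : ∀ w → w ⊕ m ≡ w
  same w = ⊕-weight-zero w m (suc-injective h)
#-atMost-flip zero r (false ∷ []) ()
#-atMost-flip (suc n) zero (false ∷ m) h = trans (cong₂ _+_ (sumC-zero (suc n)) (#-atMost-flip n zero m h))
  (cong (λ c → c + c) (trans (C-zero n) (sym (C-zero (suc n)))))
#-atMost-flip (suc n) (suc r) (false ∷ m) h = trans (cong₂ _+_
    (trans (#-cong {B = λ w → atMost r w xor atMost r (w ⊕ m)} (λ w → cong₂ _xor_ (≤ᵇ-suc-suc (weight w) r) (≤ᵇ-suc-suc (weight (w ⊕ m)) r))) (#-atMost-flip n r m h))
    (#-atMost-flip n (suc r) m h))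
  (trans (+-interchange (n C r) _ _ _) (cong (λ c → c + c) (nCk+nC[k+1]≡[n+1]C[k+1] n r)))

#-ball-flip : ∀ {n} (c : Cube (suc n)) r m → weight m ≡ 1 →
  # (ball c r △ (λ z → ball c r (z ⊕ m))) ≡ n C r + n C r
#-ball-flip {n} c r m h = trans (#-cong {B = λ z → F (z ⊕ c)} (λ z → cong₂ _xor_
    (cong (_≤ᵇ r) (hdist≡weight z c))
    (cong (_≤ᵇ r) (trans (hdist≡weight (z ⊕ m) c) (cong weight (trans (sym (⊕-exchange z c m)) (assoc z c m)))))))
  (trans (#-xor F c) (#-atMost-flip n r m h))
  where
  F : Family (suc n)
  F w = atMost r w xor atMost r (w ⊕ m)
  assoc : ∀ {n} (x y z : Cube n) → x ⊕ (y ⊕ z) ≡ x ⊕ y ⊕ z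
  assoc [] [] [] = refl
  assoc (a ∷ x) (b ∷ y) (c ∷ z) = cong₂ _∷_ (sym (xor-assoc a b c)) (assoc x y z)

-- Counting sets with a prescribed trace on x △ y.

free : ∀ {n} → Cube n → Cube n → ℕ
free [] [] = 0
free (a ∷ x) (b ∷ y) = ind (not (a xor b)) + free x y

free-only : ∀ {n} (x y : Cube n) → free x y + (only x y + only y x) ≡ n
free-only [] [] = refl
free-only (true ∷ x) (true ∷ y) = cong suc (free-only x y)
free-only (true ∷ x) (false ∷ y) = trans (+-suc (free x y) _) (cong suc (free-only x y))
free-only (false ∷ x) (true ∷ y) = trans (cong (free x y +_) (+-suc (only x y) (only y x)))
  (trans (+-suc (free x y) _) (cong suc (free-only x y)))
free-only (false ∷ x) (false ∷ y) = cong suc (free-only x y)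

agr-weight≥ : ∀ {n} (x y z : Cube n) → agr x y z ≡ true → only y x ≤ weight z
agr-weight≥ x y z h = ≤-trans (≤-reflexive (sym (proj₂ (agr-only x y z h)))) (only-≤ z _)
  where
  only-≤ : ∀ {n} (z w : Cube n) → only z w ≤ weight z
  only-≤ [] [] = z≤n
  only-≤ (a ∷ z) (b ∷ w) = +-mono-≤ (lem a b) (only-≤ z w)
    where
    lem : ∀ a b → ind (a ∧ not b) ≤ ind a
    lem true b = ind≤1 (not b)
    lem false b = z≤n

-- Such a z contains y ∖ x and misses x ∖ y, so it is determined by a j-element subset of the
-- coordinates where x and y agree.
#-agr-layer : ∀ {n} (x y : Cube n) j → # (λ z → agr x y z ∧ layer (only y x + j) z) ≡ free x y C j
#-agr-layer-same : ∀ {n} (x y : Cube n) j →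
  # (λ z → agr x y z ∧ (suc (weight z) ≡ᵇ only y x + j)) + # (λ z → agr x y z ∧ layer (only y x + j) z) ≡ suc (free x y) C j

#-agr-layer [] [] zero = refl
#-agr-layer [] [] (suc j) = sym (k>n⇒nCk≡0 {0} {suc j} (s≤s z≤n))
#-agr-layer (true ∷ x) (true ∷ y) j = #-agr-layer-same x y j
#-agr-layer (false ∷ x) (false ∷ y) j = #-agr-layer-same x y j
#-agr-layer {suc n} (true ∷ x) (false ∷ y) j = trans (cong (_+ # (λ z → agr x y z ∧ layer (only y x + j) z)) (sumC-zero n)) (#-agr-layer x y j)
#-agr-layer {suc n} (false ∷ x) (true ∷ y) j = trans (cong₂ _+_ (#-agr-layer x y j) (sumC-zero n)) (+-identityʳ (free x y C j))

#-agr-layer-same x y zero = trans (cong₂ _+_ (#-empty none) (#-agr-layer x y 0)) (trans (C-zero (free x y)) (sym (C-zero (suc (free x y)))))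
  where
  none : ∀ z → ¬ (agr x y z ∧ (suc (weight z) ≡ᵇ only y x + 0) ≡ true)
  none z h with ∧-true {agr x y z} h
  ... | p , q = <⇒≱ (≤-reflexive (trans (≡ᵇ-true (suc (weight z)) (only y x + 0) q) (+-identityʳ (only y x)))) (agr-weight≥ x y z p)
#-agr-layer-same x y (suc j) = trans (cong₂ _+_
    (trans (#-cong {B = λ z → agr x y z ∧ layer (only y x + j) z} (λ z → cong (λ k → agr x y z ∧ (suc (weight z) ≡ᵇ k)) (+-suc (only y x) j))) (#-agr-layer x y j))
    (#-agr-layer x y (suc j)))
  (nCk+nC[k+1]≡[n+1]C[k+1] (free x y) j)

C-suc≥ : ∀ n k → n C k ≤ suc n C suc k
C-suc≥ n k = ≤-trans (m≤m+n _ _) (≤-reflexive (nCk+nC[k+1]≡[n+1]C[k+1] n k))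

C-monoˡ : ∀ n k → n C k ≤ suc n C k
C-monoˡ n zero = ≤-reflexive (trans (C-zero n) (sym (C-zero (suc n))))
C-monoˡ n (suc k) = ≤-trans (m≤n+m (n C suc k) (n C k)) (≤-reflexive (nCk+nC[k+1]≡[n+1]C[k+1] n k))

-- Two extra elements suffice for the factor 2, by Pascal's rule and monotonicity; each further pair
-- of elements only enlarges the right side.
C-double : ∀ a r j → (r C j) + (r C j) ≤ (suc a + suc a + r) C (suc a + j)
C-double zero r j = ≤-trans (+-mono-≤ (C-monoˡ r j) (C-suc≥ r j))
  (≤-reflexive (nCk+nC[k+1]≡[n+1]C[k+1] (suc r) j))
C-double (suc a) r j = ≤-trans (C-double a r j) (≤-trans (C-suc≥ (suc a + suc a + r) (suc a + j))
  (≤-trans (C-monoˡ (suc (suc a + suc a + r)) (suc (suc a + j)))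
    (≤-reflexive (cong (λ w → w C (suc (suc a + j))) (lem a r)))))
  where
  lem : ∀ a r → suc (suc (suc a + suc a + r)) ≡ suc (suc a) + suc (suc a) + r
  lem = solve-∀

ball-ones : ∀ j i (z : Cube (suc (j + i))) → ball ones i z ≡ atLeast (suc j) z
ball-ones j i z = bool-ext
  (λ h → ≤⇒≤ᵇ-true (+-cancelˡ-≤ i (suc j) (weight z) (≤-trans (≤-reflexive (+-comm i (suc j)))
    (≤-trans (≤-reflexive (sym total)) (+-monoˡ-≤ (weight z) (≤ᵇ-true (hdist z ones) i h))))))
  (λ h → ≤⇒≤ᵇ-true (+-cancelʳ-≤ (suc j) (hdist z ones) i
    (≤-trans (+-monoʳ-≤ (hdist z ones) (≤ᵇ-true (suc j) (weight z) h)) (≤-reflexive (trans total (+-comm (suc j) i))))))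
  where
  total : hdist z ones + weight z ≡ suc j + i
  total = trans (cong (_+ weight z) (hdist≡weight z ones)) (weight-⊕-ones z)

-- Up-sets under compression.

Upset : ∀ {n} → Family n → Set
Upset A = ∀ {x y} → Up x y → x ∈ A → y ∈ A

Type1⇒Upset : ∀ {n} (A : Family n) → Type1 A 0 → Upset A
Type1⇒Upset A T {x} {y} u = T y x (proj₁ (Up-only u)) (proj₂ (Up-only u))

Upset⇒Type1 : ∀ {n} (A : Family n) → Upset A → Type1 A 0
Upset⇒Type1 A up x y p q y∈A with pick-remove x y 0 p
... | x′ , u , e , f with only-zero⇒≡ x′ y e (trans f q)
... | refl = up u y∈A

no-top-bottom-edge : ∀ {n} (x y : Cube n) {u v} → Up u v → agr y x u ≡ true → agr x y v ≡ true → only x y ≡ 0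
no-top-bottom-edge (a ∷ x) (b ∷ y) (here {x = z}) p q
  with ∧-true {not (b xor a) ∨ not (false xor a)} p | ∧-true {not (a xor b) ∨ not (true xor b)} q
... | p₀ , p₁ | q₀ , q₁ with agr-both x y z q₁ p₁
... | refl = cong₂ _+_ (lem a b p₀) (only-self x)
  where
  lem : ∀ a b → (not (b xor a) ∨ not (false xor a)) ≡ true → ind (a ∧ not b) ≡ 0
  lem true true _ = refl
  lem true false ()
  lem false b _ = refl
no-top-bottom-edge (a ∷ x) (b ∷ y) (there {b = c} w) p q
  with ∧-true {not (b xor a) ∨ not (c xor a)} p | ∧-true {not (a xor b) ∨ not (c xor b)} q
... | p₀ , p₁ | q₀ , q₁ = cong₂ _+_ (lem a b c p₀ q₀) (no-top-bottom-edge x y w p₁ q₁)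
  where
  lem : ∀ a b c → (not (b xor a) ∨ not (c xor a)) ≡ true → (not (a xor b) ∨ not (c xor b)) ≡ true → ind (a ∧ not b) ≡ 0
  lem true true _ _ _ = refl
  lem true false true _ ()
  lem true false false () _
  lem false _ _ _ _ = refl

-- Problems arise only for edges in a direction of V, where the upper end leaves the upper state or
-- reaches the lower one. The exchange is then complete but for one element of V, and `goodV`
-- supplies membership in A itself. As U is nonempty, no edge joins the two states directly.
comp-Upset : ∀ {n} (x y : Cube n) (A : Family n) → only x y ≢ 0 →
  (∀ s t → NearV x y s t → t ∈ A → s ∈ A) → Upset A → Upset (comp x y A)
comp-Upset x y A ne goodV up {u} {v} w h = go (comp-elim x y A u x≢y h) (direction x y w)
  where
  m = x ⊕ y
  x≢y : x ≢ y
  x≢y refl = ne (only-self x)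
  go : (u ∈ A × (agr x y u ≡ true → u ⊕ m ∈ A)) ⊎ (agr y x u ≡ true × agr x y u ≡ false × u ⊕ m ∈ A) →
    Direction x y u v → v ∈ comp x y A
  go (inj₁ (p , q)) (out e f w′) = comp-intro x y A v (up w p) (λ b → up w′ (q (trans e b)))
  go (inj₁ (p , q)) (inU e f w′ near) = comp-intro x y A v (up w p) (λ b → ∈∉-absurd b e)
  go (inj₁ (p , q)) (inV e f w′ near) = comp-intro x y A v (up w p) (λ b → goodV (v ⊕ m) u (proj₁ (near b)) p)
  go (inj₂ (t , b , p)) (out e f w′) = comp-intro-top x y A v (trans (sym f) t) (trans (sym e) b) (up w′ p)
  go (inj₂ (t , b , p)) (inU e f w′ near) = ∈∉-absurd t f
  go (inj₂ (t , b , p)) (inV e f w′ near) = comp-intro x y A v (v∈A (direction x y w′)) (λ c → ⊥-elim (ne (no-top-bottom-edge x y w t c)))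
    where
    bot : agr x y (u ⊕ m) ≡ true
    bot = trans (agr-⊕ x y u) t
    v∈A : Direction x y (v ⊕ m) (u ⊕ m) → v ∈ A
    v∈A (out e′ _ _) = ∈∉-absurd (trans (sym (agr-⊕ x y v)) (trans e′ bot)) f
    v∈A (inU e′ _ _ _) = ∈∉-absurd bot e′
    v∈A (inV _ _ _ near′) = subst (_∈ A) (⊕-cancelʳ v m) (goodV (v ⊕ m ⊕ m) (u ⊕ m) (proj₂ (near′ bot)) p)

-- Removing one element of s ∖ t leaves an exchange of level a, already performed in A; s is
-- recovered because A is an up-set.
comp₁-Upset : ∀ {n} (A : Family n) a x y → only x y ≡ suc (suc a) → only y x ≡ suc a →
  (∀ b → b < suc a → Type1 A b) → Upset (comp x y A)
comp₁-Upset A a x y p q T = comp-Upset x y A (λ e → case trans (sym p) e of λ ()) goodV up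
  where
  up : Upset A
  up = Type1⇒Upset A (T 0 (s≤s z≤n))
  goodV : ∀ s t → NearV x y s t → t ∈ A → s ∈ A
  goodV s t (e , f) t∈A with pick-remove s t (suc a) (trans e p)
  ... | s′ , u , g , h = up u (T a ≤-refl s′ t g (trans h (suc-injective (trans f q))) t∈A)

comp₂-Upset : ∀ {n} (A : Family n) a x y → only x y ≡ suc a → only y x ≡ suc a →
  (∀ b → Type1 A b) → Upset (comp x y A)
comp₂-Upset A a x y p q T = comp-Upset x y A (λ e → case trans (sym p) e of λ ())
  (λ s t (e , f) → T a s t (trans e p) (suc-injective (trans f q))) (Type1⇒Upset A (T 0))

-- The exchange raises the size by exactly one, so only a set of size j can enter `atLeast (j + 1)`
-- by it.
agr-bottom-weight : ∀ {n} (x y : Cube n) j a → only x y ≡ suc a → only y x ≡ a → ∀ z → agr x y z ≡ true →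
  atLeast (suc j) z xor atLeast (suc j) (z ⊕ (x ⊕ y)) ≡ true → weight z ≡ j
agr-bottom-weight x y j a p q z b h = sym (≡ᵇ-true j (weight z) (trans (sym (≤ᵇ-step j (weight z)))
  (trans (cong ((suc j ≤ᵇ weight z) xor_) (sym (trans (cong (suc j ≤ᵇ_) raise) (≤ᵇ-suc-suc j (weight z))))) h)))
  where
  raise : weight (z ⊕ (x ⊕ y)) ≡ suc (weight z)
  raise = +-cancelʳ-≡ a _ _ (trans (cong (weight (z ⊕ (x ⊕ y)) +_) (sym (trans (proj₂ (agr-only x y z b)) q)))
    (trans (weight-only (z ⊕ (x ⊕ y)) z) (trans (cong (weight z +_) (trans (proj₁ (agr-only x y z b)) p)) (+-suc (weight z) a))))

-- The separated pairs consist of the sets of size j that contain V and miss U, together with their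
-- images, 2 C(r, j - |V|) sets in all, where r counts the coordinates outside x △ y. Since V is
-- nonempty, the 2 |V| = 2 (a + 1) elements by which j + i exceeds r absorb the factor 2. For V = ∅
-- the count would be 2 M.
#-separated₁ : ∀ j i (x y : Cube (suc (j + i))) (A : Family (suc (j + i))) a →
  only x y ≡ suc (suc a) → only y x ≡ suc a → # separated x y A (atLeast (suc j)) ≤ (j + i) C j
#-separated₁ j i x y A a p q = ≤-trans (#-∪ {A = separated x y A (atLeast (suc j))} {L} {λ z → L (z ⊕ m)} cover)
  (≤-trans (≤-reflexive (cong (# L +_) (#-xor L m))) (go (suc a ≤? j)))
  where
  m = x ⊕ y
  L : Family (suc (j + i))
  L z = agr x y z ∧ layer j z
  cover : ∀ z → z ∈ separated x y A (atLeast (suc j)) → z ∈ L ⊎ z ⊕ m ∈ L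
  cover z h = [ inj₂ ∘ upper , inj₁ ∘ lower ]′ (xor-true (agr y x z) (agr x y z) (proj₁ (∧-true {agr y x z xor agr x y z} h)))
    where
    differ : atLeast (suc j) z xor atLeast (suc j) (z ⊕ m) ≡ true
    differ = proj₂ (∧-true {agr y x z xor agr x y z} h)
    xor-true : ∀ t b → t xor b ≡ true → t ≡ true ⊎ b ≡ true
    xor-true true b _ = inj₁ refl
    xor-true false b h = inj₂ h
    lower : agr x y z ≡ true → z ∈ L
    lower b = cong₂ _∧_ b (≡⇒≡ᵇ-true (agr-bottom-weight x y j (suc a) p q z b differ))
    upper : agr y x z ≡ true → z ⊕ m ∈ L
    upper t = cong₂ _∧_ b (≡⇒≡ᵇ-true (agr-bottom-weight x y j (suc a) p q (z ⊕ m) b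
      (trans (cong (λ w → atLeast (suc j) (z ⊕ m) xor atLeast (suc j) w) (⊕-cancelʳ z m))
        (trans (xor-comm (atLeast (suc j) (z ⊕ m)) (atLeast (suc j) z)) differ))))
      where
      b : agr x y (z ⊕ m) ≡ true
      b = trans (agr-⊕ x y z) t
  N≡ : suc a + suc a + free x y ≡ j + i
  N≡ = suc-injective (trans (lem a (free x y)) (trans (cong₂ (λ s t → free x y + (s + t)) (sym p) (sym q)) (free-only x y)))
    where
    lem : ∀ a r → suc (suc a + suc a + r) ≡ r + (suc (suc a) + suc a)
    lem = solve-∀
  #L : ∀ j′ → j ≡ suc a + j′ → # L ≡ free x y C j′
  #L j′ e = trans (#-cong {B = λ z → agr x y z ∧ layer (only y x + j′) z}
    (λ z → cong (λ k → agr x y z ∧ layer k z) (trans e (cong (_+ j′) (sym q))))) (#-agr-layer x y j′)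
  go : Dec (suc a ≤ j) → # L + # L ≤ (j + i) C j
  go (yes l) = ≤-trans (≤-reflexive (cong (λ c → c + c) (#L (j ∸ suc a) j≡)))
    (≤-trans (C-double a (free x y) (j ∸ suc a)) (≤-reflexive (cong₂ _C_ N≡ (sym j≡))))
    where
    j≡ : j ≡ suc a + (j ∸ suc a)
    j≡ = sym (m+[n∸m]≡n l)
  go (no l) = ≤-trans (≤-reflexive (cong (λ c → c + c) (#-empty {A = L} none))) z≤n
    where
    none : ∀ z → ¬ (L z ≡ true)
    none z h = l (≤-trans (≤-trans (≤-reflexive (sym q)) (agr-weight≥ x y z (proj₁ (∧-true {agr x y z} h))))
      (≤-reflexive (≡ᵇ-true (weight z) j (proj₂ (∧-true {agr x y z} h)))))

-- These exchanges preserve size, so both sets of a pair lie on the same side of `atLeast (j + 1)`.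
#-separated₂ : ∀ {n} j (x y : Cube n) A → only x y ≡ only y x → # separated x y A (atLeast (suc j)) ≡ 0
#-separated₂ j x y A p = #-empty {A = separated x y A (atLeast (suc j))} none
  where
  m = x ⊕ y
  same : ∀ z → agr x y z ≡ true → weight (z ⊕ m) ≡ weight z
  same z b = only≡⇒weight≡ (z ⊕ m) z (trans (proj₁ (agr-only x y z b)) (trans p (sym (proj₂ (agr-only x y z b)))))
  xor-self : ∀ b {P : Set} → b xor b ≡ true → P
  xor-self true ()
  xor-self false ()
  none : ∀ z → ¬ (separated x y A (atLeast (suc j)) z ≡ true)
  none z h with ∧-true {agr y x z xor agr x y z} h
  ... | p , q with agr x y z in b
  ... | true = xor-self (suc j ≤ᵇ weight z) (trans (cong (λ w → (suc j ≤ᵇ weight z) xor (suc j ≤ᵇ w)) (sym (same z b))) q)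
  ... | false = xor-self (suc j ≤ᵇ weight z) (trans (cong (λ w → (suc j ≤ᵇ weight z) xor (suc j ≤ᵇ w))
          (trans (cong weight (sym (⊕-cancelʳ z m))) (same (z ⊕ m) (trans (agr-⊕ x y z) t)))) q)
    where
    t : agr y x z ≡ true
    t with agr y x z
    ... | true = refl

-- If closeness to a ball self-improves for the families of the size of a ball with
-- neighbourhood at most W, it can be pulled back along the compressions leading to an initial segment.
module _ (j i W : ℕ) (self-improving : ∀ (A : Family (suc (j + i))) → # A ≡ # atLeast {suc (j + i)} (suc j) → # nb A ≤ W →
    ∀ c → 100 * # (A △ ball c i) ≤ 101 * ((j + i) C j) → 100 * # (A △ ball c i) ≤ (j + i) C j) where

  private
    N = j + i
    M = N C j
    size = # atLeast {suc N} (suc j)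

  Near : Family (suc N) → Cube (suc N) → Set
  Near A c = 100 * # (A △ ball c i) ≤ M

  -- Origin of the threshold 101: with d at most M / 100, a move by M ends within 1.01 M of the
  -- ball, and self-improvement brings it back to M / 100.
  near-step : ∀ A c d → # A ≡ size → # nb A ≤ W → # (A △ ball c i) ≤ d + M → 100 * d ≤ M → Near A c
  near-step A c d s w h k = self-improving A s w c (≤-trans (*-monoʳ-≤ 100 h)
    (≤-trans (≤-reflexive (*-distribˡ-+ 100 d M)) (+-monoˡ-≤ (100 * M) k)))

  △-ball-ones : ∀ A → # (A △ ball ones i) ≡ # (A △ atLeast (suc j))
  △-ball-ones A = #-cong {A = A △ ball ones i} {A △ atLeast (suc j)} (λ z → cong (A z xor_) (ball-ones j i z))

  near-ones-step : ∀ x y A → # nb (comp x y A) ≤ # nb A → # separated x y A (atLeast (suc j)) ≤ M →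
    (# comp x y A ≡ size → # nb (comp x y A) ≤ W → Near (comp x y A) ones) → # A ≡ size → # nb A ≤ W → Near A ones
  near-ones-step x y A nb≤ sep ih s w = near-step A ones (# (comp x y A △ ball ones i)) s w
    (≤-trans (≤-reflexive (△-ball-ones A)) (≤-trans (△-move x y A (atLeast (suc j)))
      (+-mono-≤ (≤-reflexive (sym (△-ball-ones (comp x y A)))) sep)))
    (ih (trans (#-comp x y A) s) (≤-trans nb≤ w))

  -- Up-sets have no violation of type 1 at level 0, and the other compressions preserve up-sets, so
  -- the induction stays among up-sets and the centre stays `ones`. It starts from
  -- `atLeast (j + 1)`, which is that ball.
  near-ball-Upset : ∀ A → Type1 A 0 → # A ≡ size → # nb A ≤ W → Near A ones
  near-ball-Upset = compression-induction (λ A → Type1 A 0 → # A ≡ size → # nb A ≤ W → Near A ones) base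
    step₁ step₂
    where
    base : ∀ A → Compressed A → Type1 A 0 → # A ≡ size → # nb A ≤ W → Near A ones
    base A c _ s _ = ≤-trans (≤-reflexive (trans (cong (100 *_) (trans (△-ball-ones A) (#-empty {A = A △ atLeast (suc j)} none))) (*-zeroʳ 100))) z≤n
      where
      incl : atLeast (suc j) ⊆ A
      incl = atLeast-⊆-Closed (suc j) A (Compressed⇒Closed A c) (≤-reflexive (sym s))
      none : ∀ z → ¬ (A z xor atLeast (suc j) z ≡ true)
      none z h with ∈? (atLeast (suc j)) z | ∈? A z
      ... | inj₁ p | inj₁ q = case trans (sym (cong₂ _xor_ q p)) h of λ ()
      ... | inj₁ p | inj₂ q = ∈∉-absurd (incl z p) q
      ... | inj₂ p | inj₂ q = case trans (sym (cong₂ _xor_ q p)) h of λ ()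
      ... | inj₂ p | inj₁ q = <-irrefl (sym s) (#-mono-< incl z p q)
    step₁ : ∀ A a x y → only x y ≡ suc a → only y x ≡ a → (∀ b → b < a → Type1 A b) → y ∈ A → A x ≡ false →
      (Type1 (comp x y A) 0 → # comp x y A ≡ size → # nb (comp x y A) ≤ W → Near (comp x y A) ones) →
      Type1 A 0 → # A ≡ size → # nb A ≤ W → Near A ones
    step₁ A zero x y p q T y∈A x∉A ih T₀ = ∈∉-absurd (T₀ x y p q y∈A) x∉A
    step₁ A (suc a) x y p q T y∈A x∉A ih T₀ = near-ones-step x y A (#-nb-comp₁ A (suc a) x y p q T)
      (#-separated₁ j i x y A a p q) (ih (Upset⇒Type1 (comp x y A) (comp₁-Upset A a x y p q T)))
    step₂ : ∀ A a x y → only x y ≡ a → only y x ≡ a → val x < val y → (∀ b → Type1 A b) → (∀ b → b < a → Type2 A b) →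
      (Type1 (comp x y A) 0 → # comp x y A ≡ size → # nb (comp x y A) ≤ W → Near (comp x y A) ones) →
      Type1 A 0 → # A ≡ size → # nb A ≤ W → Near A ones
    step₂ A zero x y p q l T₁ T ih T₀ with only-zero⇒≡ x y p q
    ... | refl = ⊥-elim (<-irrefl refl l)
    step₂ A (suc a) x y p q l T₁ T ih T₀ = near-ones-step x y A (#-nb-comp₂ A (suc a) x y p q l T₁ T)
      (≤-trans (≤-reflexive (#-separated₂ j x y A (trans p (sym q)))) z≤n)
      (ih (Upset⇒Type1 (comp x y A) (comp₂-Upset A a x y p q T₁)))

  -- Only compressions with U a singleton and V = ∅ are followed here, with the centre flipped when
  -- that brings the ball closer; every other step already starts from an up-set.
  near-ball : ∀ A → # A ≡ size → # nb A ≤ W → ∃[ c ] Near A c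
  near-ball = compression-induction (λ A → # A ≡ size → # nb A ≤ W → ∃[ c ] Near A c)
    (λ A c s w → ones , near-ball-Upset A (proj₁ c 0) s w)
    step₁
    (λ A a x y p q l T₁ T ih s w → ones , near-ball-Upset A (T₁ 0) s w)
    where
    step₁ : ∀ A a x y → only x y ≡ suc a → only y x ≡ a → (∀ b → b < a → Type1 A b) → y ∈ A → A x ≡ false →
      (# comp x y A ≡ size → # nb (comp x y A) ≤ W → ∃[ c ] Near (comp x y A) c) → # A ≡ size → # nb A ≤ W → ∃[ c ] Near A c
    step₁ A (suc a) x y p q T _ _ ih s w = ones , near-ball-Upset A (T 0 (s≤s z≤n)) s w
    step₁ A zero x y p q T _ _ ih s w = go (ih (trans (#-comp x y A) s) (≤-trans (#-nb-comp₁ A 0 x y p q T) w))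
      where
      m = x ⊕ y
      go : (∃[ c ] Near (comp x y A) c) → ∃[ c ] Near A c
      go (c , k) = choice (≤-total (# (A △ ball c i)) (d + M))
        where
        d = # (comp x y A △ ball c i)
        flip : # (A △ ball c i) + # (A △ ball (c ⊕ m) i) ≤ (d + M) + (d + M)
        flip = begin
          # (A △ ball c i) + # (A △ ball (c ⊕ m) i)
            ≡⟨ cong (# (A △ ball c i) +_) (#-cong {A = A △ ball (c ⊕ m) i} (λ z → cong (A z xor_) (ball-⊕ c m i z))) ⟩
          # (A △ ball c i) + # (A △ flipped x y A (ball c i))
            ≤⟨ △-flip x y A (ball c i) ⟩
          (d + d) + # (ball c i △ (λ z → ball c i (z ⊕ m)))
            ≡⟨ cong ((d + d) +_) (trans (#-ball-flip c i m (trans (weight-⊕ x y) (cong₂ _+_ p q))) (cong (λ e → e + e) N-C-i)) ⟩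
          (d + d) + (M + M)
            ≡⟨ +-interchange d d M M ⟩
          (d + M) + (d + M) ∎
          where
          open ≤-Reasoning
          N-C-i : N C i ≡ M
          N-C-i = trans (nCk≡nC[n∸k] (m≤n+m i j)) (cong (N C_) (m+n∸n≡m j i))
        choice : # (A △ ball c i) ≤ d + M ⊎ d + M ≤ # (A △ ball c i) → ∃[ c ] Near A c
        choice (inj₁ h) = c , near-step A c d s w h k
        choice (inj₂ h) = c ⊕ m , near-step A (c ⊕ m) d s w
          (+-cancelˡ-≤ (d + M) _ _ (≤-trans (+-monoˡ-≤ (# (A △ ball (c ⊕ m) i)) h) flip)) k

-- Local stability

#-∩-∖ : ∀ {n} (A H : Family n) → # (λ x → A x ∧ H x) + # (A ∖ H) ≡ # A
#-∩-∖ A H = trans (sym (sumC-+ (λ x → ind (A x ∧ H x)) (ind ∘ (A ∖ H)))) (sumC-cong (λ x → lem (A x) (H x)))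
  where
  lem : ∀ a h → ind (a ∧ h) + ind (a ∧ not h) ≡ ind a
  lem true true = refl
  lem true false = refl
  lem false _ = refl

#-∪-∖ : ∀ {n} (A H : Family n) → # (A ∪ H) ≡ # H + # (A ∖ H)
#-∪-∖ A H = trans (sumC-cong (λ x → lem (A x) (H x))) (sumC-+ (ind ∘ H) (ind ∘ (A ∖ H)))
  where
  lem : ∀ a h → ind (a ∨ h) ≡ ind h + ind (a ∧ not h)
  lem true true = refl
  lem true false = refl
  lem false h = sym (+-identityʳ (ind h))

#-△ : ∀ {n} (A H : Family n) → # A ≡ # H → # (A △ H) ≡ # (A ∖ H) + # (A ∖ H)
#-△ A H e = trans (trans (sumC-cong (λ x → lem (A x) (H x))) (sumC-+ (ind ∘ (A ∖ H)) (ind ∘ (H ∖ A))))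
  (cong (# (A ∖ H) +_) (+-cancelˡ-≡ (# (λ x → A x ∧ H x)) _ _
    (trans (cong (_+ # (H ∖ A)) (#-cong {A = λ x → A x ∧ H x} {λ x → H x ∧ A x} (λ x → Bool.∧-comm (A x) (H x))))
      (trans (#-∩-∖ H A) (trans (sym e) (sym (#-∩-∖ A H)))))))
  where
  lem : ∀ a h → ind (a xor h) ≡ ind (a ∧ not h) + ind (h ∧ not a)
  lem true true = refl
  lem true false = refl
  lem false true = refl
  lem false false = refl

-- Here K = i + 1 and B = C(n + 1, j). Eliminating s and l leaves D D′ + B K M ≤ ∂ K M; with B K =
-- (n + 1) M and the bound on ∂ this becomes 1000 q D D′ ≤ p M². From 5 D ≤ 3 M follows D′ ≥ 2 M /
-- 5, and 400 = 1000 · 2 / 5.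
gap-arith : ∀ M D D′ j s l K B ∂ n q p → 0 < M → D + D′ ≡ M → 5 * D ≤ 3 * M →
  D * j * M + D * D′ ≤ s * K * M → l * K ≤ D * j → B + s ≤ ∂ + l → B * K ≡ suc n * M →
  ∂ * (1000 * q * suc n) ≤ (1000 * q * suc n + p) * B → 400 * q * D ≤ p * M
gap-arith M D D′ j s l K B ∂ n q p M>0 split D≤ gain loss balance BK bound =
  *-cancelʳ-≤ (400 * q * D) (p * M) (5 * M) {{m*n≢0 5 M {{_}} {{>-nonZero M>0}}}} (begin
    400 * q * D * (5 * M)        ≡⟨ lem₁ q D M ⟩
    1000 * q * D * (2 * M)       ≤⟨ *-monoʳ-≤ (1000 * q * D) D′≥ ⟩
    1000 * q * D * (5 * D′)      ≡⟨ lem₂ q D D′ ⟩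
    5 * (1000 * q * (D * D′))    ≤⟨ *-monoʳ-≤ 5 third ⟩
    5 * (p * M * M)              ≡⟨ lem₃ p M ⟩
    p * M * (5 * M) ∎)
  where
  open ≤-Reasoning
  τ = 1000 * q * suc n
  lem₁ : ∀ q D M → 400 * q * D * (5 * M) ≡ 1000 * q * D * (2 * M)
  lem₁ = solve-∀
  lem₂ : ∀ q D D′ → 1000 * q * D * (5 * D′) ≡ 5 * (1000 * q * (D * D′))
  lem₂ = solve-∀
  lem₃ : ∀ p M → 5 * (p * M * M) ≡ p * M * (5 * M)
  lem₃ = solve-∀
  D′≥ : 2 * M ≤ 5 * D′
  D′≥ = +-cancelˡ-≤ (3 * M) _ _ (begin
    3 * M + 2 * M   ≡⟨ lem M ⟩
    5 * M           ≡⟨ cong (5 *_) split ⟨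
    5 * (D + D′)    ≡⟨ *-distribˡ-+ 5 D D′ ⟩
    5 * D + 5 * D′  ≤⟨ +-monoˡ-≤ (5 * D′) D≤ ⟩
    3 * M + 5 * D′ ∎)
    where
    lem : ∀ M → 3 * M + 2 * M ≡ 5 * M
    lem = solve-∀
  first : D * D′ + B * K * M ≤ ∂ * K * M
  first = +-cancelˡ-≤ (D * j * M) _ _ (begin
    D * j * M + (D * D′ + B * K * M)   ≡⟨ lem₄ (D * j * M) (D * D′) (B * K * M) ⟩
    (D * j * M + D * D′) + B * K * M   ≤⟨ +-monoˡ-≤ (B * K * M) gain ⟩
    s * K * M + B * K * M              ≡⟨ lem₅ s K M B ⟩
    (B + s) * K * M                    ≤⟨ *-monoˡ-≤ M (*-monoˡ-≤ K balance) ⟩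
    (∂ + l) * K * M                    ≡⟨ lem₆ ∂ l K M ⟩
    l * K * M + ∂ * K * M              ≤⟨ +-monoˡ-≤ (∂ * K * M) (*-monoˡ-≤ M loss) ⟩
    D * j * M + ∂ * K * M ∎)
    where
    lem₄ : ∀ a b c → a + (b + c) ≡ (a + b) + c
    lem₄ = solve-∀
    lem₅ : ∀ s K M B → s * K * M + B * K * M ≡ (B + s) * K * M
    lem₅ = solve-∀
    lem₆ : ∀ ∂ l K M → (∂ + l) * K * M ≡ l * K * M + ∂ * K * M
    lem₆ = solve-∀
  second : τ * (D * D′) ≤ p * (B * K * M)
  second = +-cancelˡ-≤ (τ * (B * K * M)) _ _ (begin
    τ * (B * K * M) + τ * (D * D′)   ≡⟨ lem₄ τ (B * K * M) (D * D′) ⟩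
    τ * (D * D′ + B * K * M)         ≤⟨ *-monoʳ-≤ τ first ⟩
    τ * (∂ * K * M)                  ≡⟨ lem₅ τ ∂ K M ⟩
    ∂ * τ * (K * M)                  ≤⟨ *-monoˡ-≤ (K * M) bound ⟩
    (τ + p) * B * (K * M)            ≡⟨ lem₆ τ p B K M ⟩
    τ * (B * K * M) + p * (B * K * M) ∎)
    where
    lem₄ : ∀ τ b d → τ * b + τ * d ≡ τ * (d + b)
    lem₄ = solve-∀
    lem₅ : ∀ τ ∂ K M → τ * (∂ * K * M) ≡ ∂ * τ * (K * M)
    lem₅ = solve-∀
    lem₆ : ∀ τ p B K M → (τ + p) * B * (K * M) ≡ τ * (B * K * M) + p * (B * K * M)
    lem₆ = solve-∀
  third : 1000 * q * (D * D′) ≤ p * M * M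
  third = *-cancelˡ-≤ (suc n) (begin
    suc n * (1000 * q * (D * D′))  ≡⟨ lem₄ (suc n) (1000 * q) (D * D′) ⟩
    τ * (D * D′)                   ≤⟨ second ⟩
    p * (B * K * M)                ≡⟨ cong (λ w → p * (w * M)) BK ⟩
    p * (suc n * M * M)            ≡⟨ lem₅ p (suc n) M ⟩
    suc n * (p * M * M) ∎)
    where
    lem₄ : ∀ n t d → n * (t * d) ≡ t * n * d
    lem₄ = solve-∀
    lem₅ : ∀ p n M → p * (n * M * M) ≡ n * (p * M * M)
    lem₅ = solve-∀

module _ (j i : ℕ) where

  private
    N = j + i
    M = N C j
    size = # atLeast {suc N} (suc j)

  M>0 : 0 < M
  M>0 = C-positive j i

  #ball : ∀ (c : Cube (suc N)) → # ball c i ≡ size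
  #ball = #-ball (suc j) i refl

  #nb-ball : ∀ (c : Cube (suc N)) → # nb (ball c i) ≤ # atLeast {suc N} j
  #nb-ball c = ≤-trans (#-mono (nb-ball c i)) (≤-reflexive (#-ball j (suc i) (sym (+-suc j i)) c))

  module _ (A : Family (suc N)) (#A : # A ≡ size) (c : Cube (suc N)) where

    private
      H = ball c i
      D = # (A ∖ H)

    #A∩H : # (λ z → A z ∧ H z) + D ≡ size
    #A∩H = trans (#-∩-∖ A H) #A

    #A∪H : # (A ∪ H) ≡ size + D
    #A∪H = trans (#-∪-∖ A H) (cong (_+ D) (#ball c))

    nb-∩∪ : # nb (λ z → A z ∧ H z) + # nb (A ∪ H) ≤ # nb A + # atLeast {suc N} j
    nb-∩∪ = ≤-trans (nb-submodular A H) (+-monoʳ-≤ (# nb A) (#nb-ball c))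

    dist : # (A △ H) ≡ D + D
    dist = #-△ A H (trans #A (sym (#ball c)))

    -- A ∪ H exceeds a ball by D and A ∩ H falls short of one by the same D. The main terms D j / (i
    -- + 1) of gain and loss cancel, so only the surplus D (M - D) / M of the shadow estimate
    -- remains.
    gap : ∀ p q → # vboundary A * (1000 * q * suc N) ≤ (1000 * q * suc N + p) * (suc N C j) →
      5 * D ≤ 3 * M → 400 * q * D ≤ p * M
    gap p q bound D≤ = go
      (nb-above-ball N j i refl (A ∪ H) D (M ∸ D) #A∪H (m+[n∸m]≡n (<⇒≤ D<M)))
      (nb-below-ball N j i refl (λ z → A z ∧ H z) D #A∩H D<M)
      where
      D<M : D < M
      D<M = *-cancelˡ-< 5 D M (≤-<-trans D≤ (*-monoˡ-< M {{>-nonZero M>0}} (s≤s (s≤s (s≤s (s≤s (z≤n {1})))))))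
      go : ∃[ s ] # atLeast {suc N} j + s ≤ # nb (A ∪ H) × D * j * M + D * (M ∸ D) ≤ s * suc i * M →
        ∃[ l ] # atLeast {suc N} j ≤ # nb (λ z → A z ∧ H z) + l × l * suc i ≤ D * j →
        400 * q * D ≤ p * M
      go (s , s≤ , gain) (l , l≥ , loss) = gap-arith M D (M ∸ D) j s l (suc i) (suc N C j) (# vboundary A) N q p M>0
        (m+[n∸m]≡n (<⇒≤ D<M)) D≤ gain loss balance (C-suc-ratio j i) bound
        where
        open ≤-Reasoning
        balance : (suc N C j) + s ≤ # vboundary A + l
        balance = +-cancelˡ-≤ (# atLeast {suc N} j + size) _ _ (begin
          (# atLeast {suc N} j + size) + ((suc N C j) + s)
            ≡⟨ lem₁ (# atLeast {suc N} j) size (suc N C j) s ⟩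
          ((suc N C j) + size) + (# atLeast {suc N} j + s)
            ≡⟨ cong (_+ (# atLeast {suc N} j + s)) (#atLeast-split (suc N) j) ⟨
          # atLeast {suc N} j + (# atLeast {suc N} j + s)
            ≤⟨ +-mono-≤ l≥ s≤ ⟩
          (# nb (λ z → A z ∧ H z) + l) + # nb (A ∪ H)
            ≡⟨ lem₂ (# nb (λ z → A z ∧ H z)) l (# nb (A ∪ H)) ⟩
          (# nb (λ z → A z ∧ H z) + # nb (A ∪ H)) + l
            ≤⟨ +-monoˡ-≤ l nb-∩∪ ⟩
          # nb A + # atLeast {suc N} j + l
            ≡⟨ cong (λ w → w + # atLeast {suc N} j + l) (trans (#-nb A) (cong (_+ # vboundary A) #A)) ⟩
          size + # vboundary A + # atLeast {suc N} j + l
            ≡⟨ lem₃ size (# vboundary A) (# atLeast {suc N} j) l ⟩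
          (# atLeast {suc N} j + size) + (# vboundary A + l) ∎)
          where
          lem₁ : ∀ a m b s → (a + m) + (b + s) ≡ (b + m) + (a + s)
          lem₁ = solve-∀
          lem₂ : ∀ x l y → (x + l) + y ≡ (x + y) + l
          lem₂ = solve-∀
          lem₃ : ∀ m v a l → m + v + a + l ≡ (a + m) + (v + l)
          lem₃ = solve-∀

-- The extremal families

J : ∀ {n} → ℕ → ℕ → Family n
J m D = initSeg (m ∸ D) ∪ (initSeg (m + D) ∖ initSeg m)

upperHalfLayer : ∀ {n} → ℕ → Family (suc n)
upperHalfLayer j z = layer (suc j) z ∧ last z

last-true : ∀ {n} (y : Cube n) b → last (y ∷ʳ b) ≡ true → b ≡ true
last-true y b h = trans (sym (last-∷ʳ b y)) h

upperHalfLayer-elim : ∀ {n} j (z : Cube (suc n)) → z ∈ upperHalfLayer j → (∃[ y ] z ≡ y ∷ʳ true) × weight z ≡ suc j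
upperHalfLayer-elim j z h = go (initLast z) , ≡ᵇ-true (weight z) (suc j) (proj₁ (∧-true {layer (suc j) z} h))
  where
  go : (∃[ y ] ∃[ b ] z ≡ y ∷ʳ b) → ∃[ y ] z ≡ y ∷ʳ true
  go (y , b , e) = y , trans e (cong (y ∷ʳ_) (last-true y b
    (subst (λ w → last w ≡ true) e (proj₂ (∧-true {layer (suc j) z} h)))))

#-upperHalfLayer : ∀ {n} j → n C j ≤ # upperHalfLayer {n} j
#-upperHalfLayer {n} j = begin
  n C j                   ≡⟨ #-layer n j ⟨
  # layer {n} j           ≤⟨ #-mono {A = layer {n} j} (λ y p → cong₂ _∧_
                               (≡⇒≡ᵇ-true (trans (weight-snoc y true) (cong suc (≡ᵇ-true (weight y) j p)))) (last-∷ʳ true y)) ⟩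
  sumC half               ≤⟨ m≤n+m (sumC half) (sumC (λ (y : Cube n) → ind (upperHalfLayer j (y ∷ʳ false)))) ⟩
  _                       ≡⟨ sumC-snoc (ind ∘ upperHalfLayer {n} j) ⟨
  # upperHalfLayer {n} j  ∎
  where
  open ≤-Reasoning
  half : Cube n → ℕ
  half y = ind (upperHalfLayer j (y ∷ʳ true))

-- An initial segment missing fewer than C(n, j) sets of a ball misses only sets of size
-- j + 1 containing the last element.
Closed-⊇ : ∀ {n} j (P : Family (suc n)) D → Closed P → # P + D ≡ # atLeast {suc n} (suc j) → D < n C j →
  ∀ x → (suc (suc j) ≤ weight x ⊎ ∃[ y ] x ≡ y ∷ʳ false × weight y ≡ suc j) → x ∈ P
Closed-⊇ {n} j P D closed size D<M x kind with ∈? P x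
... | inj₁ p = p
... | inj₂ x∉P = ⊥-elim (<⇒≱ (≤-<-trans disjoint (#-mono-< G⊆ x x∉G (≤⇒≤ᵇ-true weight-x)))
    (≤-trans (≤-reflexive (sym size)) (+-monoʳ-≤ (# P) (<⇒≤ D<M))))
  where
  G : Family (suc n)
  G z = P z ∨ upperHalfLayer j z
  before : ∀ z → z ∈ P → z ≺ x
  before z p = Closed-before closed p x∉P
  weight-x : suc j ≤ weight x
  weight-x = [ <⇒≤ , (λ { (y , e , w) → ≤-reflexive (sym (trans (cong weight e) (trans (weight-snoc y false) w))) }) ]′ kind
  after : ∀ z → z ∈ upperHalfLayer j → x ≺ z
  after z h with upperHalfLayer-elim j z h
  ... | (z′ , refl) , w = [ (λ l → inj₁ (≤-<-trans (≤-reflexive w) l)) ,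
      (λ { (y , refl , w′) → ≺-snoc y z′ (trans (weight-snoc y false) (trans w′ (sym w))) }) ]′ kind
  disjoint : # P + n C j ≤ # G
  disjoint = ≤-trans (+-monoʳ-≤ (# P) (#-upperHalfLayer j))
    (#-⊎ {A = G} {P} {upperHalfLayer j} (λ z p → ∨-trueˡ p) (λ z p → ∨-trueʳ (P z) p)
      (λ z p q → ≺-irrefl z (≺-trans {x = z} {x} {z} (before z p) (after z q))))
  x∉G : G x ≡ false
  x∉G with ∈? (upperHalfLayer j) x
  ... | inj₁ q = ⊥-elim (≺-irrefl x (after x q))
  ... | inj₂ q = cong₂ _∨_ x∉P q
  G⊆ : G ⊆ atLeast (suc j)
  G⊆ z p with ∨-true {P z} p
  ... | inj₁ q = ≤⇒≤ᵇ-true (≤-trans weight-x (≺⇒weight≤ z x (before z q)))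
  ... | inj₂ q = ≤⇒≤ᵇ-true (≤-reflexive (sym (proj₂ (upperHalfLayer-elim j z q))))

-- A converse to the submodular inequality, with initial segments P and Q in place of A ∩ H and A ∪
-- H. The sets added beyond the ball have size j and avoid the last element, while P lacks only sets
-- of size j + 1 containing it. Hence the added sets and their upper neighbours are already in nb P;
-- their lower neighbours lie in nb Q outside `atLeast j`, all of which nb Q contains.
nb-J : ∀ j i D → D < (j + i) C j → let size = # atLeast {suc (j + i)} (suc j) in
  # initSeg {suc (j + i)} (size ∸ D) + D ≡ size → # initSeg {suc (j + i)} (size + D) ≡ size + D →
  # initSeg {suc (j + i)} size ≡ size →
  # nb (J {suc (j + i)} size D) + # atLeast {suc (j + i)} j ≤
  # nb (initSeg {suc (j + i)} (size ∸ D)) + # nb (initSeg {suc (j + i)} (size + D))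
nb-J j i D D<M #P #Q #R = ≤-trans (+-monoˡ-≤ (# atLeast {suc N} j) (#-∪ {A = nb (J size D)} {nb P} {Q′} cover))
  (≤-trans (≤-reflexive (+-assoc (# nb P) (# Q′) _))
    (+-monoʳ-≤ (# nb P) (#-⊎ {A = nb Q} {Q′} {atLeast j} (λ z p → proj₁ (∧-true {nb Q z} p))
      (atLeast-⊆-nb j Q (s≤s (m≤m+n j i)) (atLeast-⊆-Closed (suc j) Q (initSeg-Closed (size + D)) (≤-trans (m≤m+n size D) (≤-reflexive (sym #Q)))))
      (λ z p q → ∈∉-absurd q (not-true (proj₂ (∧-true {nb Q z} p)))))))
  where
  N = j + i
  size = # atLeast {suc N} (suc j)
  P Q R Q′ : Family (suc N)
  P = initSeg (size ∸ D)
  Q = initSeg (size + D)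
  R = initSeg size
  Q′ z = nb Q z ∧ not (atLeast j z)
  P⊇ : ∀ x → (suc (suc j) ≤ weight x ⊎ ∃[ y ] x ≡ y ∷ʳ false × weight y ≡ suc j) → x ∈ P
  P⊇ = Closed-⊇ j P D (initSeg-Closed (size ∸ D)) #P D<M
  added : ∀ y → y ∈ Q → R y ≡ false → ∃[ y′ ] y ≡ y′ ∷ʳ false × weight y′ ≡ j
  added y p q = halfLayer-elim j y (Closed-⊆-halfLayer j Q (initSeg-Closed (size + D))
    (≤-trans (≤-reflexive #Q) (+-monoʳ-≤ size (<⇒≤ D<M))) y p low)
    where
    low : weight y ≤ j
    low with suc j ≤? weight y
    ... | no r = ≤-pred (≰⇒> r)
    ... | yes r = ∈∉-absurd (atLeast-⊆-Closed (suc j) R (initSeg-Closed size) (≤-reflexive (sym #R)) y (≤⇒≤ᵇ-true r)) q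
  j<N : ∀ y → y ∈ Q → R y ≡ false → j < N
  -- For j = N the bound M is 1, so D = 0, Q = R and nothing was added. Otherwise an added set can
  -- be enlarged without using the last element.
  j<N y p q with j <? N
  ... | yes r = r
  ... | no r = ∈∉-absurd (subst (λ m → initSeg {suc N} m y ≡ true) (trans (cong (size +_) D≡0) (+-identityʳ size)) p) q
    where
    D≡0 : D ≡ 0
    D≡0 = n≤0⇒n≡0 (≤-pred (≤-trans D<M (≤-reflexive
      (trans (cong (_C j) (≤-antisym (≮⇒≥ r) (m≤m+n j i))) (nCn≡1 j)))))
  above : ∀ z y → y ∈ Q → R y ≡ false → z ≡ y ⊎ Up y z → z ∈ nb P
  above z y p q (inj₁ refl) = go (added y p q)
    where
    go : (∃[ y′ ] y ≡ y′ ∷ʳ false × weight y′ ≡ j) → y ∈ nb P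
    go (y′ , e , w) = go′ (weight<n⇒Up y′ (≤-<-trans (≤-reflexive w) (j<N y p q)))
      where
      go′ : (∃[ v ] Up y′ v) → y ∈ nb P
      go′ (v , u) = subst (_∈ nb P) (sym e) (nb-intro P (inj₁ (Up-snoc false u))
        (P⊇ (v ∷ʳ false) (inj₂ (v , refl , trans (Up-weight u) (cong suc w)))))
  above z y p q (inj₂ u) = go (weight<n⇒Up z (≤-<-trans (≤-reflexive weight-z) (s≤s (j<N y p q))))
    where
    weight-z : weight z ≡ suc j
    weight-z = trans (Up-weight u) (cong suc (weight-y (added y p q)))
      where
      weight-y : (∃[ y′ ] y ≡ y′ ∷ʳ false × weight y′ ≡ j) → weight y ≡ j
      weight-y (y′ , e , w) = trans (cong weight e) (trans (weight-snoc y′ false) w)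
    go : (∃[ v ] Up z v) → z ∈ nb P
    go (v , u′) = nb-intro P (inj₁ u′) (P⊇ v (inj₁ (≤-reflexive (sym (trans (Up-weight u′) (cong suc weight-z))))))
  from : ∀ z y → z ≡ y ⊎ Adj z y → y ∈ J size D → z ∈ nb P ⊎ z ∈ Q′
  from z y a h with ∨-true {P y} h
  from z y (inj₁ refl) h | inj₁ p = inj₁ (⊆-nb P z p)
  from z y (inj₂ a) h | inj₁ p = inj₁ (nb-intro P a p)
  from z y a h | inj₂ r with ∧-true {Q y} r
  ... | p , ¬q with not-true ¬q
  from z y (inj₁ e) h | inj₂ r | p , ¬q | q = inj₁ (above z y p q (inj₁ e))
  from z y (inj₂ (inj₂ u)) h | inj₂ r | p , ¬q | q = inj₁ (above z y p q (inj₂ u))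
  from z y (inj₂ (inj₁ u)) h | inj₂ r | p , ¬q | q = inj₂ (cong₂ _∧_ (nb-intro Q (inj₁ u) p) (cong not low))
    where
    weight-y : (∃[ y′ ] y ≡ y′ ∷ʳ false × weight y′ ≡ j) → weight y ≡ j
    weight-y (y′ , e , w) = trans (cong weight e) (trans (weight-snoc y′ false) w)
    low : atLeast j z ≡ false
    low with ∈? (atLeast j) z
    ... | inj₂ l = l
    ... | inj₁ l = ⊥-elim (<⇒≱ (≤-reflexive (trans (sym (Up-weight u)) (weight-y (added y p q)))) (≤ᵇ-true j (weight z) l))
  cover : ∀ z → z ∈ nb (J size D) → z ∈ nb P ⊎ z ∈ Q′
  cover z h = go (nb-elim (J size D) z h)
    where
    go : z ∈ J size D ⊎ (∃[ y ] Adj z y × y ∈ J size D) → z ∈ nb P ⊎ z ∈ Q′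
    go (inj₁ p) = from z z (inj₁ refl) p
    go (inj₂ (y , a , p)) = from z y (inj₂ a) p

-- The gap and the two conclusions for δ = p / q.

gap-△ : ∀ j i p q → p < q → (A : Family (suc (j + i))) → # A ≡ # atLeast {suc (j + i)} (suc j) →
  # vboundary A * (1000 * q * suc (j + i)) ≤ (1000 * q * suc (j + i) + p) * (suc (j + i) C j) →
  ∀ c → 100 * # (A △ ball c i) ≤ 101 * ((j + i) C j) → 400 * q * # (A ∖ ball c i) ≤ p * ((j + i) C j)
gap-△ j i p q p<q A #A bound c near = gap j i A #A c p q bound (*-cancelˡ-≤ 40 (begin
  40 * (5 * D)             ≡⟨ lem₁ D ⟩
  100 * (D + D)            ≡⟨ cong (100 *_) (dist j i A #A c) ⟨
  100 * # (A △ ball c i)   ≤⟨ near ⟩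
  -- The limit 5 D ≤ 3 M allows a distance of 1.2 M, so 1.01 M is within it.
  101 * M                  ≤⟨ *-monoˡ-≤ M (m≤m+n 101 19) ⟩
  120 * M                  ≡⟨ lem₂ M ⟩
  40 * (3 * M) ∎))
  where
  open ≤-Reasoning
  M = (j + i) C j
  D = # (A ∖ ball c i)
  lem₁ : ∀ D → 40 * (5 * D) ≡ 100 * (D + D)
  lem₁ = solve-∀
  lem₂ : ∀ M → 120 * M ≡ 40 * (3 * M)
  lem₂ = solve-∀

gap-small : ∀ p q D M → p < q → 400 * q * D ≤ p * M → 400 * D ≤ M
gap-small p (suc q) D M (s≤s p≤q) h = *-cancelˡ-≤ (suc q) (begin
  suc q * (400 * D)  ≡⟨ lem (suc q) D ⟩
  400 * suc q * D    ≤⟨ h ⟩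
  p * M              ≤⟨ *-monoˡ-≤ M (m≤n⇒m≤1+n p≤q) ⟩
  suc q * M ∎)
  where
  open ≤-Reasoning
  lem : ∀ q D → q * (400 * D) ≡ 400 * q * D
  lem = solve-∀

gap-strict : ∀ D M → 0 < M → 400 * D ≤ M → D < M
gap-strict D M M>0 h = ≰⇒> λ M≤D → <⇒≱ M>0 (≤-trans (m≤m+n M 0) (+-cancelˡ-≤ M (M + 0) 0 (begin
  2 * M    ≤⟨ *-monoˡ-≤ M (m≤m+n 2 398) ⟩
  400 * M  ≤⟨ *-monoʳ-≤ 400 M≤D ⟩
  400 * D  ≤⟨ h ⟩
  M        ≡⟨ +-identityʳ M ⟨
  M + 0 ∎)))
  where open ≤-Reasoning

near⇒medium : ∀ D M → 100 * D ≤ M → 100 * D ≤ 101 * M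
near⇒medium D M h = ≤-trans h (m≤m+n M (100 * M))

-- The counting function s is a parameter so that both conclusions pass from `#_` to `card`
-- together.
Stable : ∀ {N} (s : Family (suc N) → ℕ) (p q j : ℕ) (A : Family (suc N)) (m : ℕ) → Set
Stable {N} s p q j A m = Σ (Cube (suc N)) λ ctr → Σ ℕ λ r →
  (s (A △ ball ctr r) * q ≤ p * (N C j)) ×
  ((D : ℕ) → s (A △ ball ctr r) ≡ 2 * D → s (vboundary (J m D)) ≤ s (vboundary A))

module _ (j i p q : ℕ) (p<q : p < q) (A : Family (suc (j + i)))
  (#A : # A ≡ # atLeast {suc (j + i)} (suc j))
  (bound : # vboundary A * (1000 * q * suc (j + i)) ≤ (1000 * q * suc (j + i) + p) * (suc (j + i) C j)) where

  private
    N = j + i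
    M = N C j
    size = # atLeast {suc N} (suc j)

  near-some-ball : ∃[ c ] 100 * # (A △ ball c i) ≤ M
  -- With W = |nb A| every family met along the compressions has boundary at most that of A, so the
  -- hypothesis on A and with it the gap hold for all of them.
  near-some-ball = near-ball j i (# nb A) improve A #A ≤-refl
    where
    open ≤-Reasoning
    improve : ∀ B → # B ≡ size → # nb B ≤ # nb A → ∀ c →
      100 * # (B △ ball c i) ≤ 101 * M → 100 * # (B △ ball c i) ≤ M
    improve B #B nb≤ c near = begin
      100 * # (B △ ball c i)  ≡⟨ cong (100 *_) (dist j i B #B c) ⟩
      100 * (D + D)           ≡⟨ lem D ⟩
      200 * D                 ≤⟨ *-monoˡ-≤ D (m≤m+n 200 200) ⟩
      400 * D                 ≤⟨ gap-small p q D M p<q (gap-△ j i p q p<q B #B boundB c near) ⟩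
      M ∎
      where
      D = # (B ∖ ball c i)
      lem : ∀ D → 100 * (D + D) ≡ 200 * D
      lem = solve-∀
      boundary≤ : # vboundary B ≤ # vboundary A
      boundary≤ = +-cancelˡ-≤ size _ _ (begin
        size + # vboundary B   ≡⟨ cong (_+ # vboundary B) #B ⟨
        # B + # vboundary B    ≡⟨ #-nb B ⟨
        # nb B                 ≤⟨ nb≤ ⟩
        # nb A                 ≡⟨ #-nb A ⟩
        # A + # vboundary A    ≡⟨ cong (_+ # vboundary A) #A ⟩
        size + # vboundary A ∎)
      boundB : # vboundary B * (1000 * q * suc N) ≤ (1000 * q * suc N + p) * (suc N C j)
      boundB = ≤-trans (*-monoˡ-≤ (1000 * q * suc N) boundary≤) bound

  module _ (c : Cube (suc N)) (near : 100 * # (A △ ball c i) ≤ M) where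

    private
      D = # (A ∖ ball c i)

      sharp : 400 * q * D ≤ p * M
      sharp = gap-△ j i p q p<q A #A bound c (near⇒medium (# (A △ ball c i)) M near)

    distance≤ : # (A △ ball c i) * q ≤ p * M
    distance≤ = begin
      # (A △ ball c i) * q  ≡⟨ cong (_* q) (dist j i A #A c) ⟩
      (D + D) * q           ≡⟨ lem D q ⟩
      2 * q * D             ≤⟨ *-monoˡ-≤ D (*-monoˡ-≤ q (m≤m+n 2 398)) ⟩
      400 * q * D           ≤⟨ sharp ⟩
      p * M ∎
      where
      open ≤-Reasoning
      lem : ∀ D q → (D + D) * q ≡ 2 * q * D
      lem = solve-∀

    boundary-J≤ : # vboundary (J {suc N} size D) ≤ # vboundary A
    boundary-J≤ = +-cancelˡ-≤ (size + # atLeast {suc N} j) _ _ (begin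
      (size + # atLeast {suc N} j) + # vboundary (J {suc N} size D)
        ≤⟨ +-monoˡ-≤ (# vboundary (J {suc N} size D)) (+-monoˡ-≤ (# atLeast {suc N} j) #J) ⟩
      (# J {suc N} size D + # atLeast {suc N} j) + # vboundary (J {suc N} size D)
        ≡⟨ lem (# J {suc N} size D) (# atLeast {suc N} j) (# vboundary (J {suc N} size D)) ⟩
      (# J {suc N} size D + # vboundary (J {suc N} size D)) + # atLeast {suc N} j
        ≡⟨ cong (_+ # atLeast {suc N} j) (#-nb (J {suc N} size D)) ⟨
      # nb (J {suc N} size D) + # atLeast {suc N} j
        ≤⟨ nb-J j i D D<M #P #Q #R ⟩
      # nb (initSeg {suc N} (size ∸ D)) + # nb (initSeg {suc N} (size + D))
        ≤⟨ +-mono-≤ nb-P nb-Q ⟩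
      # nb (λ z → A z ∧ ball c i z) + # nb (A ∪ ball c i)
        ≤⟨ nb-∩∪ j i A #A c ⟩
      # nb A + # atLeast {suc N} j
        ≡⟨ cong (_+ # atLeast {suc N} j) (trans (#-nb A) (cong (_+ # vboundary A) #A)) ⟩
      (size + # vboundary A) + # atLeast {suc N} j
        ≡⟨ lem size (# atLeast {suc N} j) (# vboundary A) ⟨
      (size + # atLeast {suc N} j) + # vboundary A ∎)
      where
      open ≤-Reasoning
      lem : ∀ a b v → (a + b) + v ≡ (a + v) + b
      lem = solve-∀
      D<M : D < M
      D<M = gap-strict D M (M>0 j i) (gap-small p q D M p<q sharp)
      I : Family (suc N)
      I z = A z ∧ ball c i z
      #I : # I ≡ size ∸ D
      #I = trans (sym (m+n∸n≡m (# I) D)) (cong (_∸ D) (#A∩H j i A #A c))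
      D≤size : D ≤ size
      D≤size = ≤-trans (m≤n+m D (# I)) (≤-reflexive (#A∩H j i A #A c))
      segment : ∀ (X : Family (suc N)) m → # X ≡ m → # initSeg {suc N} m ≡ m × # nb (initSeg {suc N} m) ≤ # nb X
      segment X m refl = harper X
      #P : # initSeg {suc N} (size ∸ D) + D ≡ size
      #P = trans (cong (_+ D) (proj₁ (segment I (size ∸ D) #I))) (m∸n+n≡m D≤size)
      nb-P : # nb (initSeg {suc N} (size ∸ D)) ≤ # nb I
      nb-P = proj₂ (segment I (size ∸ D) #I)
      #Q : # initSeg {suc N} (size + D) ≡ size + D
      #Q = proj₁ (segment (A ∪ ball c i) (size + D) (#A∪H j i A #A c))
      nb-Q : # nb (initSeg {suc N} (size + D)) ≤ # nb (A ∪ ball c i)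
      nb-Q = proj₂ (segment (A ∪ ball c i) (size + D) (#A∪H j i A #A c))
      #R : # initSeg {suc N} size ≡ size
      #R = proj₁ (segment A size #A)
      P Q R : Family (suc N)
      P = initSeg (size ∸ D)
      Q = initSeg (size + D)
      R = initSeg size
      P⊆R : P ⊆ R
      P⊆R z h = <⇒<ᵇ-true (<-≤-trans (<ᵇ-true (rank z) (size ∸ D) h) (m∸n≤m size D))
      -- Since |∂J| = |nb J| - |J|, a lower bound on |J| is what the estimate calls for; it follows
      -- from |P| + |Q| ≤ |J| + |R|, which holds pointwise by P ⊆ R.
      #J : size ≤ # J {suc N} size D
      #J = +-cancelʳ-≤ size _ _ (begin
        size + size                ≡⟨ cong (_+ size) #P ⟨
        # P + D + size             ≡⟨ trans (+-assoc (# P) D size) (cong (# P +_) (trans (+-comm D size) (sym #Q))) ⟩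
        # P + # Q                  ≡⟨ sumC-+ (ind ∘ P) (ind ∘ Q) ⟨
        sumC (λ z → ind (P z) + ind (Q z))
                                   ≤⟨ sumC-mono (λ z → lem′ (P z) (Q z) (R z) (P⊆R z)) ⟩
        sumC (λ z → ind (J {suc N} size D z) + ind (R z))
                                   ≡⟨ sumC-+ (ind ∘ J {suc N} size D) (ind ∘ R) ⟩
        # J {suc N} size D + # R           ≡⟨ cong (# J {suc N} size D +_) #R ⟩
        # J {suc N} size D + size ∎)
        where
        lem′ : ∀ a b r → (a ≡ true → r ≡ true) → ind a + ind b ≤ ind (a ∨ (b ∧ not r)) + ind r
        lem′ true b r h rewrite h refl = s≤s (ind≤1 b)
        lem′ false true true h = ≤-refl
        lem′ false true false h = ≤-refl
        lem′ false false r h = z≤n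

  stability : Stable #_ p q j A size
  stability = go near-some-ball
    where
    go : (∃[ c ] 100 * # (A △ ball c i) ≤ M) → Stable #_ p q j A size
    go (c , near) = c , i , distance≤ c near , λ D e →
      subst (λ d → # vboundary (J {suc N} size d) ≤ # vboundary A)
        (double-injective {# (A ∖ ball c i)} {D} (trans (sym (dist j i A #A c)) (trans e (cong (D +_) (+-identityʳ D)))))
        (boundary-J≤ c near)

Stable-cong : ∀ {N} (s t : Family (suc N) → ℕ) p q j A m m′ → (∀ B → s B ≡ t B) → m ≡ m′ →
  Stable s p q j A m → Stable t p q j A m′
Stable-cong {N} s t p q j A m m′ s≡t refl (c , r , near , sharp) = c , r ,
  subst (λ v → v * q ≤ p * (N C j)) (s≡t (A △ ball c r)) near ,
  λ D e → subst₂ _≤_ (s≡t (vboundary (J {suc N} m D))) (s≡t (vboundary A)) (sharp D (trans (s≡t (A △ ball c r)) e))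

stability-card : ∀ N j i b → j + i ≡ N → b ≡ suc N C j → ∀ p q → p < q → (A : Family (suc N)) → card A ≡ binomGe (suc N) (suc j) →
  card (vboundary A) * (1000 * q * suc N) ≤ (1000 * q * suc N + p) * b →
  Stable card p q j A (binomGe (suc N) (suc j))
stability-card N j i b refl refl p q p<q A #A bound = Stable-cong #_ card p q j A _ _ (λ B → sym (card≡# B))
  (sym (binomGe≡#atLeast (suc N) (suc j)))
  (stability j i p q p<q A (trans (sym (card≡# A)) (trans #A (binomGe≡#atLeast (suc N) (suc j))))
    (subst (λ v → v * (1000 * q * suc N) ≤ (1000 * q * suc N + p) * (suc N C j)) (card≡# (vboundary A)) bound))

-- Encoding: δ = p / q, and the bound on the boundary is multiplied by 1000 q n. The indices of the
-- proof are j = k - 1 and i = n - k, the latter being the radius of the ball.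
theorem1p1 : (n k p q : ℕ) → 1 ≤ k → k ≤ n → 0 < p → p < q →
    (A : Family n) →
    card A ≡ binomGe n k →
    card (vboundary A) * (1000 * q * n) ≤ (1000 * q * n + p) * (n C (k ∸ 1)) →
    Σ (Cube n) λ ctr → Σ ℕ λ r →
    (card (A △ ball ctr r) * q ≤ p * ((n ∸ 1) C (k ∸ 1)))
    × ((D : ℕ) → card (A △ ball ctr r) ≡ 2 * D →
    card (vboundary (initSeg {n} (binomGe n k ∸ D)
    ∪ (initSeg (binomGe n k + D) ∖ initSeg (binomGe n k))))
    ≤ card (vboundary A))
theorem1p1 (suc N) (suc j) p q 1≤k (s≤s j≤N) 0<p p<q A #A bound =
  stability-card N j (N ∸ j) _ (m+[n∸m]≡n j≤N) refl p q p<q A #A bound
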